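{- Let $a\in\{0,1\}$ and $r\ge0$. Then $$\tfrac12\big(M_r(x)+(-1)^aM_r(-x)\big)-\delta_{r+a,0}=\sum_{\rho\in K_{2r+1}}x^{s(\rho)}\sum_{\substack{r_1+\dots+r_{f(\rho)}=r-c(\rho)\\ r_j\ge0}}\ \sum_{\mathbf v\in X^\rho_{(-1)^a}}2^{ -f(\rho)}z_\rho(\mathbf v)\prod_{j=1}^{f(\rho)}\big(M_{r_j}(x)+(-1)^{v_j}M_{r_j}(-x)\big),$$ where $\delta$ is the Kronecker delta.
   Context: Permutations are words. An occurrence of $132$ in $\pi=\pi_1\cdots\pi_n$ is a triple $i<j<k$ with $\pi_i<\pi_k<\pi_j$, and $132(\pi)$ is the number of occurrences. $\operatorname{sign}(\pi)=(-1)^{\#\text{inversions}}$, and the empty permutation has sign $1$. $M_r(x)=\sum_{n\ge0}\sum_{\pi\in\mathfrak S_n,\,132(\pi)=r}\operatorname{sign}(\pi)x^n$, i.e. the generating function of even minus odd permutations with exactly $r$ occurrences of $132$. Kernel: form the bipartite graph whose vertices are the entries of $\pi$ and the occurrences of $132$ in $\pi$, an entry being joined to each occurrence containing it. The kernel of $\pi\in\mathfrak S_n$ is the subsequence of entries lying in the connected component containing the entry $n$. Its order-isomorphic permutation $\rho\in\mathfrak S_s$ is the kernel shape, with size $s(\rho)=s$ and capacity $c(\rho)=132(\rho)$. A kernel permutation is one that is the kernel shape of some permutation. $K_t$ is the set of kernel shapes of permutations in $\mathfrak S_t$. Cells: for a kernel permutation $\rho\in\mathfrak S_s$, $1\le m\le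 s$ and $1\le l\le s+1$, the cell $C_{ml}$ is the region of positions between the $(l-1)$-st and $l$-th kernel entries and values between the $(m-1)$-st and $m$-th smallest kernel entries (boundary cases: before the first or after the last kernel position; below the smallest value). $C_{ml}$ is infeasible if an element inserted into $\rho$ at a position between $\rho(l-1)$ and $\rho(l)$, with value between $m-1$ and $m$, would form a $132$ with two entries of $\rho$; otherwise it is feasible. Distinct feasible cells are linearly ordered by $C_{ml}\prec C_{m'l'}$ iff $m\ge m'$ and $l\le l'$, giving $C^1\prec\dots\prec C^{f(\rho)}$. The $k$-th kernel entry is below $C_{ml}$ if $\rho(k)<m$ and above otherwise; it is left of $C_{ml}$ if $k<l$ and right otherwise. $l_j(\rho)$ is the number of $k$ such that the $k$-th kernel entry is above-left or below-right of $C^j$. For $\mathbf v\in\{0,1\}^{f(\rho)}$, $X^\rho_\epsilon=\{\mathbf v:(-1)^{v_1+\dots+v_{f(\rho)}+s(\rho)}=\epsilon\}$ and $z_\rho(\mathbf v)=(-1)^{\sum_{i<j}v_iv_j+\sum_jl_j(\rho)v_j}\operatorname{sign}(\rho)$. -}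

module Defs where

open import Data.Bool using (Bool; true; false; if_then_else_; _∧_; _∨_; not)
open import Data.Nat using (ℕ; zero; suc; _∸_; _<ᵇ_; _≡ᵇ_; _≤ᵇ_; _≤_)
  renaming (_+_ to _+ℕ_; _*_ to _*ℕ_)
open import Data.List using (List; []; _∷_; _++_; map; concatMap; length; foldr; take; drop; applyUpTo; reverse; zipWith)
open import Data.Product using (_×_; _,_)
open import Data.Rational using (ℚ; 0ℚ; 1ℚ; ½; -_; _+_; _*_; _-_)

filterᵇ : {A : Set} → (A → Bool) → List A → List A
filterᵇ p []       = []
filterᵇ p (x ∷ xs) = if p x then x ∷ filterᵇ p xs else filterᵇ p xs

anyᵇ : {A : Set} → (A → Bool) → List A → Bool
anyᵇ p []       = false
anyᵇ p (x ∷ xs) = p x ∨ anyᵇ p xs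

countᵇ : {A : Set} → (A → Bool) → List A → ℕ
countᵇ p xs = length (filterᵇ p xs)

memberℕ : ℕ → List ℕ → Bool
memberℕ x ys = anyᵇ (λ y → x ≡ᵇ y) ys

eqListℕ : List ℕ → List ℕ → Bool
eqListℕ []       []       = true
eqListℕ (x ∷ xs) (y ∷ ys) = (x ≡ᵇ y) ∧ eqListℕ xs ys
eqListℕ _        _        = false

range : ℕ → List ℕ
range n = applyUpTo suc n

iterate : {A : Set} → ℕ → (A → A) → A → A
iterate zero    f a = a
iterate (suc n) f a = f (iterate n f a)

Word : Set
Word = List ℕ

-- 1-based letter access  (π at i) = πᵢ  (0 outside 1..length)
_at_ : Word → ℕ → ℕ
[]       at _             = 0
(x ∷ xs) at zero          = 0
(x ∷ xs) at suc zero      = x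
(x ∷ xs) at suc (suc i)   = xs at suc i

words : ℕ → ℕ → List Word
words zero    k = [] ∷ []
words (suc n) k = concatMap (λ x → map (x ∷_) (words n k)) (range k)

distinct : Word → Bool
distinct []       = true
distinct (x ∷ xs) = not (memberℕ x xs) ∧ distinct xs

Sym : ℕ → List Word
Sym n = filterᵇ distinct (words n n)

occ132 : Word → List (ℕ × ℕ × ℕ)
occ132 π =
  concatMap (λ i → concatMap (λ j → concatMap (λ k →
    if (i <ᵇ j) ∧ (j <ᵇ k) ∧ ((π at i) <ᵇ (π at k)) ∧ ((π at k) <ᵇ (π at j))
    then (i , j , k) ∷ [] else []) R) R) R
  where R = range (length π)

n132 : Word → ℕ
n132 π = length (occ132 π)

inv : Word → ℕ
inv π = length (concatMap (λ i → concatMap (λ j →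
    if (i <ᵇ j) ∧ ((π at j) <ᵇ (π at i)) then (i , j) ∷ [] else []) R) R)
  where R = range (length π)

sgnℚ : ℕ → ℚ
sgnℚ zero          = 1ℚ
sgnℚ (suc zero)    = - 1ℚ
sgnℚ (suc (suc k)) = sgnℚ k

odd : ℕ → Bool
odd zero          = false
odd (suc zero)    = true
odd (suc (suc k)) = odd k

signℚ : Word → ℚ
signℚ π = sgnℚ (inv π)

-- one step of exploring the bipartite entry/occurrence graph:
-- add all positions of occurrences that contain an already reached position
kstep : Word → List ℕ → List ℕ
kstep π S = S ++ concatMap (λ { (i , j , k) →
    if memberℕ i S ∨ memberℕ j S ∨ memberℕ k S then i ∷ j ∷ k ∷ [] else [] })
  (occ132 π)

-- positions in the connected component of the entry n (n = length π);
-- the component is reached after at most n exploration steps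
kernelPositions : Word → List ℕ
kernelPositions π =
  iterate (length π) (kstep π)
    (filterᵇ (λ i → (π at i) ≡ᵇ length π) (range (length π)))

kernelSeq : Word → Word
kernelSeq π = map (π at_) (filterᵇ (λ i → memberℕ i (kernelPositions π)) (range (length π)))

standardize : Word → Word
standardize w = map (λ x → suc (countᵇ (λ y → y <ᵇ x) w)) w

kernelShape : Word → Word
kernelShape π = standardize (kernelSeq π)

inK : ℕ → Word → Bool
inK t ρ = anyᵇ (λ π → eqListℕ (kernelShape π) ρ) (Sym t)

-- K_t, listed without repetition (kernel shapes have size between 1 and t)
K : ℕ → List Word
K t = concatMap (λ s → filterᵇ (inK t) (Sym s)) (range t)

size : Word → ℕ
size ρ = length ρ

capacity : Word → ℕ
capacity ρ = n132 ρ

-- Cells.  A cell C_{ml} is the pair (m , l), 1 ≤ m ≤ s, 1 ≤ l ≤ s+1.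
-- Feasibility: insert a value strictly between m-1 and m at the gap between
-- positions l-1 and l; doubling all values of ρ, the inserted value is 2m-1.
-- The cell is infeasible iff this creates a new 132 (which then necessarily
-- uses the new entry and two entries of ρ).

insertCell : Word → ℕ → ℕ → Word
insertCell ρ m l = take (l ∸ 1) dbl ++ ((2 *ℕ m) ∸ 1) ∷ drop (l ∸ 1) dbl
  where dbl = map (2 *ℕ_) ρ

feasible : Word → ℕ → ℕ → Bool
feasible ρ m l = n132 (insertCell ρ m l) ≡ᵇ n132 (map (2 *ℕ_) ρ)

-- feasible cells in ≺-increasing order C¹ ≺ ⋯ ≺ C^f:
-- C_{ml} ≺ C_{m'l'} iff m ≥ m' and l ≤ l'  (l increasing, then m decreasing)
cells : Word → List (ℕ × ℕ)
cells ρ = concatMap (λ l → concatMap (λ m →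
    if feasible ρ m l then (m , l) ∷ [] else []) (reverse (range s))) (range (suc s))
  where s = length ρ

f : Word → ℕ
f ρ = length (cells ρ)

-- l_j(ρ) for the cell C^j = (m , l): number of k with the k-th kernel entry
-- above-left (ρ(k) ≥ m, k < l) or below-right (ρ(k) < m, k ≥ l) of the cell
lcell : Word → ℕ × ℕ → ℕ
lcell ρ (m , l) = countᵇ (λ k →
    ((m ≤ᵇ (ρ at k)) ∧ (k <ᵇ l)) ∨ (((ρ at k) <ᵇ m) ∧ (l ≤ᵇ k))) (range (length ρ))

vectors : ℕ → List (List Bool)
vectors zero    = [] ∷ []
vectors (suc n) = map (true ∷_) (vectors n) ++ map (false ∷_) (vectors n)

ones : List Bool → ℕ
ones []           = 0
ones (true ∷ vs)  = suc (ones vs)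
ones (false ∷ vs) = ones vs

b2n : Bool → ℕ
b2n true  = 1
b2n false = 0

pairSum : List Bool → ℕ
pairSum []       = 0
pairSum (v ∷ vs) = b2n v *ℕ ones vs +ℕ pairSum vs

-- X^ρ_ε with ε = (-1)^a : vectors v with (-1)^{|v| + s(ρ)} = (-1)^a
X : Word → ℕ → List (List Bool)
X ρ a = filterᵇ (λ v → eqB (odd (ones v +ℕ size ρ)) (odd a)) (vectors (f ρ))
  where
  eqB : Bool → Bool → Bool
  eqB true  b = b
  eqB false b = not b

zρ : Word → List Bool → ℚ
zρ ρ v = sgnℚ (pairSum v +ℕ foldr _+ℕ_ 0 (zipWith (λ c b → lcell ρ c *ℕ b2n b) (cells ρ) v))
         * signℚ ρ

compositions : ℕ → ℕ → List (List ℕ)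
compositions zero    zero    = [] ∷ []
compositions zero    (suc N) = []
compositions (suc k) N       =
  concatMap (λ r₁ → map (r₁ ∷_) (compositions k (N ∸ r₁))) (applyUpTo (λ i → i) (suc N))

Series : Set
Series = ℕ → ℚ

sumℚ : List ℚ → ℚ
sumℚ = foldr _+_ 0ℚ

_⊕_ : Series → Series → Series
(F ⊕ G) n = F n + G n

_⊛_ : ℚ → Series → Series
(c ⊛ F) n = c * F n

_⊗_ : Series → Series → Series
(F ⊗ G) n = sumℚ (applyUpTo (λ i → F i * G (n ∸ i)) (suc n))

oneS : Series
oneS zero    = 1ℚ
oneS (suc n) = 0ℚ

prodS : List Series → Series
prodS = foldr _⊗_ oneS

sumS : List Series → Series
sumS Fs n = sumℚ (map (λ F → F n) Fs)

negX : Series → Series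
negX F n = sgnℚ n * F n

xpow : ℕ → Series → Series
xpow s F n = if s ≤ᵇ n then F (n ∸ s) else 0ℚ

halfPow : ℕ → ℚ
halfPow zero    = 1ℚ
halfPow (suc k) = ½ * halfPow k

M : ℕ → Series
M r n = sumℚ (map signℚ (filterᵇ (λ π → n132 π ≡ᵇ r) (Sym n)))

deltaS : ℕ → ℕ → Series
deltaS zero zero zero    = 1ℚ
deltaS _    _    _       = 0ℚ

LHS : ℕ → ℕ → Series
LHS a r n = ½ * (M r n + sgnℚ a * negX (M r) n) - deltaS r a n

compsFor : Word → ℕ → List (List ℕ)
compsFor ρ r = if capacity ρ ≤ᵇ r then compositions (f ρ) (r ∸ capacity ρ) else []

prodTerm : List ℕ → List Bool → Series
prodTerm rs v = prodS (zipWith (λ rj vj → M rj ⊕ (sgnℚ (b2n vj) ⊛ negX (M rj))) rs v)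

RHS : ℕ → ℕ → Series
RHS a r = sumS (map (λ ρ →
    xpow (size ρ) (sumS (concatMap (λ rs → map (λ v →
        (halfPow (f ρ) * zρ ρ v) ⊛ prodTerm rs v) (X ρ a)) (compsFor ρ r))))
  (K (2 *ℕ r +ℕ 1)))

{-# OPTIONS --safe #-}
module Submission where

open import Defs
open import Data.Nat using (ℕ; _≤_)
open import Relation.Binary.PropositionalEquality using (_≡_)
open import Algebra.Bundles using (CommutativeMonoid)
import Algebra.Properties.CommutativeSemigroup as CommutativeSemigroup
open import Data.Bool using (Bool; true; false; if_then_else_; _∧_; _∨_; not; T)
open import Data.Empty using (⊥; ⊥-elim)
open import Data.List using (List; []; _∷_; _++_; _∷ʳ_; map; concatMap; length; foldr; applyUpTo; upTo; zipWith; take; drop; reverse)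
open import Data.List.Membership.Propositional using (_∈_; find; lose)
open import Data.List.Membership.Propositional.Properties
  using (∈-concatMap⁺; ∈-concatMap⁻; ∈-map⁺; ∈-map⁻; ∈-applyUpTo⁺; ∈-applyUpTo⁻; ∈-upTo⁺; ∈-upTo⁻; ∈-++⁻; ∈-++⁺ˡ; ∈-++⁺ʳ)
open import Data.List.Membership.Propositional.Properties.WithK using (unique∧set⇒bag)
open import Data.List.Properties using (applyUpTo-∷ʳ; length-++; length-applyUpTo; length-map; map-applyUpTo; map-∘; reverse-applyUpTo)
open import Data.List.Relation.Binary.BagAndSetEquality using (∼bag⇒↭)
open import Data.List.Relation.Binary.Permutation.Propositional as Perm using (_↭_)
open import Data.List.Relation.Unary.All as All using (All; []; _∷_)
open import Data.List.Relation.Unary.AllPairs as AllPairs using (AllPairs; []; _∷_)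
import Data.List.Relation.Unary.AllPairs.Properties as AllPairsₚ
open import Data.List.Relation.Unary.Any using (here; there)
import Data.List.Relation.Unary.Any.Properties as Anyₚ
open import Data.Nat hiding (ℕ; _≤_)
open import Data.Nat.Properties
open import Data.Nat.Solver using () renaming (module +-*-Solver to ℕ-Solver)
open import Data.Product using (∃; _×_; _,_; proj₁; proj₂)
open import Data.Rational using (ℚ; 0ℚ; 1ℚ; ½) renaming (_+_ to _+ℚ_; _*_ to _*ℚ_; -_ to -ℚ_; _-_ to _-ℚ_)
import Data.Rational.Properties as ℚₚ
open import Data.Rational.Solver using () renaming (module +-*-Solver to ℚ-Solver)
open import Data.Sum using (_⊎_; inj₁; inj₂; [_,_]′)
open import Data.Unit using (tt)
open import Function.Base using (_∘_; id; case_of_)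
open import Function.Bundles using (mk⇔)
open import Relation.Binary.Definitions using (tri<; tri≈; tri>)
open import Relation.Binary.PropositionalEquality hiding (_≡_)
open import Relation.Nullary using (¬_; yes; no)

-- A permutation is rebuilt from its kernel shape ρ by filling the feasible cells of ρ with arbitrary
-- permutations. Connectedness of ρ forces that no letter of ρ lies left-below a feasible cell and
-- that the letters right-above it increase (the letters left-below a feasible cell form a union of
-- components avoiding the maximum). Hence the cells form a chain, entries of an earlier cell are
-- left of and above those of a later one, and no occurrence of 132 mixes kernel entries, or entries
-- of different cells. So occurrences add up, and the inversion number is that of ρ and of the blocks
-- plus n_i n_j for each pair of cells and l_j n_j for each cell. Inserting the blocks one cell at a
-- time, from the last to the first, is therefore a bijection onto the permutations with kernel shape
-- ρ. A connected ρ with c occurrences has at most 2c + 1 letters, so K_{2r+1} contains all shapes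
-- needed for r occurrences. On the right-hand side, 2^{-f} and the sum over v select in each factor
-- the coefficients with v_j ≡ n_j mod 2.

-- The component of the maximum is never traced along paths. It enters only as an induction
-- principle: a set of positions that contains the maximum and, with one position of an occurrence,
-- all three of them, contains the whole component. This is proved for the exploration that computes
-- the kernel, transferred to the shape, and then used for cells and for the size bound. Positions
-- and values shift with every inserted block, so words are not compared letter by letter: a
-- permutation is determined by the comparisons among its letters, and it is enough to compare
-- patterns. The order of insertion makes each block contiguous both in position and in value. When
-- the block of a cell arrives, all entries outside the kernel lie right-below that cell, so two
-- kernel entries alone fix its place and the earlier blocks cannot interfere. The empty permutation
-- has no maximum and hence no kernel; it is the source of the Kronecker delta, and the constant
-- coefficient is treated apart from all others.

Rng : ℕ → ℕ → Set
Rng n q = 1 ≤ q × q ≤ n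

-- Reflection of Boolean tests

<ᵇ-true : ∀ {m n} → m < n → (m <ᵇ n) ≡ true
<ᵇ-true {m} {n} m<n with m <ᵇ n in eq
... | true  = refl
... | false = ⊥-elim (subst T eq (<⇒<ᵇ m<n))

<ᵇ-true⁻ : ∀ {m n} → (m <ᵇ n) ≡ true → m < n
<ᵇ-true⁻ {m} {n} eq = <ᵇ⇒< m n (subst T (sym eq) tt)

<ᵇ-false : ∀ {m n} → n ≤ m → (m <ᵇ n) ≡ false
<ᵇ-false {m} {n} n≤m with m <ᵇ n in eq
... | true  = ⊥-elim (<-irrefl refl (<-≤-trans (<ᵇ-true⁻ {m} {n} eq) n≤m))
... | false = refl

≤ᵇ-true : ∀ {m n} → m ≤ n → (m ≤ᵇ n) ≡ true
≤ᵇ-true {zero}  _   = refl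
≤ᵇ-true {suc m} m<n = <ᵇ-true m<n

≤ᵇ-true⁻ : ∀ {m n} → (m ≤ᵇ n) ≡ true → m ≤ n
≤ᵇ-true⁻ {m} {n} eq = ≤ᵇ⇒≤ m n (subst T (sym eq) tt)

≤ᵇ-false : ∀ {m n} → n < m → (m ≤ᵇ n) ≡ false
≤ᵇ-false {suc m} (s≤s n≤m) = <ᵇ-false n≤m

≡ᵇ-true : ∀ {m n} → m ≡ n → (m ≡ᵇ n) ≡ true
≡ᵇ-true {zero}  refl = refl
≡ᵇ-true {suc m} refl = ≡ᵇ-true {m} refl

≡ᵇ-true⁻ : ∀ {m n} → (m ≡ᵇ n) ≡ true → m ≡ n
≡ᵇ-true⁻ {m} {n} eq = ≡ᵇ⇒≡ m n (subst T (sym eq) tt)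

∧-true : ∀ {a b} → (a ∧ b) ≡ true → a ≡ true × b ≡ true
∧-true {true} eq = refl , eq

∧-intro : ∀ {a b} → a ≡ true → b ≡ true → (a ∧ b) ≡ true
∧-intro refl eq = eq

∨-true : ∀ {a b} → (a ∨ b) ≡ true → a ≡ true ⊎ b ≡ true
∨-true {true}  eq = inj₁ refl
∨-true {false} eq = inj₂ eq

∨-introˡ : ∀ {a b} → a ≡ true → (a ∨ b) ≡ true
∨-introˡ refl = refl

∨-introʳ : ∀ {a b} → b ≡ true → (a ∨ b) ≡ true
∨-introʳ {true}  _  = refl
∨-introʳ {false} eq = eq

bool-ext : ∀ {a b} → (a ≡ true → b ≡ true) → (b ≡ true → a ≡ true) → a ≡ b
bool-ext {true}  {b}     h g = sym (h refl)
bool-ext {false} {true}  h g = g refl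
bool-ext {false} {false} h g = refl

≢true : ∀ {a} → ¬ (a ≡ true) → a ≡ false
≢true {true}  h = ⊥-elim (h refl)
≢true {false} h = refl

b2n≤1 : ∀ b → b2n b ≤ 1
b2n≤1 true  = ≤-refl
b2n≤1 false = z≤n

b2n-mono : ∀ {a b} → (a ≡ true → b ≡ true) → b2n a ≤ b2n b
b2n-mono {true}  h rewrite h refl = ≤-refl
b2n-mono {false} h = z≤n

-- Sums over 1 … n

sumR : ℕ → (ℕ → ℕ) → ℕ
sumR zero    g = 0
sumR (suc n) g = sumR n g + g (suc n)

weaken : ∀ {n q} → Rng n q → Rng (suc n) q
weaken (a , b) = a , m≤n⇒m≤1+n b

last : ∀ {n} → Rng (suc n) (suc n)
last = s≤s z≤n , ≤-refl

sumR-cong : ∀ n {g h : ℕ → ℕ} → (∀ q → Rng n q → g q ≡ h q) → sumR n g ≡ sumR n h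
sumR-cong zero    eq = refl
sumR-cong (suc n) eq = cong₂ _+_ (sumR-cong n λ q r → eq q (weaken r)) (eq (suc n) last)

+-interchange : ∀ a b c d → (a + b) + (c + d) ≡ (a + c) + (b + d)
+-interchange = CommutativeSemigroup.interchange +-commutativeSemigroup

sumR-+ : ∀ n (g h : ℕ → ℕ) → sumR n (λ q → g q + h q) ≡ sumR n g + sumR n h
sumR-+ zero    g h = refl
sumR-+ (suc n) g h = trans (cong (_+ (g (suc n) + h (suc n))) (sumR-+ n g h))
  (+-interchange (sumR n g) (sumR n h) (g (suc n)) (h (suc n)))

sumR-const : ∀ n c → sumR n (λ _ → c) ≡ n * c
sumR-const zero    c = refl
sumR-const (suc n) c = trans (cong (_+ c) (sumR-const n c)) (+-comm (n * c) c)

sumR-*ʳ : ∀ n (g : ℕ → ℕ) c → sumR n (λ q → g q * c) ≡ sumR n g * c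
sumR-*ʳ zero    g c = refl
sumR-*ʳ (suc n) g c = trans (cong (_+ g (suc n) * c) (sumR-*ʳ n g c)) (sym (*-distribʳ-+ c (sumR n g) _))

sumR-0 : ∀ n {g : ℕ → ℕ} → (∀ q → Rng n q → g q ≡ 0) → sumR n g ≡ 0
sumR-0 n eq = trans (sumR-cong n eq) (trans (sumR-const n 0) (*-zeroʳ n))

sumR-0⁻ : ∀ n {g : ℕ → ℕ} → sumR n g ≡ 0 → ∀ q → Rng n q → g q ≡ 0
sumR-0⁻ zero    eq q (a , b) = ⊥-elim (<-irrefl refl (≤-trans a b))
sumR-0⁻ (suc n) {g} eq q (a , b) with m≤n⇒m<n∨m≡n b
... | inj₁ (s≤s q≤n) = sumR-0⁻ n (m+n≡0⇒m≡0 (sumR n g) eq) q (a , q≤n)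
... | inj₂ refl      = m+n≡0⇒n≡0 (sumR n g) eq

-- Turns counting into existence: preimages under a permutation and occurrences crossing a set are
-- both found in this way.
sumR-witness : ∀ n {g : ℕ → ℕ} → ¬ (sumR n g ≡ 0) → ∃ λ q → Rng n q × ¬ (g q ≡ 0)
sumR-witness zero    ne = ⊥-elim (ne refl)
sumR-witness (suc n) {g} ne with g (suc n) ≟ 0
... | no  h = suc n , last , h
... | yes h with sumR-witness n {g} (λ e → ne (cong₂ _+_ e h))
...   | q , r , h′ = q , weaken r , h′

sumR-mono : ∀ n {g h : ℕ → ℕ} → (∀ q → Rng n q → g q ≤ h q) → sumR n g ≤ sumR n h
sumR-mono zero    le = z≤n
sumR-mono (suc n) le = +-mono-≤ (sumR-mono n λ q r → le q (weaken r)) (le (suc n) last)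

sumR-mono-< : ∀ n {g h : ℕ → ℕ} → (∀ q → Rng n q → g q ≤ h q) →
              ∀ x → Rng n x → g x < h x → sumR n g < sumR n h
sumR-mono-< zero    le x (a , b) lt = ⊥-elim (<-irrefl refl (≤-trans a b))
sumR-mono-< (suc n) le x (a , b) lt with m≤n⇒m<n∨m≡n b
... | inj₁ (s≤s x≤n) = +-mono-<-≤ (sumR-mono-< n (λ q r → le q (weaken r)) x (a , x≤n) lt) (le (suc n) last)
... | inj₂ refl      = +-mono-≤-< (sumR-mono n λ q r → le q (weaken r)) lt

sumR-add : ∀ a b (g : ℕ → ℕ) → sumR (a + b) g ≡ sumR a g + sumR b (λ x → g (a + x))
sumR-add a zero    g = trans (cong (λ z → sumR z g) (+-identityʳ a)) (sym (+-identityʳ _))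
sumR-add a (suc b) g = begin
  sumR (a + suc b) g                                 ≡⟨ cong (λ z → sumR z g) (+-suc a b) ⟩
  sumR (a + b) g + g (suc (a + b))                   ≡⟨ cong₂ (λ y z → y + g z) (sumR-add a b g) (sym (+-suc a b)) ⟩
  sumR a g + sumR b (λ x → g (a + x)) + g (a + suc b) ≡⟨ +-assoc (sumR a g) _ _ ⟩
  sumR a g + (sumR b (λ x → g (a + x)) + g (a + suc b)) ∎
  where open ≡-Reasoning

sumR-swap : ∀ n m (g : ℕ → ℕ → ℕ) → sumR n (λ x → sumR m (g x)) ≡ sumR m (λ y → sumR n (λ x → g x y))
sumR-swap zero    m g = sym (sumR-0 m λ _ _ → refl)
sumR-swap (suc n) m g = trans (cong (_+ sumR m (g (suc n))) (sumR-swap n m g))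
  (sym (sumR-+ m (λ y → sumR n (λ x → g x y)) (g (suc n))))

total : {A : Set} → (A → ℕ) → List A → ℕ
total g []       = 0
total g (x ∷ xs) = g x + total g xs

total-++ : {A : Set} (g : A → ℕ) (xs ys : List A) → total g (xs ++ ys) ≡ total g xs + total g ys
total-++ g []       ys = refl
total-++ g (x ∷ xs) ys = trans (cong (g x +_) (total-++ g xs ys)) (sym (+-assoc (g x) _ _))

total-range : ∀ n (g : ℕ → ℕ) → total g (range n) ≡ sumR n g
total-range zero    g = refl
total-range (suc n) g = begin
  total g (range (suc n))         ≡⟨ cong (total g) (sym (applyUpTo-∷ʳ suc n)) ⟩
  total g (range n ∷ʳ suc n)      ≡⟨ total-++ g (range n) (suc n ∷ []) ⟩
  total g (range n) + (g (suc n) + 0) ≡⟨ cong₂ _+_ (total-range n g) (+-identityʳ _) ⟩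
  sumR n g + g (suc n)            ∎
  where open ≡-Reasoning

length-concatMap : {A B : Set} (F : A → List B) (xs : List A) →
                   length (concatMap F xs) ≡ total (λ x → length (F x)) xs
length-concatMap F []       = refl
length-concatMap F (x ∷ xs) = trans (length-++ (F x)) (cong (length (F x) +_) (length-concatMap F xs))

length-concatMap-range : {B : Set} (F : ℕ → List B) (n : ℕ) →
                         length (concatMap F (range n)) ≡ sumR n (λ i → length (F i))
length-concatMap-range F n = trans (length-concatMap F (range n)) (total-range n _)

length-singleton-if : {A : Set} (b : Bool) (x : A) → length (if b then x ∷ [] else []) ≡ b2n b
length-singleton-if true  x = refl
length-singleton-if false x = refl

countᵇ-total : {A : Set} (p : A → Bool) (xs : List A) → countᵇ p xs ≡ total (λ x → b2n (p x)) xs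
countᵇ-total p []       = refl
countᵇ-total p (x ∷ xs) with p x
... | true  = cong suc (countᵇ-total p xs)
... | false = countᵇ-total p xs

countᵇ-range : (p : ℕ → Bool) (n : ℕ) → countᵇ p (range n) ≡ sumR n (λ x → b2n (p x))
countᵇ-range p n = trans (countᵇ-total p (range n)) (total-range n _)

-- Occurrences of 132 and inversions

occᵇ : (ℕ → ℕ) → ℕ → ℕ → ℕ → Bool
occᵇ u i j k = (i <ᵇ j) ∧ (j <ᵇ k) ∧ (u i <ᵇ u k) ∧ (u k <ᵇ u j)

Occ : (ℕ → ℕ) → ℕ → ℕ → ℕ → Set
Occ u i j k = i < j × j < k × u i < u k × u k < u j

occᵇ⇒Occ : ∀ u i j k → occᵇ u i j k ≡ true → Occ u i j k
occᵇ⇒Occ u i j k eq =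
  let (a , eq₁) = ∧-true {i <ᵇ j} eq
      (b , eq₂) = ∧-true {j <ᵇ k} eq₁
      (c , d)   = ∧-true {u i <ᵇ u k} eq₂
  in <ᵇ-true⁻ a , <ᵇ-true⁻ b , <ᵇ-true⁻ {u i} c , <ᵇ-true⁻ {u k} d

Occ⇒occᵇ : ∀ u i j k → Occ u i j k → occᵇ u i j k ≡ true
Occ⇒occᵇ u i j k (a , b , c , d) =
  ∧-intro (<ᵇ-true a) (∧-intro (<ᵇ-true b) (∧-intro (<ᵇ-true c) (<ᵇ-true d)))

¬Occ⇒0 : ∀ u i j k → ¬ Occ u i j k → b2n (occᵇ u i j k) ≡ 0
¬Occ⇒0 u i j k h = cong b2n (≢true (h ∘ occᵇ⇒Occ u i j k))

0⇒¬Occ : ∀ u i j k → b2n (occᵇ u i j k) ≡ 0 → ¬ Occ u i j k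
0⇒¬Occ u i j k e o rewrite Occ⇒occᵇ u i j k o = case e of λ ()

-- Counting is done for functions on positions rather than for words, so that splitting positions
-- into old and new ones is a substitution in the summation variables.
N3 : ℕ → (ℕ → ℕ) → ℕ
N3 n u = sumR n λ i → sumR n λ j → sumR n λ k → b2n (occᵇ u i j k)

invᵇ : (ℕ → ℕ) → ℕ → ℕ → Bool
invᵇ u i j = (i <ᵇ j) ∧ (u j <ᵇ u i)

N2 : ℕ → (ℕ → ℕ) → ℕ
N2 n u = sumR n λ i → sumR n λ j → b2n (invᵇ u i j)

n132-N3 : ∀ π → n132 π ≡ N3 (length π) (π at_)
n132-N3 π = trans (length-concatMap-range _ n) (sumR-cong n λ i _ →
            trans (length-concatMap-range _ n) (sumR-cong n λ j _ →
            trans (length-concatMap-range _ n) (sumR-cong n λ k _ →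
            length-singleton-if (occᵇ (π at_) i j k) (i , j , k))))
  where n = length π

inv-N2 : ∀ π → inv π ≡ N2 (length π) (π at_)
inv-N2 π = trans (length-concatMap-range _ n) (sumR-cong n λ i _ →
           trans (length-concatMap-range _ n) (sumR-cong n λ j _ →
           length-singleton-if (invᵇ (π at_) i j) (i , j)))
  where n = length π

-- Membership, absence of repetitions and sorted lists

∈-concatMap-intro : {A B : Set} (F : A → List B) {xs : List A} {x : A} {y : B} →
                    x ∈ xs → y ∈ F x → y ∈ concatMap F xs
∈-concatMap-intro F x∈ y∈ = ∈-concatMap⁺ F (lose x∈ y∈)

∈-concatMap-elim : {A B : Set} (F : A → List B) {xs : List A} {y : B} →
                   y ∈ concatMap F xs → ∃ λ x → x ∈ xs × y ∈ F x
∈-concatMap-elim F y∈ = find (∈-concatMap⁻ F y∈)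

∈-range : ∀ {n q} → Rng n q → q ∈ range n
∈-range {n} {suc q} (_ , q<n) = ∈-applyUpTo⁺ suc q<n

∈-range⁻ : ∀ {n q} → q ∈ range n → Rng n q
∈-range⁻ q∈ with ∈-applyUpTo⁻ suc q∈
... | _ , i<n , refl = s≤s z≤n , i<n

∈-filterᵇ : {A : Set} (p : A → Bool) {xs : List A} {x : A} → x ∈ xs → p x ≡ true → x ∈ filterᵇ p xs
∈-filterᵇ p {y ∷ ys} (here refl) eq rewrite eq = here refl
∈-filterᵇ p {y ∷ ys} (there x∈)  eq with p y
... | true  = there (∈-filterᵇ p x∈ eq)
... | false = ∈-filterᵇ p x∈ eq

∈-filterᵇ⁻ : {A : Set} (p : A → Bool) {xs : List A} {x : A} → x ∈ filterᵇ p xs → x ∈ xs × p x ≡ true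
∈-filterᵇ⁻ p {y ∷ ys} x∈ with p y in eq
∈-filterᵇ⁻ p {y ∷ ys} (here refl) | true  = here refl , eq
∈-filterᵇ⁻ p {y ∷ ys} (there x∈)  | true  = let (a , b) = ∈-filterᵇ⁻ p x∈ in there a , b
∈-filterᵇ⁻ p {y ∷ ys} x∈          | false = let (a , b) = ∈-filterᵇ⁻ p x∈ in there a , b

memberℕ-true : ∀ {x ys} → x ∈ ys → memberℕ x ys ≡ true
memberℕ-true {x} (here refl)      = ∨-introˡ (≡ᵇ-true {x} refl)
memberℕ-true {x} {y ∷ _} (there x∈) = ∨-introʳ {x ≡ᵇ y} (memberℕ-true x∈)

memberℕ-true⁻ : ∀ {x ys} → memberℕ x ys ≡ true → x ∈ ys
memberℕ-true⁻ {x} {y ∷ ys} eq with ∨-true {x ≡ᵇ y} eq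
... | inj₁ h = here (≡ᵇ-true⁻ h)
... | inj₂ h = there (memberℕ-true⁻ h)

filterᵇ-AllPairs : {A : Set} {R : A → A → Set} (p : A → Bool) {xs : List A} →
                   AllPairs R xs → AllPairs R (filterᵇ p xs)
filterᵇ-AllPairs p [] = []
filterᵇ-AllPairs {R = R} p {x ∷ xs} (r ∷ rs) with p x
... | false = filterᵇ-AllPairs p rs
... | true  = All.tabulate (λ y∈ → All.lookup r (proj₁ (∈-filterᵇ⁻ p y∈))) ∷ filterᵇ-AllPairs p rs

AllPairs-concatMap : {A B : Set} {Q : A → A → Set} {R : B → B → Set} (F : A → List B) (xs : List A) →
  AllPairs Q xs → (∀ x → x ∈ xs → AllPairs R (F x)) →
  (∀ x y → x ∈ xs → y ∈ xs → Q x y → ∀ a b → a ∈ F x → b ∈ F y → R a b) → AllPairs R (concatMap F xs)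
AllPairs-concatMap F [] [] h g = []
AllPairs-concatMap F (x ∷ xs) (q ∷ qs) h g =
  AllPairsₚ.++⁺ (h x (here refl))
    (AllPairs-concatMap F xs qs (λ y y∈ → h y (there y∈)) (λ y z y∈ z∈ → g y z (there y∈) (there z∈)))
    (All.tabulate λ a∈ → All.tabulate λ b∈ →
      let (y , y∈ , b∈′) = ∈-concatMap-elim F {xs} b∈
      in g x y (here refl) (there y∈) (All.lookup q y∈) _ _ a∈ b∈′)

-- The map `tag` recovers from an element the index of the piece that it comes from, which makes the
-- pieces disjoint.
concatMap-unique : {A B : Set} (F : A → List B) (xs : List A) (tag : B → A) →
  AllPairs _≢_ xs → (∀ x → x ∈ xs → AllPairs _≢_ (F x)) →
  (∀ x y → y ∈ F x → tag y ≡ x) → AllPairs _≢_ (concatMap F xs)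
concatMap-unique F xs tag u h g = AllPairs-concatMap F xs u h
  λ x y _ _ x≢y a b a∈ b∈ a≡b → x≢y (trans (sym (g x a a∈)) (trans (cong tag a≡b) (g y b b∈)))

map-unique : {A B : Set} (F : A → B) {xs : List A} → (∀ {x y} → F x ≡ F y → x ≡ y) →
             AllPairs _≢_ xs → AllPairs _≢_ (map F xs)
map-unique F inj u = AllPairsₚ.map⁺ (AllPairs.map (λ x≢y e → x≢y (inj e)) u)

range-sorted : ∀ n → AllPairs _<_ (range n)
range-sorted n = AllPairsₚ.applyUpTo⁺₁ suc n (λ i<j _ → s≤s i<j)

range-unique : ∀ n → AllPairs _≢_ (range n)
range-unique n = AllPairs.map <⇒≢ (range-sorted n)

-- The heads agree since each is the minimum of the same set. This identifies the list of kernel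
-- positions, which is otherwise known only through its members.
sorted-ext : {xs ys : List ℕ} → AllPairs _<_ xs → AllPairs _<_ ys →
             (∀ {x} → x ∈ xs → x ∈ ys) → (∀ {x} → x ∈ ys → x ∈ xs) → xs ≡ ys
sorted-ext {[]} {[]} _ _ h g = refl
sorted-ext {[]} {y ∷ ys} _ _ h g = case g (here refl) of λ ()
sorted-ext {x ∷ xs} {[]} _ _ h g = case h (here refl) of λ ()
sorted-ext {x ∷ xs} {y ∷ ys} (p ∷ ps) (q ∷ qs) h g = cong₂ _∷_ x≡y
  (sorted-ext ps qs
    (λ z∈ → case h (there z∈) of λ { (here e) → ⊥-elim (<⇒≢ (All.lookup p z∈) (trans x≡y (sym e))) ; (there r) → r })
    (λ z∈ → case g (there z∈) of λ { (here e) → ⊥-elim (<⇒≢ (All.lookup q z∈) (trans (sym x≡y) (sym e))) ; (there r) → r }))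
  where
  x≡y : x ≡ y
  x≡y with h (here refl) | g (here refl)
  ... | here e   | _        = e
  ... | there _  | here e   = sym e
  ... | there x∈ | there y∈ = ⊥-elim (<-asym (All.lookup q x∈) (All.lookup p y∈))

-- Words given by their letters

tab : ℕ → (ℕ → ℕ) → Word
tab n g = map g (range n)

length-tab : ∀ n g → length (tab n g) ≡ n
length-tab n g = trans (length-map g (range n)) (length-applyUpTo suc n)

tab-applyUpTo : ∀ n g → tab n g ≡ applyUpTo (g ∘ suc) n
tab-applyUpTo n g = map-applyUpTo suc g n

applyUpTo-at : ∀ (g : ℕ → ℕ) n i → i < n → applyUpTo g n at suc i ≡ g i
applyUpTo-at g (suc n) zero    _         = refl
applyUpTo-at g (suc n) (suc i) (s≤s i<n) = applyUpTo-at (g ∘ suc) n i i<n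

at-tab : ∀ n g q → Rng n q → tab n g at q ≡ g q
at-tab n g (suc i) (_ , i<n) rewrite tab-applyUpTo n g = applyUpTo-at (g ∘ suc) n i i<n

word-ext : ∀ u w → length u ≡ length w → (∀ q → Rng (length u) q → u at q ≡ w at q) → u ≡ w
word-ext []      []      _ _ = refl
word-ext (x ∷ u) (y ∷ w) l h = cong₂ _∷_ (h 1 (s≤s z≤n , s≤s z≤n))
  (word-ext u w (suc-injective l) λ { (suc q) (_ , b) → h (suc (suc q)) (s≤s z≤n , s≤s b) })

tab-at : ∀ w → tab (length w) (w at_) ≡ w
tab-at w = word-ext _ _ (length-tab _ _) λ q r → at-tab _ _ q (subst (λ z → Rng z q) (length-tab (length w) _) r)

map-as-tab : ∀ (g : ℕ → ℕ) (w : Word) → map g w ≡ tab (length w) (λ q → g (w at q))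
map-as-tab g w = word-ext _ _ (trans (length-map g w) (sym (length-tab _ _)))
  λ q r → let r′ = subst (λ z → Rng z q) (length-map g w) r in
          trans (at-map w q r′) (sym (at-tab (length w) _ q r′))
  where
  at-map : ∀ (w : Word) q → Rng (length w) q → map g w at q ≡ g (w at q)
  at-map (x ∷ w) (suc zero)    _ = refl
  at-map (x ∷ w) (suc (suc q)) (_ , s≤s b) = at-map w (suc q) (s≤s z≤n , b)

at-∈ : ∀ (w : Word) q → Rng (length w) q → (w at q) ∈ w
at-∈ (x ∷ w) (suc zero)    _           = here refl
at-∈ (x ∷ w) (suc (suc q)) (_ , s≤s b) = there (at-∈ w (suc q) (s≤s z≤n , b))

∈-at : ∀ {w : Word} {x} → x ∈ w → ∃ λ q → Rng (length w) q × w at q ≡ x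
∈-at (here refl) = 1 , (s≤s z≤n , s≤s z≤n) , refl
∈-at (there x∈) with ∈-at x∈
... | suc q , (_ , b) , e = suc (suc q) , (s≤s z≤n , s≤s b) , e

sorted-at : ∀ {w : Word} → AllPairs _<_ w → ∀ q q′ → Rng (length w) q → Rng (length w) q′ → q < q′ → w at q < w at q′
sorted-at {x ∷ w} (r ∷ rs) (suc zero) (suc (suc q′)) _ (_ , s≤s b) _ = All.lookup r (at-∈ w (suc q′) (s≤s z≤n , b))
sorted-at {x ∷ w} (r ∷ rs) (suc zero) (suc zero) _ _ (s≤s ())
sorted-at {x ∷ w} (r ∷ rs) (suc (suc q)) (suc (suc q′)) (_ , s≤s a) (_ , s≤s b) (s≤s lt) =
  sorted-at rs (suc q) (suc q′) (s≤s z≤n , a) (s≤s z≤n , b) lt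
sorted-at {x ∷ w} (r ∷ rs) (suc (suc q)) (suc zero) _ _ (s≤s ())

total-word : ∀ (w : Word) (g : ℕ → ℕ) → total g w ≡ sumR (length w) (λ q → g (w at q))
total-word w g = begin
  total g w                             ≡⟨ cong (total g) (sym (tab-at w)) ⟩
  total g (map (w at_) (range (length w))) ≡⟨ total-map (range (length w)) ⟩
  total (λ q → g (w at q)) (range (length w)) ≡⟨ total-range (length w) _ ⟩
  sumR (length w) (λ q → g (w at q))    ∎
  where
  open ≡-Reasoning
  total-map : ∀ xs → total g (map (w at_) xs) ≡ total (λ q → g (w at q)) xs
  total-map []       = refl
  total-map (x ∷ xs) = cong (g (w at x) +_) (total-map xs)

-- Permutations

IsPerm : ℕ → (ℕ → ℕ) → Set
IsPerm n g = (∀ q → Rng n q → Rng n (g q)) × (∀ q q′ → Rng n q → Rng n q′ → g q ≡ g q′ → q ≡ q′)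

∈-words : ∀ n k w → length w ≡ n → (∀ q → Rng n q → Rng k (w at q)) → w ∈ words n k
∈-words zero    k []      l h = here refl
∈-words (suc n) k (x ∷ w) l h = ∈-concatMap-intro (λ x → map (x ∷_) (words n k)) {range k}
  (∈-range (h 1 (s≤s z≤n , s≤s z≤n)))
  (∈-map⁺ (x ∷_) (∈-words n k w (suc-injective l) λ { (suc q) (_ , b) → h (suc (suc q)) (s≤s z≤n , s≤s b) }))

∈-words⁻ : ∀ n k w → w ∈ words n k → length w ≡ n × (∀ q → Rng n q → Rng k (w at q))
∈-words⁻ zero    k w (here refl) = refl , λ { q (a , b) → ⊥-elim (<-irrefl refl (≤-trans a b)) }
∈-words⁻ (suc n) k w w∈ with ∈-concatMap-elim (λ x → map (x ∷_) (words n k)) {range k} w∈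
... | x , x∈ , w∈′ with ∈-map⁻ (x ∷_) w∈′
...   | w′ , w′∈ , refl with ∈-words⁻ n k w′ w′∈
...     | l , h = cong suc l , λ { (suc zero) _ → ∈-range⁻ x∈ ; (suc (suc q)) (_ , s≤s b) → h (suc q) (s≤s z≤n , b) }

words-unique : ∀ n k → AllPairs _≢_ (words n k)
words-unique zero    k = [] ∷ []
words-unique (suc n) k = concatMap-unique (λ x → map (x ∷_) (words n k)) (range k) (_at 1) (range-unique k)
  (λ x _ → map-unique (x ∷_) (λ { refl → refl }) (words-unique n k))
  λ x y y∈ → case ∈-map⁻ (x ∷_) y∈ of λ { (_ , _ , refl) → refl }

Injᵂ : Word → Set
Injᵂ w = ∀ q q′ → Rng (length w) q → Rng (length w) q′ → w at q ≡ w at q′ → q ≡ q′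

distinct-true : ∀ w → Injᵂ w → distinct w ≡ true
distinct-true []      h = refl
distinct-true (x ∷ w) h with memberℕ x w in eq
... | true  = let (q , (a , b) , e) = ∈-at (memberℕ-true⁻ {x} {w} eq)
                  1≡ = h 1 (suc q) (s≤s z≤n , s≤s z≤n) (s≤s z≤n , s≤s b) (sym (trans (at-suc q a) e))
              in ⊥-elim (<-irrefl (suc-injective 1≡) a)
  where
  at-suc : ∀ q → 1 ≤ q → (x ∷ w) at suc q ≡ w at q
  at-suc (suc q) _ = refl
... | false = distinct-true w λ { (suc q) (suc q′) (_ , b) (_ , b′) e →
                suc-injective (h (suc (suc q)) (suc (suc q′)) (s≤s z≤n , s≤s b) (s≤s z≤n , s≤s b′) e) }

distinct-true⁻ : ∀ w → distinct w ≡ true → Injᵂ w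
distinct-true⁻ [] d = λ q q′ r _ _ → ⊥-elim (<-irrefl refl (≤-trans (proj₁ r) (proj₂ r)))
distinct-true⁻ (x ∷ w) d with memberℕ x w in eq
distinct-true⁻ (x ∷ w) d | false = go
  where
  no-x : ∀ q → Rng (length w) q → ¬ (w at q ≡ x)
  no-x q r e = case trans (sym eq) (memberℕ-true (subst (_∈ w) e (at-∈ w q r))) of λ ()
  go : Injᵂ (x ∷ w)
  go (suc zero) (suc zero) _ _ _ = refl
  go (suc zero) (suc (suc q′)) _ (_ , s≤s b) e = ⊥-elim (no-x (suc q′) (s≤s z≤n , b) (sym e))
  go (suc (suc q)) (suc zero) (_ , s≤s b) _ e = ⊥-elim (no-x (suc q) (s≤s z≤n , b) e)
  go (suc (suc q)) (suc (suc q′)) (_ , s≤s b) (_ , s≤s b′) e =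
    cong suc (distinct-true⁻ w d (suc q) (suc q′) (s≤s z≤n , b) (s≤s z≤n , b′) e)

∈-Sym : ∀ n w → length w ≡ n → IsPerm n (w at_) → w ∈ Sym n
∈-Sym n w refl (r , i) = ∈-filterᵇ distinct (∈-words n n w refl r) (distinct-true w i)

∈-Sym⁻ : ∀ n w → w ∈ Sym n → length w ≡ n × IsPerm n (w at_)
∈-Sym⁻ n w w∈ with ∈-filterᵇ⁻ distinct w∈
... | w∈′ , d with ∈-words⁻ n n w w∈′
...   | refl , r = refl , r , distinct-true⁻ w d

Sym-unique : ∀ n → AllPairs _≢_ (Sym n)
Sym-unique n = filterᵇ-AllPairs distinct (words-unique n n)

-- Ranks

rank : ℕ → (ℕ → ℕ) → ℕ → ℕ
rank n g x = sumR n (λ k → b2n (g k <ᵇ x))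

Injective-on : ℕ → (ℕ → ℕ) → Set
Injective-on n g = ∀ q q′ → Rng n q → Rng n q′ → g q ≡ g q′ → q ≡ q′

sum-eq≤1 : ∀ n (g : ℕ → ℕ) x → Injective-on n g → sumR n (λ k → b2n (g k ≡ᵇ x)) ≤ 1
sum-eq≤1 zero    g x inj = z≤n
sum-eq≤1 (suc n) g x inj with g (suc n) ≡ᵇ x in eq
... | false = subst (_≤ 1) (sym (+-identityʳ _)) (sum-eq≤1 n g x λ q q′ r r′ → inj q q′ (weaken r) (weaken r′))
... | true  = ≤-reflexive (cong (_+ 1) (sumR-0 n λ q r → cong b2n (≢true λ e →
    <⇒≢ (s≤s (proj₂ r)) (inj q (suc n) (weaken r) last (trans (≡ᵇ-true⁻ {g q} e) (sym (≡ᵇ-true⁻ {g (suc n)} eq)))))))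

<ᵇ-suc : ∀ m x → b2n (m <ᵇ suc x) ≡ b2n (m <ᵇ x) + b2n (m ≡ᵇ x)
<ᵇ-suc m x with <-cmp m x
... | tri< a b _ rewrite <ᵇ-true (m≤n⇒m≤1+n a) | <ᵇ-true a | ≢true (λ e → b (≡ᵇ-true⁻ {m} e)) = refl
... | tri≈ _ refl _ rewrite <ᵇ-true (n<1+n m) | <ᵇ-false (≤-refl {m}) | ≡ᵇ-true {m} refl = refl
... | tri> _ b c rewrite <ᵇ-false c | <ᵇ-false (<⇒≤ c) | ≢true (λ e → b (≡ᵇ-true⁻ {m} e)) = refl

rank-suc : ∀ n g x → rank n g (suc x) ≡ rank n g x + sumR n (λ k → b2n (g k ≡ᵇ x))
rank-suc n g x = trans (sumR-cong n λ k _ → <ᵇ-suc (g k) x) (sumR-+ n _ _)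

rank-+ : ∀ n g x d → Injective-on n g → rank n g (d + x) ≤ d + rank n g x
rank-+ n g x zero    inj = ≤-refl
rank-+ n g x (suc d) inj = begin
  rank n g (suc (d + x))                                   ≡⟨ rank-suc n g (d + x) ⟩
  rank n g (d + x) + sumR n (λ k → b2n (g k ≡ᵇ d + x))     ≤⟨ +-mono-≤ (rank-+ n g x d inj) (sum-eq≤1 n g (d + x) inj) ⟩
  (d + rank n g x) + 1                                     ≡⟨ +-comm _ 1 ⟩
  suc (d + rank n g x)                                     ∎
  where open ≤-Reasoning

-- By injectivity each unit step of the threshold raises the rank by at most one. The rank is 0 at
-- threshold 1 and n at threshold n + 1, so every one of the n steps raises it by exactly one. This
-- is the pigeonhole principle for `IsPerm`.
rank-perm : ∀ n g → IsPerm n g → ∀ x → x ≤ n → rank n g (suc x) ≡ x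
rank-perm n g (r , inj) x x≤n = ≤-antisym upper lower
  where
  open ≤-Reasoning
  rank1 : rank n g 1 ≡ 0
  rank1 = sumR-0 n λ q p → cong b2n (<ᵇ-false (proj₁ (r q p)))
  upper : rank n g (suc x) ≤ x
  upper = begin
    rank n g (suc x) ≡⟨ cong (rank n g) (+-comm 1 x) ⟩
    rank n g (x + 1) ≤⟨ rank-+ n g 1 x inj ⟩
    x + rank n g 1   ≡⟨ cong (x +_) rank1 ⟩
    x + 0            ≡⟨ +-identityʳ x ⟩
    x                ∎
  ranktop : rank n g (suc n) ≡ n
  ranktop = trans (sumR-cong n λ q p → cong b2n (<ᵇ-true (s≤s (proj₂ (r q p))))) (trans (sumR-const n 1) (*-identityʳ n))
  d+ : (n ∸ x) + suc x ≡ suc n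
  d+ = trans (+-suc (n ∸ x) x) (cong suc (m∸n+n≡m x≤n))
  lower : x ≤ rank n g (suc x)
  lower = +-cancelˡ-≤ (n ∸ x) _ _ (begin
    (n ∸ x) + x                    ≡⟨ m∸n+n≡m x≤n ⟩
    n                              ≡⟨ sym ranktop ⟩
    rank n g (suc n)               ≡⟨ cong (rank n g) (sym d+) ⟩
    rank n g ((n ∸ x) + suc x)     ≤⟨ rank-+ n g (suc x) (n ∸ x) inj ⟩
    (n ∸ x) + rank n g (suc x)     ∎)

-- The rank increases between the thresholds x and x + 1, and only a letter equal to x can cause
-- this.
perm-surjective : ∀ n g → IsPerm n g → ∀ x → Rng n x → ∃ λ k → Rng n k × g k ≡ x
perm-surjective n g pm (suc x) (_ , x<n) = let (k , r , h) = sumR-witness n nz in k , r , found k h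
  where
  nz : ¬ (sumR n (λ k → b2n (g k ≡ᵇ suc x)) ≡ 0)
  nz e = <⇒≢ (n<1+n x) (begin
    x                                                      ≡⟨ sym (rank-perm n g pm x (<⇒≤ x<n)) ⟩
    rank n g (suc x)                                       ≡⟨ sym (+-identityʳ _) ⟩
    rank n g (suc x) + 0                                   ≡⟨ cong (rank n g (suc x) +_) (sym e) ⟩
    rank n g (suc x) + sumR n (λ k → b2n (g k ≡ᵇ suc x))   ≡⟨ sym (rank-suc n g (suc x)) ⟩
    rank n g (suc (suc x))                                 ≡⟨ rank-perm n g pm (suc x) x<n ⟩
    suc x                                                  ∎)
    where open ≡-Reasoning
  found : ∀ k → ¬ (b2n (g k ≡ᵇ suc x) ≡ 0) → g k ≡ suc x
  found k h with g k ≡ᵇ suc x in eq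
  ... | true  = ≡ᵇ-true⁻ {g k} eq
  ... | false = ⊥-elim (h refl)

perm-rank : ∀ n g → IsPerm n g → ∀ q → Rng n q → g q ≡ suc (rank n g (g q))
perm-rank n g pm q r with g q | proj₁ pm q r
... | suc x | _ , x<n = cong suc (sym (rank-perm n g pm x (<⇒≤ x<n)))

-- Order isomorphism stated in one direction; for injective `u` the other direction follows by
-- trichotomy in `Pat-reflect`.
Pat : ℕ → (ℕ → ℕ) → (ℕ → ℕ) → Set
Pat n u w = ∀ q q′ → Rng n q → Rng n q′ → u q < u q′ → w q < w q′

Pat-reflect : ∀ n u w → Injective-on n u → Pat n u w → Pat n w u
Pat-reflect n u w inj pat q q′ r r′ lt with <-cmp (u q) (u q′)
... | tri< a _ _ = a
... | tri≈ _ b _ = ⊥-elim (<-irrefl (cong w (inj q q′ r r′ b)) lt)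
... | tri> _ _ c = ⊥-elim (<-asym lt (pat q′ q r′ r c))

Pat-bool : ∀ n u w → Injective-on n u → Pat n u w → ∀ q q′ → Rng n q → Rng n q′ → (u q <ᵇ u q′) ≡ (w q <ᵇ w q′)
Pat-bool n u w inj pat q q′ r r′ = bool-ext
  (λ e → <ᵇ-true (pat q q′ r r′ (<ᵇ-true⁻ {u q} e)))
  (λ e → <ᵇ-true (Pat-reflect n u w inj pat q q′ r r′ (<ᵇ-true⁻ {w q} e)))

Pat-rank : ∀ n u w → Injective-on n u → Pat n u w → ∀ q → Rng n q → rank n u (u q) ≡ rank n w (w q)
Pat-rank n u w inj pat q r = sumR-cong n λ k rk → cong b2n (Pat-bool n u w inj pat k q rk r)

perm-ext : ∀ n u w → IsPerm n u → IsPerm n w → Pat n u w → ∀ q → Rng n q → u q ≡ w q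
perm-ext n u w pu pw pat q r = trans (perm-rank n u pu q r)
  (trans (cong suc (Pat-rank n u w (proj₂ pu) pat q r)) (sym (perm-rank n w pw q r)))

-- A letter of a permutation is one more than its rank, and ranks depend on comparisons only. The
-- later identifications of permutations (the shape, the reassembled word, the recovered blocks)
-- rest on this.
Sym-ext : ∀ n u w → u ∈ Sym n → w ∈ Sym n → Pat n (u at_) (w at_) → u ≡ w
Sym-ext n u w u∈ w∈ pat with ∈-Sym⁻ n u u∈ | ∈-Sym⁻ n w w∈
... | refl , pu | l , pw = word-ext u w (sym l) (perm-ext n (u at_) (w at_) pu pw pat)

rank-mono-< : ∀ n g q q′ → Rng n q → g q < g q′ → rank n g (g q) < rank n g (g q′)
rank-mono-< n g q q′ r lt = sumR-mono-< n
  (λ k _ → b2n-mono λ e → <ᵇ-true (<-trans (<ᵇ-true⁻ {g k} e) lt)) q r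
  (subst₂ _<_ (cong b2n (sym (<ᵇ-false (≤-refl {g q})))) (cong b2n (sym (<ᵇ-true lt))) (s≤s z≤n))

rank<n : ∀ n g q → Rng n q → rank n g (g q) < n
rank<n n g q r = <-≤-trans (sumR-mono-< n {h = λ _ → 1} (λ k _ → b2n≤1 _) q r
    (subst (_< 1) (cong b2n (sym (<ᵇ-false (≤-refl {g q})))) (s≤s z≤n)))
  (≤-reflexive (trans (sumR-const n 1) (*-identityʳ n)))

std : ℕ → (ℕ → ℕ) → Word
std n g = tab n (λ q → suc (rank n g (g q)))

std-Pat : ∀ n g → Pat n g (std n g at_)
std-Pat n g q q′ r r′ lt = subst₂ _<_ (sym (at-tab n _ q r)) (sym (at-tab n _ q′ r′)) (s≤s (rank-mono-< n g q q′ r lt))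

std-Sym : ∀ n g → Injective-on n g → std n g ∈ Sym n
std-Sym n g inj = ∈-Sym n (std n g) (length-tab n _)
  ( (λ q r → subst (Rng n) (sym (at-tab n _ q r)) (s≤s z≤n , rank<n n g q r))
  , λ q q′ r r′ e → case <-cmp (g q) (g q′) of λ where
      (tri< a _ _) → ⊥-elim (<⇒≢ (std-Pat n g q q′ r r′ a) e)
      (tri≈ _ b _) → inj q q′ r r′ b
      (tri> _ _ c) → ⊥-elim (<⇒≢ (std-Pat n g q′ q r′ r c) (sym e)) )

standardize-std : ∀ w → standardize w ≡ std (length w) (w at_)
standardize-std w = trans (map-as-tab _ w) (word-ext _ _ (trans (length-tab n _) (sym (length-tab n _)))
  λ q r → let r′ = subst (λ z → Rng z q) (length-tab n _) r in
    trans (at-tab n _ q r′) (trans (cong suc (trans (countᵇ-total _ w) (total-word w _))) (sym (at-tab n _ q r′))))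
  where n = length w

-- Inserting a block moves positions and values by the same two maps: the old ones skip a gap of
-- i numbers after p (e₁), and the new ones fill the gap (e₂).

abstract
  e₁ : ℕ → ℕ → ℕ → ℕ
  e₁ p i q = if q ≤ᵇ p then q else i + q

  e₁-≤ : ∀ {p i q} → q ≤ p → e₁ p i q ≡ q
  e₁-≤ h rewrite ≤ᵇ-true h = refl

  e₁-> : ∀ {p i q} → p < q → e₁ p i q ≡ i + q
  e₁-> h rewrite ≤ᵇ-false h = refl

e₂ : ℕ → ℕ → ℕ
e₂ p x = p + x

e₁-mono : ∀ p i {q q′} → q < q′ → e₁ p i q < e₁ p i q′
e₁-mono p i {q} {q′} lt with q′ ≤? p | q ≤? p
... | yes a | _     rewrite e₁-≤ {i = i} a | e₁-≤ {i = i} (≤-trans (<⇒≤ lt) a) = lt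
... | no a  | yes b rewrite e₁-> {i = i} (≰⇒> a) | e₁-≤ {i = i} b = ≤-trans lt (m≤n+m q′ i)
... | no a  | no b  rewrite e₁-> {i = i} (≰⇒> a) | e₁-> {i = i} (≰⇒> b) = +-monoʳ-< i lt

e₁-reflect : ∀ p i {q q′} → e₁ p i q < e₁ p i q′ → q < q′
e₁-reflect p i {q} {q′} lt with <-cmp q q′
... | tri< a _ _ = a
... | tri≈ _ b _ = ⊥-elim (<-irrefl (cong (e₁ p i) b) lt)
... | tri> _ _ c = ⊥-elim (<-asym lt (e₁-mono p i c))

e₁-injective : ∀ p i {q q′} → e₁ p i q ≡ e₁ p i q′ → q ≡ q′
e₁-injective p i {q} {q′} eq with <-cmp q q′
... | tri< a _ _ = ⊥-elim (<⇒≢ (e₁-mono p i a) eq)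
... | tri≈ _ b _ = b
... | tri> _ _ c = ⊥-elim (<⇒≢ (e₁-mono p i c) (sym eq))

e₁<e₂ : ∀ {p i q x} → q ≤ p → Rng i x → e₁ p i q < e₂ p x
e₁<e₂ {p} {i} {q} {x} h (1≤x , _) rewrite e₁-≤ {i = i} h = ≤-<-trans h (m<m+n p 1≤x)

e₂<e₁ : ∀ {p i q x} → p < q → Rng i x → e₂ p x < e₁ p i q
e₂<e₁ {p} {i} {q} {x} h (_ , x≤i) rewrite e₁-> {i = i} h | +-comm p x = +-mono-≤-< x≤i h

e₁<e₂⁻ : ∀ {p i q x} → Rng i x → e₁ p i q < e₂ p x → q ≤ p
e₁<e₂⁻ r lt = ≮⇒≥ λ h → <-asym lt (e₂<e₁ h r)

e₂<e₁⁻ : ∀ {p i q x} → Rng i x → e₂ p x < e₁ p i q → p < q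
e₂<e₁⁻ r lt = ≰⇒> λ h → <-asym lt (e₁<e₂ h r)

e₁≢e₂ : ∀ {p i q x} → Rng i x → ¬ (e₁ p i q ≡ e₂ p x)
e₁≢e₂ {p} {i} {q} r eq with q ≤? p
... | yes h = <⇒≢ (e₁<e₂ h r) eq
... | no h  = <⇒≢ (e₂<e₁ (≰⇒> h) r) (sym eq)

e₁-Rng : ∀ {p i a q} → Rng a q → Rng (a + i) (e₁ p i q)
e₁-Rng {p} {i} {a} {q} (l , u) with q ≤? p
... | yes h rewrite e₁-≤ {i = i} h = l , ≤-trans u (m≤m+n a i)
... | no h  rewrite e₁-> {i = i} (≰⇒> h) | +-comm a i = ≤-trans l (m≤n+m q i) , +-monoʳ-≤ i u

e₂-Rng : ∀ {p i a x} → p ≤ a → Rng i x → Rng (a + i) (e₂ p x)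
e₂-Rng {p} p≤a (l , u) = ≤-trans l (m≤n+m _ p) , +-mono-≤ p≤a u

-- A view of the positions after an insertion: matching on it replaces a position by its origin in
-- the old word or in the block.
data Cover (p i a : ℕ) : ℕ → Set where
  old : ∀ q → Rng a q → Cover p i a (e₁ p i q)
  new : ∀ x → Rng i x → Cover p i a (e₂ p x)

cover : ∀ p i a → p ≤ a → ∀ y → Rng (a + i) y → Cover p i a y
cover p i a p≤a y (l , u) with y ≤? p
... | yes h = subst (Cover p i a) (e₁-≤ h) (old y (l , ≤-trans h p≤a))
... | no h with y ≤? p + i
...   | yes g = subst (Cover p i a) (m+[n∸m]≡n (<⇒≤ (≰⇒> h))) (new (y ∸ p) (m<n⇒0<n∸m (≰⇒> h) , m≤n+o⇒m∸n≤o y p g))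
...   | no g  = subst (Cover p i a) (trans (e₁-> p<) (m+[n∸m]≡n i≤y)) (old (y ∸ i) (≤-trans (s≤s z≤n) p< , m≤n+o⇒m∸n≤o y i (subst (y ≤_) (+-comm a i) u)))
  where
  p+i<y : p + i < y
  p+i<y = ≰⇒> g
  i≤y : i ≤ y
  i≤y = ≤-trans (m≤n+m i p) (<⇒≤ p+i<y)
  p< : p < y ∸ i
  p< = +-cancelʳ-< i p (y ∸ i) (subst (p + i <_) (sym (m∸n+n≡m i≤y)) p+i<y)

-- The range is cut into the p positions before the gap, the gap, and the a - p positions after it;
-- the two outer stretches together are the image of `e₁`.
splitSum : ∀ p i a → p ≤ a → ∀ g → sumR (a + i) g ≡ sumR a (g ∘ e₁ p i) + sumR i (g ∘ e₂ p)
splitSum p i a p≤a g = begin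
  sumR (a + i) g                                        ≡⟨ cong (λ z → sumR z g) a+i ⟩
  sumR (p + (i + r)) g                                  ≡⟨ sumR-add p (i + r) g ⟩
  A + sumR (i + r) (λ x → g (p + x))                    ≡⟨ cong (A +_) (sumR-add i r _) ⟩
  A + (B + sumR r (λ x → g (p + (i + x))))              ≡⟨ cong (A +_) (+-comm B _) ⟩
  A + (sumR r (λ x → g (p + (i + x))) + B)              ≡⟨ sym (+-assoc A _ B) ⟩
  A + sumR r (λ x → g (p + (i + x))) + B                ≡⟨ cong₂ (λ y z → y + z + B)
                                                             (sumR-cong p λ q rq → cong g (sym (e₁-≤ (proj₂ rq))))
                                                             (sumR-cong r λ q rq → cong g (trans (lemma q) (sym (e₁-> {i = i} (m<m+n p (proj₁ rq)))))) ⟩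
  sumR p (g ∘ e₁ p i) + sumR r (λ x → g (e₁ p i (p + x))) + B ≡⟨ cong (_+ B) (sym (sumR-add p r _)) ⟩
  sumR (p + r) (g ∘ e₁ p i) + B                         ≡⟨ cong (λ z → sumR z (g ∘ e₁ p i) + B) p+r ⟩
  sumR a (g ∘ e₁ p i) + B                               ∎
  where
  open ≡-Reasoning
  r = a ∸ p
  A = sumR p g
  B = sumR i (g ∘ e₂ p)
  p+r : p + r ≡ a
  p+r = m+[n∸m]≡n p≤a
  lemma : ∀ x → p + (i + x) ≡ i + (p + x)
  lemma x = trans (sym (+-assoc p i x)) (trans (cong (_+ x) (+-comm p i)) (+-assoc i p x))
  a+i : a + i ≡ p + (i + r)
  a+i = trans (cong (_+ i) (sym p+r)) (trans (+-assoc p r i) (cong (p +_) (+-comm r i)))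

-- W is w with the block π inserted after position p, above the values ≤ v. Only comparisons are
-- recorded, so that the doubled words of insertCell are covered as well.
record Insertion (a i p v : ℕ) (W w π : ℕ → ℕ) : Set where
  field
    p≤a : p ≤ a
    w<w : ∀ q q′ → Rng a q → Rng a q′ → w q < w q′ → W (e₁ p i q) < W (e₁ p i q′)
    w<w⁻ : ∀ q q′ → Rng a q → Rng a q′ → W (e₁ p i q) < W (e₁ p i q′) → w q < w q′
    π<π : ∀ x x′ → Rng i x → Rng i x′ → π x < π x′ → W (e₂ p x) < W (e₂ p x′)
    π<π⁻ : ∀ x x′ → Rng i x → Rng i x′ → W (e₂ p x) < W (e₂ p x′) → π x < π x′
    w<π : ∀ q x → Rng a q → Rng i x → w q ≤ v → W (e₁ p i q) < W (e₂ p x)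
    π<w : ∀ q x → Rng a q → Rng i x → v < w q → W (e₂ p x) < W (e₁ p i q)

  w<π⁻ : ∀ q x → Rng a q → Rng i x → W (e₁ p i q) < W (e₂ p x) → w q ≤ v
  w<π⁻ q x r r′ lt = ≮⇒≥ λ h → <-asym lt (π<w q x r r′ h)

  π<w⁻ : ∀ q x → Rng a q → Rng i x → W (e₂ p x) < W (e₁ p i q) → v < w q
  π<w⁻ q x r r′ lt = ≰⇒> λ h → <-asym lt (w<π q x r r′ h)

  Occ-w : ∀ x y z → Rng a x → Rng a y → Rng a z → Occ w x y z → Occ W (e₁ p i x) (e₁ p i y) (e₁ p i z)
  Occ-w x y z rx ry rz (b , c , d , e) = e₁-mono p i b , e₁-mono p i c , w<w x z rx rz d , w<w z y rz ry e

  Occ-w⁻ : ∀ x y z → Rng a x → Rng a y → Rng a z → Occ W (e₁ p i x) (e₁ p i y) (e₁ p i z) → Occ w x y z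
  Occ-w⁻ x y z rx ry rz (b , c , d , e) = e₁-reflect p i b , e₁-reflect p i c , w<w⁻ x z rx rz d , w<w⁻ z y rz ry e

  Occ-π : ∀ x y z → Rng i x → Rng i y → Rng i z → Occ π x y z → Occ W (e₂ p x) (e₂ p y) (e₂ p z)
  Occ-π x y z rx ry rz (b , c , d , e) = +-monoʳ-< p b , +-monoʳ-< p c , π<π x z rx rz d , π<π z y rz ry e

  Occ-π⁻ : ∀ x y z → Rng i x → Rng i y → Rng i z → Occ W (e₂ p x) (e₂ p y) (e₂ p z) → Occ π x y z
  Occ-π⁻ x y z rx ry rz (b , c , d , e) = +-cancelˡ-< p x y b , +-cancelˡ-< p y z c , π<π⁻ x z rx rz d , π<π⁻ z y rz ry e

  private
    h : ℕ → ℕ → ℕ → ℕ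
    h x y z = b2n (occᵇ W x y z)
    e = e₁ p i
    e′ = e₂ p

  -- Triples with first position X that use both old and new positions: X is meant to be old in
  -- `mixed₁` and new in `mixed₂`.
  mixed₁ mixed₂ : ℕ → ℕ
  mixed₁ X = sumR a (λ y → sumR i (λ z → h X (e y) (e′ z)))
           + sumR i (λ y → sumR a (λ z → h X (e′ y) (e z)) + sumR i (λ z → h X (e′ y) (e′ z)))
  mixed₂ X = sumR a (λ y → sumR a (λ z → h X (e y) (e z)) + sumR i (λ z → h X (e y) (e′ z)))
           + sumR i (λ y → sumR a (λ z → h X (e′ y) (e z)))

  N3-split : N3 (a + i) W ≡ (N3 a w + N3 i π) + (sumR a (mixed₁ ∘ e) + sumR i (mixed₂ ∘ e′))
  N3-split = begin
    N3 (a + i) W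
      ≡⟨ splitSum p i a p≤a _ ⟩
    sumR a (λ x → H (e x)) + sumR i (λ x → H (e′ x))
      ≡⟨ cong₂ _+_ (sumR-cong a λ x r → first x r) (sumR-cong i λ x r → second x r) ⟩
    sumR a (λ x → G x + mixed₁ (e x)) + sumR i (λ x → G′ x + mixed₂ (e′ x))
      ≡⟨ cong₂ _+_ (sumR-+ a G _) (sumR-+ i G′ _) ⟩
    (N3 a w + sumR a (mixed₁ ∘ e)) + (N3 i π + sumR i (mixed₂ ∘ e′))
      ≡⟨ +-interchange (N3 a w) _ (N3 i π) _ ⟩
    (N3 a w + N3 i π) + (sumR a (mixed₁ ∘ e) + sumR i (mixed₂ ∘ e′)) ∎
    where
    open ≡-Reasoning
    H G G′ : ℕ → ℕ
    H X = sumR (a + i) λ y → sumR (a + i) λ z → h X y z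
    G x = sumR a λ y → sumR a λ z → b2n (occᵇ w x y z)
    G′ x = sumR i λ y → sumR i λ z → b2n (occᵇ π x y z)
    H-split : ∀ X → H X ≡ sumR a (λ y → sumR a (λ z → h X (e y) (e z)) + sumR i (λ z → h X (e y) (e′ z)))
                        + sumR i (λ y → sumR a (λ z → h X (e′ y) (e z)) + sumR i (λ z → h X (e′ y) (e′ z)))
    H-split X = trans (splitSum p i a p≤a _) (cong₂ _+_ (sumR-cong a λ y _ → splitSum p i a p≤a _)
                                                        (sumR-cong i λ y _ → splitSum p i a p≤a _))
    first : ∀ x → Rng a x → H (e x) ≡ G x + mixed₁ (e x)
    first x rx = trans (H-split (e x)) (trans (cong (_+ R) (sumR-+ a _ _)) (trans (cong (λ z → z + S + R) pure) (+-assoc (G x) S R)))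
      where
      S = sumR a (λ y → sumR i (λ z → h (e x) (e y) (e′ z)))
      R = sumR i (λ y → sumR a (λ z → h (e x) (e′ y) (e z)) + sumR i (λ z → h (e x) (e′ y) (e′ z)))
      pure = sumR-cong a λ y ry → sumR-cong a λ z rz → cong b2n (bool-ext
        (λ t → Occ⇒occᵇ w x y z (Occ-w⁻ x y z rx ry rz (occᵇ⇒Occ W _ _ _ t)))
        (λ t → Occ⇒occᵇ W _ _ _ (Occ-w x y z rx ry rz (occᵇ⇒Occ w x y z t))))
    second : ∀ x → Rng i x → H (e′ x) ≡ G′ x + mixed₂ (e′ x)
    second x rx = trans (H-split (e′ x)) (trans (cong (R +_) (trans (sumR-+ i _ _) (cong (S +_) pure)))
        (trans (sym (+-assoc R S (G′ x))) (+-comm (R + S) (G′ x))))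
      where
      R = sumR a (λ y → sumR a (λ z → h (e′ x) (e y) (e z)) + sumR i (λ z → h (e′ x) (e y) (e′ z)))
      S = sumR i (λ y → sumR a (λ z → h (e′ x) (e′ y) (e z)))
      pure = sumR-cong i λ y ry → sumR-cong i λ z rz → cong b2n (bool-ext
        (λ t → Occ⇒occᵇ π x y z (Occ-π⁻ x y z rx ry rz (occᵇ⇒Occ W _ _ _ t)))
        (λ t → Occ⇒occᵇ W _ _ _ (Occ-π x y z rx ry rz (occᵇ⇒Occ π x y z t))))

  -- If the counts add up, the sum of all mixed terms is zero, and a vanishing sum of natural
  -- numbers vanishes term by term. Feasibility is defined by a count, and this turns it into
  -- statements about single triples.
  module _ (additive : N3 (a + i) W ≡ N3 a w + N3 i π) where
    private
      mixed≡0 : sumR a (mixed₁ ∘ e) + sumR i (mixed₂ ∘ e′) ≡ 0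
      mixed≡0 = +-cancelˡ-≡ (N3 a w + N3 i π) _ 0 (trans (sym N3-split) (trans additive (sym (+-identityʳ _))))
      m₁ : ∀ x → Rng a x → mixed₁ (e x) ≡ 0
      m₁ = sumR-0⁻ a (m+n≡0⇒m≡0 _ mixed≡0)
      m₂ : ∀ x → Rng i x → mixed₂ (e′ x) ≡ 0
      m₂ = sumR-0⁻ i (m+n≡0⇒n≡0 (sumR a (mixed₁ ∘ e)) mixed≡0)

    no-wwπ : ∀ x y z → Rng a x → Rng a y → Rng i z → ¬ Occ W (e x) (e y) (e′ z)
    no-wwπ x y z rx ry rz = 0⇒¬Occ W _ _ _ (sumR-0⁻ i (sumR-0⁻ a (m+n≡0⇒m≡0 _ (m₁ x rx)) y ry) z rz)

    no-wπw : ∀ x y z → Rng a x → Rng i y → Rng a z → ¬ Occ W (e x) (e′ y) (e z)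
    no-wπw x y z rx ry rz = 0⇒¬Occ W _ _ _ (sumR-0⁻ a (m+n≡0⇒m≡0 _ (sumR-0⁻ i
      (m+n≡0⇒n≡0 (sumR a (λ y → sumR i (λ z → h (e x) (e y) (e′ z)))) (m₁ x rx)) y ry)) z rz)

    no-πww : ∀ x y z → Rng i x → Rng a y → Rng a z → ¬ Occ W (e′ x) (e y) (e z)
    no-πww x y z rx ry rz = 0⇒¬Occ W _ _ _ (sumR-0⁻ a (m+n≡0⇒m≡0 _ (sumR-0⁻ a (m+n≡0⇒m≡0 _ (m₂ x rx)) y ry)) z rz)

  -- One for each old letter above-left or below-right of the block, that is, for each old letter
  -- that forms an inversion with every letter of the block; all other old letters form none.
  discordant : ℕ → ℕ
  discordant q = b2n ((q ≤ᵇ p) ∧ (v <ᵇ w q)) + b2n ((p <ᵇ q) ∧ (w q ≤ᵇ v))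

  N2-split : N2 (a + i) W ≡ (N2 a w + N2 i π) + i * sumR a discordant
  N2-split = begin
    N2 (a + i) W
      ≡⟨ splitSum p i a p≤a _ ⟩
    sumR a (λ x → H (e x)) + sumR i (λ x → H (e′ x))
      ≡⟨ cong₂ _+_ (sumR-cong a λ x r → splitSum p i a p≤a _) (sumR-cong i λ x r → splitSum p i a p≤a _) ⟩
    sumR a (λ x → sumR a (λ y → k (e x) (e y)) + sumR i (λ y → k (e x) (e′ y)))
      + sumR i (λ x → sumR a (λ y → k (e′ x) (e y)) + sumR i (λ y → k (e′ x) (e′ y)))
      ≡⟨ cong₂ _+_ (sumR-+ a _ _) (trans (sumR-+ i _ _) (+-comm B _)) ⟩
    (sumR a (λ x → sumR a (λ y → k (e x) (e y))) + A)
      + (sumR i (λ x → sumR i (λ y → k (e′ x) (e′ y))) + B)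
      ≡⟨ cong₂ (λ y z → y + A + (z + B)) (sumR-cong a λ x rx → sumR-cong a λ y ry → pure-w x y rx ry)
                                         (sumR-cong i λ x rx → sumR-cong i λ y ry → pure-π x y rx ry) ⟩
    (N2 a w + A) + (N2 i π + B)
      ≡⟨ +-interchange (N2 a w) A (N2 i π) B ⟩
    (N2 a w + N2 i π) + (A + B)
      ≡⟨ cong ((N2 a w + N2 i π) +_) cross ⟩
    (N2 a w + N2 i π) + i * sumR a discordant ∎
    where
    open ≡-Reasoning
    k : ℕ → ℕ → ℕ
    k x y = b2n (invᵇ W x y)
    H : ℕ → ℕ
    H x = sumR (a + i) (k x)
    A = sumR a (λ x → sumR i (λ y → k (e x) (e′ y)))
    B = sumR i (λ x → sumR a (λ y → k (e′ x) (e y)))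
    pure-w : ∀ x y → Rng a x → Rng a y → k (e x) (e y) ≡ b2n (invᵇ w x y)
    pure-w x y rx ry = cong b2n (cong₂ _∧_
      (bool-ext (λ t → <ᵇ-true (e₁-reflect p i (<ᵇ-true⁻ {e x} t))) (λ t → <ᵇ-true (e₁-mono p i (<ᵇ-true⁻ {x} t))))
      (bool-ext (λ t → <ᵇ-true (w<w⁻ y x ry rx (<ᵇ-true⁻ {W (e y)} t))) (λ t → <ᵇ-true (w<w y x ry rx (<ᵇ-true⁻ {w y} t)))))
    pure-π : ∀ x y → Rng i x → Rng i y → k (e′ x) (e′ y) ≡ b2n (invᵇ π x y)
    pure-π x y rx ry = cong b2n (cong₂ _∧_
      (bool-ext (λ t → <ᵇ-true (+-cancelˡ-< p x y (<ᵇ-true⁻ {e′ x} t))) (λ t → <ᵇ-true (+-monoʳ-< p (<ᵇ-true⁻ {x} t))))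
      (bool-ext (λ t → <ᵇ-true (π<π⁻ y x ry rx (<ᵇ-true⁻ {W (e′ y)} t))) (λ t → <ᵇ-true (π<π y x ry rx (<ᵇ-true⁻ {π y} t)))))
    wπ : ∀ q x → Rng a q → Rng i x → k (e q) (e′ x) ≡ b2n ((q ≤ᵇ p) ∧ (v <ᵇ w q))
    wπ q x rq rx = cong b2n (cong₂ _∧_
      (bool-ext (λ t → ≤ᵇ-true (e₁<e₂⁻ rx (<ᵇ-true⁻ {e q} t))) (λ t → <ᵇ-true (e₁<e₂ (≤ᵇ-true⁻ {q} {p} t) rx)))
      (bool-ext (λ t → <ᵇ-true (π<w⁻ q x rq rx (<ᵇ-true⁻ {W (e′ x)} t))) (λ t → <ᵇ-true (π<w q x rq rx (<ᵇ-true⁻ {v} t)))))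
    πw : ∀ q x → Rng a q → Rng i x → k (e′ x) (e q) ≡ b2n ((p <ᵇ q) ∧ (w q ≤ᵇ v))
    πw q x rq rx = cong b2n (cong₂ _∧_
      (bool-ext (λ t → <ᵇ-true (e₂<e₁⁻ rx (<ᵇ-true⁻ {e′ x} t))) (λ t → <ᵇ-true (e₂<e₁ (<ᵇ-true⁻ {p} {q} t) rx)))
      (bool-ext (λ t → ≤ᵇ-true (w<π⁻ q x rq rx (<ᵇ-true⁻ {W (e q)} t))) (λ t → <ᵇ-true (w<π q x rq rx (≤ᵇ-true⁻ {w q} t)))))
    cross : A + B ≡ i * sumR a discordant
    cross = begin
      A + B ≡⟨ cong (A +_) (sumR-swap i a _) ⟩
      A + sumR a (λ y → sumR i (λ x → k (e′ x) (e y))) ≡⟨ sym (sumR-+ a _ _) ⟩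
      sumR a (λ q → sumR i (λ x → k (e q) (e′ x)) + sumR i (λ x → k (e′ x) (e q)))
        ≡⟨ sumR-cong a (λ q rq → trans (sym (sumR-+ i _ _)) (trans (sumR-cong i λ x rx → cong₂ _+_ (wπ q x rq rx) (πw q x rq rx))
             (trans (sumR-const i (discordant q)) (*-comm i _)))) ⟩
      sumR a (λ q → discordant q * i) ≡⟨ sumR-*ʳ a discordant i ⟩
      sumR a discordant * i ≡⟨ *-comm _ i ⟩
      i * sumR a discordant ∎

-- The two conditions on the old word that exclude mixed occurrences: a letter left-below the block
-- could start one with a block entry as its largest or middle value, and a descent right-above the
-- block could complete one that starts in the block.
record Good (a p v : ℕ) (w : ℕ → ℕ) : Set where
  field
    no-left-below : ∀ q → Rng a q → q ≤ p → v < w q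
    right-above-increasing : ∀ q q′ → Rng a q → Rng a q′ → p < q → q < q′ → v < w q → v < w q′ → w q < w q′

module GoodInsertion {a i p v W w π} (I : Insertion a i p v W w π) (G : Good a p v w) where
  open Insertion I
  open Good G

  -- such an occurrence starts with a letter left-below the block
  no-w-π : ∀ q y x → Rng a q → Rng i x → ¬ Occ W (e₁ p i q) y (e₂ p x)
  no-w-π q y x rq rx (b , c , d , _) =
    <-irrefl refl (<-≤-trans (no-left-below q rq (e₁<e₂⁻ rx (<-trans b c))) (w<π⁻ q x rq rx d))

  -- The last letter is below the block, hence so is the first, which moreover lies to the left of
  -- the block.
  no-wπ- : ∀ q x z → Rng a q → Rng i x → Rng a z → ¬ Occ W (e₁ p i q) (e₂ p x) (e₁ p i z)
  no-wπ- q x z rq rx rz (b , c , d , f) =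
    <-asym (w<w⁻ q z rq rz d) (≤-<-trans (w<π⁻ z x rz rx f) (no-left-below q rq (e₁<e₂⁻ rx b)))

  -- Both old letters lie right-above the block and would form a descent there.
  no-πw- : ∀ x q z → Rng i x → Rng a q → Rng a z → ¬ Occ W (e₂ p x) (e₁ p i q) (e₁ p i z)
  no-πw- x q z rx rq rz (b , c , d , f) =
    <-asym z<q (right-above-increasing q z rq rz (e₂<e₁⁻ rx b) (e₁-reflect p i c) (<-trans v<z z<q) v<z)
    where
    v<z = π<w⁻ z x rz rx d
    z<q = w<w⁻ z q rz rq f

  -- Excluded by positions alone: no old letter stands between two letters of the block.
  no-πwπ : ∀ x q z → Rng i x → Rng a q → Rng i z → ¬ Occ W (e₂ p x) (e₁ p i q) (e₂ p z)
  no-πwπ x q z rx rq rz (b , c , _) = <-irrefl refl (<-≤-trans (e₂<e₁⁻ rx b) (e₁<e₂⁻ rz c))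

  -- Excluded by values alone: no old value lies between two values of the block.
  no-ππw : ∀ x y q → Rng i x → Rng i y → Rng a q → ¬ Occ W (e₂ p x) (e₂ p y) (e₁ p i q)
  no-ππw x y q rx ry rq (b , c , d , f) = <-irrefl refl (<-≤-trans (π<w⁻ q x rq rx d) (w<π⁻ q y rq ry f))

  -- Six kinds of mixed triples have to vanish; `no-w-π` leaves the middle position arbitrary and so
  -- disposes of two of them.
  N3-additive : N3 (a + i) W ≡ N3 a w + N3 i π
  N3-additive = trans N3-split (trans (cong ((N3 a w + N3 i π) +_) (cong₂ _+_
    (sumR-0 a λ x rx → cong₂ _+_
      (sumR-0 a λ y ry → sumR-0 i λ z rz → ¬Occ⇒0 W _ _ _ (no-w-π x (e₁ p i y) z rx rz))
      (sumR-0 i λ y ry → cong₂ _+_ (sumR-0 a λ z rz → ¬Occ⇒0 W _ _ _ (no-wπ- x y z rx ry rz))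
                                   (sumR-0 i λ z rz → ¬Occ⇒0 W _ _ _ (no-w-π x (e₂ p y) z rx rz))))
    (sumR-0 i λ x rx → cong₂ _+_
      (sumR-0 a λ y ry → cong₂ _+_ (sumR-0 a λ z rz → ¬Occ⇒0 W _ _ _ (no-πw- x y z rx ry rz))
                                   (sumR-0 i λ z rz → ¬Occ⇒0 W _ _ _ (no-πwπ x y z rx ry rz)))
      (sumR-0 i λ y ry → sumR-0 a λ z rz → ¬Occ⇒0 W _ _ _ (no-ππw x y z rx ry rz))))) (+-identityʳ _))

-- Block insertion on words

insF : Word → ℕ → ℕ → Word → ℕ → ℕ
insF w p v π q =
  if q ≤ᵇ p then e₁ v (length π) (w at q)
  else if q ≤ᵇ p + length π then e₂ v (π at (q ∸ p))
  else e₁ v (length π) (w at (q ∸ length π))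

ins : Word → ℕ → ℕ → Word → Word
ins w p v π = tab (length w + length π) (insF w p v π)

insF-e₁ : ∀ w p v π q → insF w p v π (e₁ p (length π) q) ≡ e₁ v (length π) (w at q)
insF-e₁ w p v π q with q ≤? p
... | yes h rewrite e₁-≤ {i = length π} h | ≤ᵇ-true h = refl
... | no h rewrite e₁-> {i = length π} (≰⇒> h)
                 | ≤ᵇ-false {length π + q} {p} (<-≤-trans (≰⇒> h) (m≤n+m q (length π)))
                 | ≤ᵇ-false {length π + q} {p + length π} (subst (_< length π + q) (+-comm (length π) p) (+-monoʳ-< (length π) (≰⇒> h)))
                 | m+n∸m≡n (length π) q = refl

insF-e₂ : ∀ w p v π x → Rng (length π) x → insF w p v π (e₂ p x) ≡ e₂ v (π at x)
insF-e₂ w p v π x (l , u)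
  rewrite ≤ᵇ-false {p + x} {p} (m<m+n p l) | ≤ᵇ-true {p + x} {p + length π} (+-monoʳ-≤ p u) | m+n∸m≡n p x = refl

ins-e₁ : ∀ w p v π q → Rng (length w) q → ins w p v π at e₁ p (length π) q ≡ e₁ v (length π) (w at q)
ins-e₁ w p v π q r = trans (at-tab _ _ _ (e₁-Rng r)) (insF-e₁ w p v π q)

ins-e₂ : ∀ w p v π x → p ≤ length w → Rng (length π) x → ins w p v π at e₂ p x ≡ e₂ v (π at x)
ins-e₂ w p v π x p≤ r = trans (at-tab _ _ _ (e₂-Rng p≤ r)) (insF-e₂ w p v π x r)

length-ins : ∀ w p v π → length (ins w p v π) ≡ length w + length π
length-ins w p v π = length-tab _ _

ins-Insertion : ∀ a i p v w π → w ∈ Sym a → π ∈ Sym i → p ≤ a → Insertion a i p v (ins w p v π at_) (w at_) (π at_)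
ins-Insertion a i p v w π w∈ π∈ p≤a with ∈-Sym⁻ a w w∈ | ∈-Sym⁻ i π π∈
... | refl , wr , _ | refl , πr , _ = record
  { p≤a = p≤a
  ; w<w = λ q q′ r r′ lt → subst₂ _<_ (sym (E q r)) (sym (E q′ r′)) (e₁-mono v i lt)
  ; w<w⁻ = λ q q′ r r′ lt → e₁-reflect v i (subst₂ _<_ (E q r) (E q′ r′) lt)
  ; π<π = λ q q′ r r′ lt → subst₂ _<_ (sym (E′ q r)) (sym (E′ q′ r′)) (+-monoʳ-< v lt)
  ; π<π⁻ = λ q q′ r r′ lt → +-cancelˡ-< v _ _ (subst₂ _<_ (E′ q r) (E′ q′ r′) lt)
  ; w<π = λ q x r r′ le → subst₂ _<_ (sym (E q r)) (sym (E′ x r′)) (e₁<e₂ le (πr x r′))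
  ; π<w = λ q x r r′ lt → subst₂ _<_ (sym (E′ x r′)) (sym (E q r)) (e₂<e₁ lt (πr x r′))
  }
  where
  E : ∀ q → Rng a q → ins w p v π at e₁ p i q ≡ e₁ v i (w at q)
  E q r = ins-e₁ w p v π q r
  E′ : ∀ x → Rng i x → ins w p v π at e₂ p x ≡ e₂ v (π at x)
  E′ x r = ins-e₂ w p v π x p≤a r

ins-Sym : ∀ a i p v w π → w ∈ Sym a → π ∈ Sym i → p ≤ a → v ≤ a → ins w p v π ∈ Sym (a + i)
ins-Sym a i p v w π w∈ π∈ p≤a v≤a with ∈-Sym⁻ a w w∈ | ∈-Sym⁻ i π π∈
... | refl , wr , winj | refl , πr , πinj = ∈-Sym (a + i) _ (length-ins w p v π) (rng , inj)
  where
  E : ∀ q → Rng a q → ins w p v π at e₁ p i q ≡ e₁ v i (w at q)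
  E q r = ins-e₁ w p v π q r
  E′ : ∀ x → Rng i x → ins w p v π at e₂ p x ≡ e₂ v (π at x)
  E′ x r = ins-e₂ w p v π x p≤a r
  rng : ∀ q → Rng (a + i) q → Rng (a + i) (ins w p v π at q)
  rng y r with cover p i a p≤a y r
  ... | old q rq = subst (Rng (a + i)) (sym (E q rq)) (e₁-Rng (wr q rq))
  ... | new x rx = subst (Rng (a + i)) (sym (E′ x rx)) (e₂-Rng v≤a (πr x rx))
  inj : Injective-on (a + i) (ins w p v π at_)
  inj y y′ r r′ eq with cover p i a p≤a y r | cover p i a p≤a y′ r′
  ... | old q rq | old q′ rq′ = cong (e₁ p i) (winj q q′ rq rq′ (e₁-injective v i (trans (sym (E q rq)) (trans eq (E q′ rq′)))))
  ... | old q rq | new x rx = ⊥-elim (e₁≢e₂ {v} {i} {w at q} (πr x rx) (trans (sym (E q rq)) (trans eq (E′ x rx))))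
  ... | new x rx | old q rq = ⊥-elim (e₁≢e₂ {v} {i} {w at q} (πr x rx) (trans (sym (E q rq)) (trans (sym eq) (E′ x rx))))
  ... | new x rx | new x′ rx′ = cong (e₂ p) (πinj x x′ rx rx′ (+-cancelˡ-≡ v _ _ (trans (sym (E′ x rx)) (trans eq (E′ x′ rx′)))))

-- The list of occurrences and the exploration of the occurrence graph

∈-if : {A : Set} {b : Bool} {xs : List A} {y : A} → y ∈ (if b then xs else []) → b ≡ true × y ∈ xs
∈-if {b = true} y∈ = refl , y∈

∈-if-intro : {A : Set} {b : Bool} {xs : List A} {y : A} → b ≡ true → y ∈ xs → y ∈ (if b then xs else [])
∈-if-intro refl y∈ = y∈

∈-occ132 : ∀ π i j k → Rng (length π) i → Rng (length π) j → Rng (length π) k → Occ (π at_) i j k → (i , j , k) ∈ occ132 π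
∈-occ132 π i j k ri rj rk o =
  ∈-concatMap-intro _ (∈-range ri) (∈-concatMap-intro _ (∈-range rj) (∈-concatMap-intro _ (∈-range rk)
    (∈-if-intro {b = occᵇ (π at_) i j k} (Occ⇒occᵇ (π at_) i j k o) (here refl))))

∈-occ132⁻ : ∀ π {i j k} → (i , j , k) ∈ occ132 π →
            Rng (length π) i × Rng (length π) j × Rng (length π) k × Occ (π at_) i j k
∈-occ132⁻ π o∈ with ∈-concatMap-elim _ {range (length π)} o∈
... | i , i∈ , o∈₁ with ∈-concatMap-elim _ {range (length π)} o∈₁
...   | j , j∈ , o∈₂ with ∈-concatMap-elim _ {range (length π)} o∈₂
...     | k , k∈ , o∈₃ with ∈-if {b = occᵇ (π at_) i j k} o∈₃
...       | t , here refl = ∈-range⁻ i∈ , ∈-range⁻ j∈ , ∈-range⁻ k∈ , occᵇ⇒Occ (π at_) i j k t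

map₃ : {A B C A′ B′ C′ : Set} → (A → A′) → (B → B′) → (C → C′) → A ⊎ B ⊎ C → A′ ⊎ B′ ⊎ C′
map₃ g h k (inj₁ x)        = inj₁ (g x)
map₃ g h k (inj₂ (inj₁ x)) = inj₂ (inj₁ (h x))
map₃ g h k (inj₂ (inj₂ x)) = inj₂ (inj₂ (k x))

-- Says that P is a union of components of the bipartite graph, without mentioning the occurrence
-- vertices.
Closed : ℕ → (ℕ → ℕ) → (ℕ → Set) → Set
Closed n u P = ∀ i j k → Rng n i → Rng n j → Rng n k → Occ u i j k → P i ⊎ P j ⊎ P k → P i × P j × P k

touches : List ℕ → ℕ → ℕ → ℕ → Bool
touches S i j k = memberℕ i S ∨ memberℕ j S ∨ memberℕ k S

touches-true : ∀ S i j k → i ∈ S ⊎ j ∈ S ⊎ k ∈ S → touches S i j k ≡ true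
touches-true S i j k (inj₁ h)        = ∨-introˡ (memberℕ-true h)
touches-true S i j k (inj₂ (inj₁ h)) = ∨-introʳ {memberℕ i S} (∨-introˡ (memberℕ-true h))
touches-true S i j k (inj₂ (inj₂ h)) = ∨-introʳ {memberℕ i S} (∨-introʳ {memberℕ j S} (memberℕ-true h))

touches-true⁻ : ∀ S i j k → touches S i j k ≡ true → i ∈ S ⊎ j ∈ S ⊎ k ∈ S
touches-true⁻ S i j k t with ∨-true {memberℕ i S} t
... | inj₁ h = inj₁ (memberℕ-true⁻ h)
... | inj₂ t′ with ∨-true {memberℕ j S} t′
...   | inj₁ h = inj₂ (inj₁ (memberℕ-true⁻ h))
...   | inj₂ h = inj₂ (inj₂ (memberℕ-true⁻ h))

kstep-⊆ : ∀ π {S x} → x ∈ S → x ∈ kstep π S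
kstep-⊆ π = ∈-++⁺ˡ

kstep-occ : ∀ π S i j k → (i , j , k) ∈ occ132 π → touches S i j k ≡ true →
            i ∈ kstep π S × j ∈ kstep π S × k ∈ kstep π S
kstep-occ π S i j k o∈ t = go (here refl) , go (there (here refl)) , go (there (there (here refl)))
  where
  go : ∀ {x} → x ∈ (i ∷ j ∷ k ∷ []) → x ∈ kstep π S
  go x∈ = ∈-++⁺ʳ S (∈-concatMap-intro _ o∈ (∈-if-intro {b = touches S i j k} t x∈))

kstep⁻ : ∀ π S {x} → x ∈ kstep π S → x ∈ S ⊎ (∃ λ i → ∃ λ j → ∃ λ k → (i , j , k) ∈ occ132 π × touches S i j k ≡ true × x ∈ (i ∷ j ∷ k ∷ []))
kstep⁻ π S x∈ with ∈-++⁻ S x∈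
... | inj₁ h = inj₁ h
... | inj₂ h with ∈-concatMap-elim _ {occ132 π} h
...   | (i , j , k) , o∈ , x∈′ with ∈-if {b = touches S i j k} x∈′
...     | t , x∈″ = inj₂ (i , j , k , o∈ , t , x∈″)

-- The reached set grows by at least one position per step until it is stable.
module Exploration (n : ℕ) (step : List ℕ → List ℕ) (S₀ : List ℕ)
  (step-⊆ : ∀ {S x} → x ∈ S → x ∈ step S)
  (step-mono : ∀ {S S′} → (∀ {x} → x ∈ S → x ∈ S′) → ∀ {x} → x ∈ step S → x ∈ step S′)
  (step-Rng : ∀ {S} → (∀ {x} → x ∈ S → Rng n x) → ∀ {x} → x ∈ step S → Rng n x)
  (start-Rng : ∀ {x} → x ∈ S₀ → Rng n x) (start : ∃ λ x → x ∈ S₀) where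

  private
    S : ℕ → List ℕ
    S t = iterate t step S₀

    card : List ℕ → ℕ
    card A = sumR n λ q → b2n (memberℕ q A)

    Stable : ℕ → Set
    Stable t = ∀ {q} → q ∈ S (suc t) → q ∈ S t

    equal-card : ∀ {A B} → (∀ {x} → x ∈ A → x ∈ B) → card B ≤ card A → ∀ {q} → Rng n q → q ∈ B → q ∈ A
    equal-card {A} {B} sub le {q} r q∈ with memberℕ q A in eq
    ... | true  = memberℕ-true⁻ eq
    ... | false = ⊥-elim (<-irrefl refl (<-≤-trans
            (sumR-mono-< n (λ x _ → b2n-mono λ m → memberℕ-true (sub (memberℕ-true⁻ {x} m))) q r
              (subst₂ _<_ (cong b2n (sym eq)) (cong b2n (sym (memberℕ-true q∈))) (s≤s z≤n))) le))

  reached-Rng : ∀ t {x} → x ∈ S t → Rng n x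
  reached-Rng zero    = start-Rng
  reached-Rng (suc t) = step-Rng (reached-Rng t)

  reached-start : ∀ t {x} → x ∈ S₀ → x ∈ S t
  reached-start zero    x∈ = x∈
  reached-start (suc t) x∈ = step-⊆ (reached-start t x∈)

  private
    grow : ∀ t → Stable t ⊎ t < card (S t)
    grow zero = let (q , q∈) = start in
      inj₂ (≤-<-trans z≤n (sumR-mono-< n {g = λ _ → 0} (λ _ _ → z≤n) q (start-Rng q∈)
            (subst (0 <_) (sym (cong b2n (memberℕ-true q∈))) (s≤s z≤n))))
    grow (suc t) with grow t | card (S (suc t)) ≤? card (S t)
    ... | inj₁ st | _     = inj₁ (step-mono st)
    ... | inj₂ lt | no h  = inj₂ (≤-<-trans lt (≰⇒> h))
    ... | inj₂ lt | yes h = inj₁ (step-mono λ x∈ → equal-card step-⊆ h (reached-Rng (suc t) x∈) x∈)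

  stable : ∀ {q} → q ∈ step (S n) → q ∈ S n
  stable with grow n
  ... | inj₁ st = st
  ... | inj₂ lt = ⊥-elim (<-irrefl refl (<-≤-trans lt
          (≤-trans (sumR-mono n {h = λ _ → 1} (λ q _ → b2n≤1 _)) (≤-reflexive (trans (sumR-const n 1) (*-identityʳ n))))))

module KernelPositions (π : Word) (nonempty : 1 ≤ length π) (perm : IsPerm (length π) (π at_)) where

  private
    n : ℕ
    n = length π

    S₀ : List ℕ
    S₀ = filterᵇ (λ i → (π at i) ≡ᵇ length π) (range (length π))

    S : ℕ → List ℕ
    S t = iterate t (kstep π) S₀

    triple : ∀ {P : ℕ → Set} {i j k q} → q ∈ (i ∷ j ∷ k ∷ []) → P i × P j × P k → P q
    triple (here refl) (a , _)                 = a
    triple (there (here refl)) (_ , a , _)     = a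
    triple (there (there (here refl))) (_ , _ , a) = a

    triple-Rng : ∀ {i j k} → (i , j , k) ∈ occ132 π → ∀ {x} → x ∈ (i ∷ j ∷ k ∷ []) → Rng n x
    triple-Rng o∈ x∈ = let (ri , rj , rk , _) = ∈-occ132⁻ π o∈ in triple {Rng n} x∈ (ri , rj , rk)

    step-mono : ∀ {A B} → (∀ {x} → x ∈ A → x ∈ B) → ∀ {x} → x ∈ kstep π A → x ∈ kstep π B
    step-mono {A} {B} sub x∈ = [ (λ h → kstep-⊆ π (sub h)) , (λ { (i , j , k , o∈ , tc , x∈′) →
      triple {_∈ kstep π B} x∈′ (kstep-occ π B i j k o∈ (touches-true B i j k (map₃ sub sub sub (touches-true⁻ A i j k tc)))) }) ]′
      (kstep⁻ π A x∈)

    step-Rng : ∀ {A} → (∀ {x} → x ∈ A → Rng n x) → ∀ {x} → x ∈ kstep π A → Rng n x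
    step-Rng {A} h x∈ = [ h , (λ { (i , j , k , o∈ , _ , x∈′) → triple-Rng o∈ x∈′ }) ]′ (kstep⁻ π A x∈)

    start-Rng : ∀ {x} → x ∈ S₀ → Rng n x
    start-Rng x∈ = ∈-range⁻ (proj₁ (∈-filterᵇ⁻ (λ i → (π at i) ≡ᵇ n) x∈))

    top∈S₀ : ∀ q → Rng n q → π at q ≡ n → q ∈ S₀
    top∈S₀ q r e = ∈-filterᵇ (λ i → (π at i) ≡ᵇ n) (∈-range r) (≡ᵇ-true {π at q} e)

    start : ∃ λ x → x ∈ S₀
    start = let (q , r , e) = perm-surjective n (π at_) perm n (nonempty , ≤-refl) in q , top∈S₀ q r e

    module Ex = Exploration n (kstep π) S₀ (kstep-⊆ π) step-mono step-Rng start-Rng start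

  kp-Rng : ∀ {q} → q ∈ kernelPositions π → Rng n q
  kp-Rng = Ex.reached-Rng n

  kp-top : ∀ q → Rng n q → π at q ≡ n → q ∈ kernelPositions π
  kp-top q r e = Ex.reached-start n (top∈S₀ q r e)

  kp-closed : Closed n (π at_) (_∈ kernelPositions π)
  kp-closed i j k ri rj rk o h =
    let (a , b , c) = kstep-occ π (S n) i j k (∈-occ132 π i j k ri rj rk o) (touches-true (S n) i j k h)
    in Ex.stable a , Ex.stable b , Ex.stable c

  -- Each exploration step only adds positions of an occurrence that already meets the set, so the
  -- steps never leave P. Together with `kp-top` and `kp-closed` this characterises the kernel as
  -- the least closed set containing the maximum.
  kp-least : (P : ℕ → Set) → Closed n (π at_) P → (∀ q → Rng n q → π at q ≡ n → P q) →
             ∀ q → q ∈ kernelPositions π → P q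
  kp-least P cl tp q = go n
    where
    start-P : ∀ {q} → q ∈ S₀ → P q
    start-P {q} q∈ = let (q∈′ , e) = ∈-filterᵇ⁻ (λ i → (π at i) ≡ᵇ n) q∈ in tp q (∈-range⁻ q∈′) (≡ᵇ-true⁻ {π at q} e)
    step-P : ∀ A → (∀ {q} → q ∈ A → P q) → ∀ {q} → q ∈ kstep π A → P q
    step-P A h q∈ = [ h , (λ { (i , j , k , o∈ , tc , q∈′) →
      let (ri , rj , rk , o) = ∈-occ132⁻ π o∈
      in triple {P} q∈′ (cl i j k ri rj rk o (map₃ h h h (touches-true⁻ A i j k tc))) }) ]′ (kstep⁻ π A q∈)
    go : ∀ t {q} → q ∈ S t → P q
    go zero    = start-P
    go (suc t) = step-P (S t) (go t)

-- Kernels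

-- Maximality by comparison instead of the equation with n, so that it passes between a word and its
-- pattern.
Top : ℕ → (ℕ → ℕ) → ℕ → Set
Top n u q = ∀ q′ → Rng n q′ → ¬ (u q < u q′)

-- Connectedness of the occurrence graph in the form of an induction principle starting from the
-- maximum.
Connected : ℕ → (ℕ → ℕ) → Set₁
Connected s ρ = (P : ℕ → Set) → Closed s ρ P → (∀ q → Rng s q → Top s ρ q → P q) → ∀ q → Rng s q → P q

Img : ℕ → (ℕ → ℕ) → ℕ → Set
Img s κ q = ∃ λ k → Rng s k × κ k ≡ q

-- κ enumerates the kernel positions of u, on which u has the pattern ρ; κ 0 = 0 makes
-- κ (l ∸ 1) the end of the part left of the l-th gap also when l = 1.
record Kernel (n s : ℕ) (u ρ κ : ℕ → ℕ) : Set₁ where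
  field
    κ-0       : κ 0 ≡ 0
    κ-Rng     : ∀ k → Rng s k → Rng n (κ k)
    κ-mono    : ∀ k k′ → Rng s k → Rng s k′ → k < k′ → κ k < κ k′
    pattern-κ : Pat s ρ (u ∘ κ)
    closed    : Closed n u (Img s κ)
    top       : ∃ λ k → Rng s k × Top n u (κ k)
    connected : Connected s ρ

  κ-injective : Injective-on s κ
  κ-injective k k′ r r′ e with <-cmp k k′
  ... | tri< a _ _ = ⊥-elim (<⇒≢ (κ-mono k k′ r r′ a) e)
  ... | tri≈ _ b _ = b
  ... | tri> _ _ c = ⊥-elim (<⇒≢ (κ-mono k′ k r′ r c) (sym e))

  κ-reflect : ∀ k k′ → Rng s k → Rng s k′ → κ k < κ k′ → k < k′
  κ-reflect k k′ r r′ lt with <-cmp k k′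
  ... | tri< a _ _ = a
  ... | tri≈ _ b _ = ⊥-elim (<-irrefl (cong κ b) lt)
  ... | tri> _ _ c = ⊥-elim (<-asym lt (κ-mono k′ k r′ r c))

top-value : ∀ n u → IsPerm n u → ∀ q → Rng n q → Top n u q → u q ≡ n
top-value n u pm q r t with m≤n⇒m<n∨m≡n (proj₂ (proj₁ pm q r))
... | inj₂ e = e
... | inj₁ lt with perm-surjective n u pm n (≤-trans (s≤s z≤n) lt , ≤-refl)
...   | k , rk , e = ⊥-elim (t k rk (subst (u q <_) (sym e) lt))

value-top : ∀ n u → IsPerm n u → ∀ q → u q ≡ n → Top n u q
value-top n u pm q e q′ r lt = <-irrefl refl (<-≤-trans lt (subst (u q′ ≤_) (sym e) (proj₂ (proj₁ pm q′ r))))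

abstract
  kernelList : Word → List ℕ
  kernelList π = filterᵇ (λ i → memberℕ i (kernelPositions π)) (range (length π))

  kernelList-sorted : ∀ π → AllPairs _<_ (kernelList π)
  kernelList-sorted π = filterᵇ-AllPairs _ (range-sorted (length π))

  std-cong : ∀ n {g h : ℕ → ℕ} → (∀ q → Rng n q → g q ≡ h q) → std n g ≡ std n h
  std-cong n {g} {h} e = word-ext _ _ (trans (length-tab n _) (sym (length-tab n _))) λ q r →
    let r′ = subst (λ z → Rng z q) (length-tab n _) r in
    trans (at-tab n _ q r′) (trans (cong suc (sumR-cong n λ k rk → cong b2n (cong₂ _<ᵇ_ (e k rk) (e q r′)))) (sym (at-tab n _ q r′)))

  kernelShape-std : ∀ π → kernelShape π ≡ std (length (kernelList π)) (λ k → π at (kernelList π at k))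
  kernelShape-std π = trans (standardize-std (kernelSeq π)) (trans (cong (λ w → std (length w) (w at_)) eq)
    (trans (cong (λ m → std m (tab s g at_)) (length-tab s g)) (std-cong s (λ q r → at-tab s g q r))))
    where
    s : ℕ
    s = length (kernelList π)
    g : ℕ → ℕ
    g k = π at (kernelList π at k)
    eq : kernelSeq π ≡ tab s g
    eq = map-as-tab (π at_) (kernelList π)

module _ {n : ℕ} (π : Word) (π∈ : π ∈ Sym n) (nonempty : 1 ≤ n) where

  private
    len : length π ≡ n
    len = proj₁ (∈-Sym⁻ n π π∈)
    module KP = KernelPositions π (subst (1 ≤_) (sym len) nonempty)
                  (subst (λ z → IsPerm z (π at_)) (sym len) (proj₂ (∈-Sym⁻ n π π∈)))

    abstract
      kp⇒kl : ∀ {q} → q ∈ kernelPositions π → q ∈ kernelList π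
      kp⇒kl q∈ = ∈-filterᵇ (λ i → memberℕ i (kernelPositions π)) (∈-range (KP.kp-Rng q∈)) (memberℕ-true q∈)

      kl⇒kp : ∀ {q} → q ∈ kernelList π → q ∈ kernelPositions π
      kl⇒kp q∈ = memberℕ-true⁻ (proj₂ (∈-filterᵇ⁻ (λ i → memberℕ i (kernelPositions π)) {range (length π)} q∈))

  abstract
    kl-Rng : ∀ {q} → q ∈ kernelList π → Rng n q
    kl-Rng {q} q∈ = subst (λ z → Rng z q) len (KP.kp-Rng (kl⇒kp q∈))

    kl-top : ∀ q → Rng n q → π at q ≡ n → q ∈ kernelList π
    kl-top q r e = kp⇒kl (KP.kp-top q (subst (λ z → Rng z q) (sym len) r) (trans e (sym len)))

    kl-closed : Closed n (π at_) (_∈ kernelList π)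
    kl-closed = subst (λ z → Closed z (π at_) (_∈ kernelList π)) len λ i j k ri rj rk o h →
      let (a , b , c) = KP.kp-closed i j k ri rj rk o (map₃ kl⇒kp kl⇒kp kl⇒kp h) in kp⇒kl a , kp⇒kl b , kp⇒kl c

    kl-least : (P : ℕ → Set) → Closed n (π at_) P → (∀ q → Rng n q → π at q ≡ n → P q) →
               ∀ q → q ∈ kernelList π → P q
    kl-least P cl tp q q∈ = KP.kp-least P (subst (λ z → Closed z (π at_) P) (sym len) cl)
      (λ q r e → tp q (subst (λ z → Rng z q) len r) (trans e len)) q (kl⇒kp q∈)

module _ (n : ℕ) (π : Word) (π∈ : π ∈ Sym n) (nonempty : 1 ≤ n) where

  private
    pm : IsPerm n (π at_)
    pm = proj₂ (∈-Sym⁻ n π π∈)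
    L = kernelList π
    s = length L
    κ : ℕ → ℕ
    κ = L at_
    σ : Word
    σ = std s (λ k → π at κ k)

    κ∈ : ∀ k → Rng s k → κ k ∈ L
    κ∈ k r = at-∈ L k r

    κR : ∀ k → Rng s k → Rng n (κ k)
    κR k r = kl-Rng π π∈ nonempty (κ∈ k r)

    ∈κ : ∀ q → q ∈ L → Img s κ q
    ∈κ q q∈ = ∈-at q∈

    img∈ : ∀ {q} → Img s κ q → q ∈ L
    img∈ (k , r , e) = subst (_∈ L) e (κ∈ k r)

    mono : ∀ k k′ → Rng s k → Rng s k′ → k < k′ → κ k < κ k′
    mono = sorted-at (kernelList-sorted π)

    κinj : ∀ {a b} → Rng s a → Rng s b → κ a ≡ κ b → a ≡ b
    κinj {k} {k′} r r′ e with <-cmp k k′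
    ... | tri< a _ _ = ⊥-elim (<⇒≢ (mono k k′ r r′ a) e)
    ... | tri≈ _ b _ = b
    ... | tri> _ _ c = ⊥-elim (<⇒≢ (mono k′ k r′ r c) (sym e))

    rfl : ∀ {a b} → Rng s a → Rng s b → κ a < κ b → a < b
    rfl {a} {b} ra rb lt with <-cmp a b
    ... | tri< h _ _ = h
    ... | tri≈ _ h _ = ⊥-elim (<-irrefl (cong κ h) lt)
    ... | tri> _ _ h = ⊥-elim (<-asym lt (mono b a rb ra h))

    inj : Injective-on s (λ k → π at κ k)
    inj k k′ r r′ e = κinj r r′ (proj₂ pm (κ k) (κ k′) (κR k r) (κR k′ r′) e)

    at-0 : ∀ (w : Word) → w at 0 ≡ 0
    at-0 []      = refl
    at-0 (x ∷ w) = refl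

    pat : Pat s (λ k → π at κ k) (σ at_)
    pat = std-Pat s (λ k → π at κ k)

    pat⁻ : Pat s (σ at_) (λ k → π at κ k)
    pat⁻ = Pat-reflect s _ _ inj pat

    closed : Closed n (π at_) (Img s κ)
    closed i j k ri rj rk o h =
      let (a , b , c) = kl-closed π π∈ nonempty i j k ri rj rk o (map₃ img∈ img∈ img∈ h) in ∈κ i a , ∈κ j b , ∈κ k c

    top : ∃ λ k → Rng s k × Top n (π at_) (κ k)
    top = let (q , r , e) = perm-surjective n (π at_) pm n (nonempty , ≤-refl)
              (k , rk , e′) = ∈κ q (kl-top π π∈ nonempty q r e)
          in k , rk , value-top n (π at_) pm (κ k) (trans (cong (π at_) e′) e)

    -- The shape is connected: a closed set P of the shape is carried along `κ` to a set P′ of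
    -- positions of π. An occurrence of π that meets P′ meets the kernel, hence lies inside it and
    -- comes from an occurrence of the shape; so P′ is closed and leastness of the kernel gives all
    -- of it.
    module _ (P : ℕ → Set) (cl : Closed s (σ at_) P) (tp : ∀ q → Rng s q → Top s (σ at_) q → P q) where

      P′ : ℕ → Set
      P′ q = ∃ λ k → Rng s k × κ k ≡ q × P k

      forget : ∀ {q} → P′ q → q ∈ L
      forget (k , r , e , _) = img∈ (k , r , e)

      closed-κ : ∀ x y z → Rng s x → Rng s y → Rng s z → Occ (π at_) (κ x) (κ y) (κ z) → P x ⊎ P y ⊎ P z → P x × P y × P z
      closed-κ x y z rx ry rz (a , b , c , d) = cl x y z rx ry rz (rfl rx ry a , rfl ry rz b , pat x z rx rz c , pat z y rz ry d)

      recover : ∀ {x q} → Rng s x → κ x ≡ q → P′ q → P x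
      recover rx e (k , r , e′ , p) = subst P (κinj r rx (trans e′ (sym e))) p

      P′-closed : Closed n (π at_) P′
      P′-closed i j k ri rj rk o h =
        let (a , b , c) = kl-closed π π∈ nonempty i j k ri rj rk o (map₃ forget forget forget h)
            (x , rx , ex) = ∈κ i a
            (y , ry , ey) = ∈κ j b
            (z , rz , ez) = ∈κ k c
            o′ = subst₂ (λ x′ y′ → Occ (π at_) x′ y′ (κ z)) (sym ex) (sym ey) (subst (Occ (π at_) i j) (sym ez) o)
            (px , py , pz) = closed-κ x y z rx ry rz o′ (map₃ (recover rx ex) (recover ry ey) (recover rz ez) h)
        in (x , rx , ex , px) , (y , ry , ey , py) , (z , rz , ez , pz)

      P′-top : ∀ q → Rng n q → π at q ≡ n → P′ q
      P′-top q r e =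
        let (k , rk , e′) = ∈κ q (kl-top π π∈ nonempty q r e)
        in k , rk , e′ , tp k rk λ k′ rk′ lt →
             value-top n (π at_) pm (κ k) (trans (cong (π at_) e′) e) (κ k′) (κR k′ rk′) (pat⁻ k k′ rk rk′ lt)

      P-all : ∀ k → Rng s k → P k
      P-all k r = recover r refl (kl-least π π∈ nonempty P′ P′-closed P′-top (κ k) (κ∈ k r))

    std-kernel : Kernel n s (π at_) (σ at_) κ
    std-kernel = record
      { κ-0 = at-0 L
      ; κ-Rng = κR
      ; κ-mono = mono
      ; pattern-κ = pat⁻
      ; closed = closed
      ; top = top
      ; connected = P-all
      }

  kernelShape-Sym : kernelShape π ∈ Sym (length (kernelList π))
  kernelShape-Sym = subst (_∈ Sym s) (sym (kernelShape-std π)) (std-Sym s _ inj)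

  kernel : Kernel n (length (kernelList π)) (π at_) (kernelShape π at_) (kernelList π at_)
  kernel = subst (λ ρ → Kernel n s (π at_) (ρ at_) κ) (sym (kernelShape-std π)) std-kernel

  module _ {s′ : ℕ} {ρ : Word} {κ′ : ℕ → ℕ} (ρ∈ : ρ ∈ Sym s′) (K′ : Kernel n s′ (π at_) (ρ at_) κ′) where
    private
      module K′ = Kernel K′

      pρ : IsPerm s′ (ρ at_)
      pρ = proj₂ (∈-Sym⁻ s′ ρ ρ∈)

      top-unique : ∀ k → Rng s′ k → Top s′ (ρ at_) k → Top n (π at_) (κ′ k)
      top-unique k r t with K′.top
      ... | k₀ , r₀ , t₀ with <-cmp (ρ at k₀) (ρ at k)
      ...   | tri< a _ _ = ⊥-elim (t₀ (κ′ k) (K′.κ-Rng k r) (K′.pattern-κ k₀ k r₀ r a))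
      ...   | tri≈ _ b _ = subst (λ z → Top n (π at_) (κ′ z)) (proj₂ pρ k₀ k r₀ r b) t₀
      ...   | tri> _ _ c = ⊥-elim (t k₀ r₀ c)

      -- Connectedness of ρ is applied to the set of those letters whose image lies in the computed
      -- kernel.
      img⇒kl : ∀ k → Rng s′ k → κ′ k ∈ L
      img⇒kl = K′.connected (λ k → κ′ k ∈ L)
        (λ i j k ri rj rk (a , b , c , d) → kl-closed π π∈ nonempty (κ′ i) (κ′ j) (κ′ k) (K′.κ-Rng i ri) (K′.κ-Rng j rj) (K′.κ-Rng k rk)
          (K′.κ-mono i j ri rj a , K′.κ-mono j k rj rk b , K′.pattern-κ i k ri rk c , K′.pattern-κ k j rk rj d))
        (λ k r t → kl-top π π∈ nonempty (κ′ k) (K′.κ-Rng k r) (top-value n (π at_) pm (κ′ k) (K′.κ-Rng k r) (top-unique k r t)))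

      kl⇒img : ∀ q → q ∈ L → Img s′ κ′ q
      kl⇒img = kl-least π π∈ nonempty (Img s′ κ′) K′.closed λ q r e →
        let (k , rk , t) = K′.top in
        k , rk , proj₂ pm (κ′ k) q (K′.κ-Rng k rk) r (trans (top-value n (π at_) pm (κ′ k) (K′.κ-Rng k rk) t) (sym e))

    -- The record `Kernel` determines the kernel: one inclusion follows from connectedness of ρ, the
    -- other from leastness of the kernel, and both lists increase. Thus the kernel of an assembled
    -- word is known without running the exploration.
    kernelList-unique : kernelList π ≡ tab s′ κ′
    kernelList-unique = sorted-ext (kernelList-sorted π) sorted ⊆ ⊇
      where
      sorted : AllPairs _<_ (tab s′ κ′)
      sorted = subst (AllPairs _<_) (sym (tab-applyUpTo s′ κ′)) (AllPairsₚ.applyUpTo⁺₁ (κ′ ∘ suc) s′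
        λ {i} {j} i<j j<s → K′.κ-mono (suc i) (suc j) (s≤s z≤n , ≤-trans i<j (<⇒≤ j<s)) (s≤s z≤n , j<s) (s≤s i<j))
      ⊆ : ∀ {x} → x ∈ kernelList π → x ∈ tab s′ κ′
      ⊆ {x} x∈ = let (k , r , e) = kl⇒img x x∈ in subst (_∈ tab s′ κ′) e (∈-map⁺ κ′ (∈-range r))
      ⊇ : ∀ {x} → x ∈ tab s′ κ′ → x ∈ kernelList π
      ⊇ {x} x∈ = let (k , k∈ , e) = ∈-map⁻ κ′ x∈ in subst (_∈ L) (sym e) (img⇒kl k (∈-range⁻ k∈))

    length-kernelList : length (kernelList π) ≡ s′
    length-kernelList = trans (cong length kernelList-unique) (length-tab s′ κ′)

    kernelList-at : ∀ k → Rng s′ k → kernelList π at k ≡ κ′ k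
    kernelList-at k r = trans (cong (_at k) kernelList-unique) (at-tab s′ κ′ k r)

    private
      std-unique : σ ≡ ρ
      std-unique = Sym-ext s′ σ ρ (subst (λ z → σ ∈ Sym z) length-kernelList (std-Sym s _ inj)) ρ∈
        λ q q′ r r′ lt → Pat-reflect s′ (ρ at_) (λ k → π at κ′ k) (proj₂ pρ) K′.pattern-κ q q′ r r′
          (subst₂ (λ x y → (π at x) < (π at y)) (kernelList-at q r) (kernelList-at q′ r′)
            (pat⁻ q q′ (relen r) (relen r′) lt))
        where
        relen : ∀ {q} → Rng s′ q → Rng s q
        relen {q} = subst (λ z → Rng z q) (sym length-kernelList)

    kernelShape-unique : kernelShape π ≡ ρ
    kernelShape-unique = trans (kernelShape-std π) std-unique

-- Feasible cells

-- The conditions of `Good` for a block put into the cell, with p = l - 1 and v = m - 1; for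
-- connected ρ they amount to feasibility.
record GoodCell (s : ℕ) (ρ : ℕ → ℕ) (m l : ℕ) : Set where
  field
    m-Rng : Rng s m
    l-Rng : Rng (suc s) l
    left⇒above : ∀ k → Rng s k → k < l → m ≤ ρ k
    right-above-increasing : ∀ k k′ → Rng s k → Rng s k′ → l ≤ k → k < k′ → m ≤ ρ k → m ≤ ρ k′ → ρ k < ρ k′

-- Feasibility by the role that an entry of the cell would play in an occurrence with two letters of ρ.
record Unobstructed (s : ℕ) (ρ : ℕ → ℕ) (m l : ℕ) : Set where
  field
    not-last   : ∀ x y → Rng s x → Rng s y → x < y → y < l → ρ x < m → m ≤ ρ y → ⊥
    not-middle : ∀ x y → Rng s x → Rng s y → x < l → l ≤ y → ρ x < ρ y → ρ y < m → ⊥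
    not-first  : ∀ x y → Rng s x → Rng s y → l ≤ x → x < y → m ≤ ρ y → ρ y < ρ x → ⊥

-- In a connected ρ no letter lies left-below an unobstructed cell, because the set of such
-- letters is a union of components that misses the maximum.
unobstructed⇒good : ∀ s ρ m l → IsPerm s ρ → Connected s ρ → Rng s m → Rng (suc s) l → Unobstructed s ρ m l → GoodCell s ρ m l
unobstructed⇒good s ρ m l pρ conn rm rl U = record
  { m-Rng = rm
  ; l-Rng = rl
  ; left⇒above = λ k r k<l → ≮⇒≥ λ lt → conn (λ k → ¬ LB k) closed top k r (k<l , lt)
  ; right-above-increasing = λ k k′ r r′ l≤k k<k′ h h′ → ≰⇒> λ le → not-first k k′ r r′ l≤k k<k′ h′
      (≤∧≢⇒< le λ e → <⇒≢ k<k′ (proj₂ pρ k k′ r r′ (sym e)))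
  }
  where
  open Unobstructed U
  LB : ℕ → Set
  LB k = k < l × ρ k < m
  module _ {x y z} (rx : Rng s x) (ry : Rng s y) (rz : Rng s z) (o : Occ ρ x y z) (lb : LB x) where
    b = proj₁ (proj₂ o)
    -- If y were not left-below the cell, the cell would be obstructed: by x and y when y is left of
    -- it, by x and z when y is right of it and z below, by y and z when y is right of it and z
    -- above.
    middle : LB y
    middle with y <? l | ρ y <? m
    ... | yes g | yes h = g , h
    ... | yes g | no h  = ⊥-elim (not-last x y rx ry (proj₁ o) g (proj₂ lb) (≮⇒≥ h))
    ... | no g  | _ with ρ z <? m
    ...   | yes h = ⊥-elim (not-middle x z rx rz (proj₁ lb) (≤-trans (≮⇒≥ g) (<⇒≤ b)) (proj₁ (proj₂ (proj₂ o))) h)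
    ...   | no h  = ⊥-elim (not-first y z ry rz (≮⇒≥ g) b (≮⇒≥ h) (proj₂ (proj₂ (proj₂ o))))
    last′ : LB z
    last′ with z <? l
    ... | yes g = g , <-trans (proj₂ (proj₂ (proj₂ o))) (proj₂ middle)
    ... | no g  = ⊥-elim (not-middle x z rx rz (proj₁ lb) (≮⇒≥ g) (proj₁ (proj₂ (proj₂ o))) (<-trans (proj₂ (proj₂ (proj₂ o))) (proj₂ middle)))
  closed : Closed s ρ (λ k → ¬ LB k)
  closed x y z rx ry rz o@(a , b , c , d) h =
    -- The first letter of an occurrence is to the left of and smaller than the other two, so it is
    -- left-below the cell as soon as one of them is.
    (λ lb → none lb) , (λ lb → none (<-trans a (proj₁ lb) , <-trans c (<-trans d (proj₂ lb))))
                     , (λ lb → none (<-trans a (<-trans b (proj₁ lb)) , <-trans c (proj₂ lb)))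
    where
    none : ¬ LB x
    none lb = case h of λ where
      (inj₁ g)        → g lb
      (inj₂ (inj₁ g)) → g (middle rx ry rz o lb)
      (inj₂ (inj₂ g)) → g (last′ rx ry rz o lb)
  -- The value m occurs in ρ, so a letter smaller than m is not the maximum.
  top : ∀ q → Rng s q → Top s ρ q → ¬ LB q
  top q r t (_ , lt) = let (k , rk , e) = perm-surjective s ρ pρ m rm in t k rk (subst (ρ q <_) (sym e) lt)

-- The lexicographic order in which `cells` is listed. On good cells it refines to the order of the
-- statement, by `precedes`.
CellLt : ℕ × ℕ → ℕ × ℕ → Set
CellLt (m , l) (m′ , l′) = l < l′ ⊎ (l ≡ l′ × m′ < m)

at-suc : ∀ (x : ℕ) (w : Word) q → 1 ≤ q → (x ∷ w) at suc q ≡ w at q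
at-suc x w (suc q) _ = refl

insertAt : ℕ → ℕ → Word → Word
insertAt p x d = take p d ++ x ∷ drop p d

e₁-suc : ∀ p i q → e₁ (suc p) i (suc q) ≡ suc (e₁ p i q)
e₁-suc p i q with q ≤? p
... | yes h = trans (e₁-≤ (s≤s h)) (cong suc (sym (e₁-≤ h)))
... | no h  = trans (e₁-> (s≤s (≰⇒> h))) (trans (+-suc i q) (cong suc (sym (e₁-> (≰⇒> h)))))

insertAt-old : ∀ p x d q → p ≤ length d → Rng (length d) q → insertAt p x d at e₁ p 1 q ≡ d at q
insertAt-old zero x d q _ r rewrite e₁-> {0} {1} (proj₁ r) = at-suc x d q (proj₁ r)
insertAt-old (suc p) x (y ∷ d) (suc zero) _ _ rewrite e₁-≤ {suc p} {1} {1} (s≤s z≤n) = refl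
insertAt-old (suc p) x (y ∷ d) (suc (suc q)) (s≤s p≤) (_ , s≤s u) rewrite e₁-suc p 1 (suc q) =
  trans (at-suc y (insertAt p x d) _ (proj₁ (e₁-Rng {p} {1} {length d} (s≤s z≤n , u))))
        (insertAt-old p x d (suc q) p≤ (s≤s z≤n , u))

insertAt-new : ∀ p x d → p ≤ length d → insertAt p x d at (p + 1) ≡ x
insertAt-new zero x d _ = refl
insertAt-new (suc p) x (y ∷ d) (s≤s p≤) = trans (at-suc y (insertAt p x d) (p + 1) (m≤n+m 1 p)) (insertAt-new p x d p≤)

length-insertAt : ∀ p x d → length (insertAt p x d) ≡ length d + 1
length-insertAt zero x d = +-comm 1 (length d)
length-insertAt (suc p) x [] = refl
length-insertAt (suc p) x (y ∷ d) = cong suc (length-insertAt p x d)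

N3-cong : ∀ n u w → Injective-on n u → Pat n u w → N3 n u ≡ N3 n w
N3-cong n u w inj pat = sumR-cong n λ i ri → sumR-cong n λ j rj → sumR-cong n λ k rk → cong b2n
  (cong₂ (λ x y → (i <ᵇ j) ∧ (j <ᵇ k) ∧ x ∧ y) (Pat-bool n u w inj pat i k ri rk) (Pat-bool n u w inj pat k j rk rj))

module _ (s : ℕ) (ρ : Word) (ρ∈ : ρ ∈ Sym s) where

  private
    len : length ρ ≡ s
    len = proj₁ (∈-Sym⁻ s ρ ρ∈)
    pρ : IsPerm s (ρ at_)
    pρ = proj₂ (∈-Sym⁻ s ρ ρ∈)
    d : Word
    d = map (2 *_) ρ
    len-d : length d ≡ s
    len-d = trans (length-map (2 *_) ρ) len

    at-d : ∀ q → Rng s q → d at q ≡ 2 * (ρ at q)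
    at-d q r = trans (cong (_at q) (map-as-tab (2 *_) ρ)) (at-tab (length ρ) _ q (subst (λ z → Rng z q) (sym len) r))

    twice-suc : ∀ m → 2 * suc m ≡ suc (suc (2 * m))
    twice-suc m = cong suc (+-suc m (m + 0))

  module _ (m₀ p : ℕ) (p≤s : p ≤ s) where
    private
      W : ℕ → ℕ
      W = insertCell ρ (suc m₀) (suc p) at_

      W-e₁ : ∀ q → Rng s q → W (e₁ p 1 q) ≡ 2 * (ρ at q)
      W-e₁ q r = trans (insertAt-old p _ d q (subst (p ≤_) (sym len-d) p≤s) (subst (λ z → Rng z q) (sym len-d) r)) (at-d q r)

      W-e₂ : ∀ x → Rng 1 x → W (e₂ p x) ≡ suc (2 * m₀)
      W-e₂ (suc zero) r = trans (insertAt-new p _ d (subst (p ≤_) (sym len-d) p≤s)) (cong (_∸ 1) (twice-suc m₀))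
      W-e₂ (suc (suc x)) (_ , s≤s ())

    -- With m = m₀ + 1 the inserted value 2m - 1 lies strictly between the doubled values of m₀ and
    -- m, so up to comparisons a single letter is inserted into the undoubled ρ above the values ≤
    -- m₀.
    cell-Insertion : Insertion s 1 p m₀ W (ρ at_) (λ _ → 1)
    cell-Insertion = record
      { p≤a = p≤s
      ; w<w = λ q q′ r r′ lt → subst₂ _<_ (sym (W-e₁ q r)) (sym (W-e₁ q′ r′)) (*-monoʳ-< 2 lt)
      ; w<w⁻ = λ q q′ r r′ lt → *-cancelˡ-< 2 _ _ (subst₂ _<_ (W-e₁ q r) (W-e₁ q′ r′) lt)
      -- The block is a single letter, so neither side has a strict comparison within it.
      ; π<π = λ x x′ r r′ lt → ⊥-elim (<-irrefl refl lt)
      ; π<π⁻ = λ x x′ r r′ lt → ⊥-elim (<⇒≢ lt (trans (W-e₂ x r) (sym (W-e₂ x′ r′))))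
      ; w<π = λ q x r r′ le → subst₂ _<_ (sym (W-e₁ q r)) (sym (W-e₂ x r′)) (s≤s (*-monoʳ-≤ 2 le))
      ; π<w = λ q x r r′ lt → subst₂ _<_ (sym (W-e₂ x r′)) (sym (W-e₁ q r)) (subst (_≤ 2 * (ρ at q)) (twice-suc m₀) (*-monoʳ-≤ 2 lt))
      }

    private
      count-W : n132 (insertCell ρ (suc m₀) (suc p)) ≡ N3 (s + 1) W
      count-W = trans (n132-N3 (insertCell ρ (suc m₀) (suc p))) (cong (λ z → N3 z W) (trans (length-insertAt p _ d) (cong (_+ 1) len-d)))

      count-d : n132 d ≡ N3 s (ρ at_)
      count-d = trans (n132-N3 d) (trans (cong (λ z → N3 z (d at_)) len-d) (sym (N3-cong s (ρ at_) (d at_) (proj₂ pρ)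
        λ q q′ r r′ lt → subst₂ _<_ (sym (at-d q r)) (sym (at-d q′ r′)) (*-monoʳ-< 2 lt))))

    open Insertion cell-Insertion

    -- A single letter has no occurrence, so equality of the two counts is additivity, and every
    -- mixed triple is excluded. The three ways to place the new letter give the three fields.
    feasible⇒unobstructed : feasible ρ (suc m₀) (suc p) ≡ true → Unobstructed s (ρ at_) (suc m₀) (suc p)
    feasible⇒unobstructed fe = record
      { not-last = λ x y rx ry x<y y<l lo hi → no-wwπ additive x y 1 rx ry r1
          (e₁-mono p 1 x<y , e₁<e₂ (≤-pred y<l) r1 , w<π x 1 rx r1 (≤-pred lo) , π<w y 1 ry r1 hi)
      ; not-middle = λ x y rx ry x<l l≤y lt hi → no-wπw additive x 1 y rx r1 ry
          (e₁<e₂ (≤-pred x<l) r1 , e₂<e₁ l≤y r1 , w<w x y rx ry lt , w<π y 1 ry r1 (≤-pred hi))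
      ; not-first = λ x y rx ry l≤x x<y lo lt → no-πww additive 1 x y r1 rx ry
          (e₂<e₁ l≤x r1 , e₁-mono p 1 x<y , π<w y 1 ry r1 lo , w<w y x ry rx lt)
      }
      where
      r1 : Rng 1 1
      r1 = ≤-refl , ≤-refl
      additive : N3 (s + 1) W ≡ N3 s (ρ at_) + N3 1 (λ _ → 1)
      additive = trans (trans (sym count-W) (trans (≡ᵇ-true⁻ {n132 (insertCell ρ (suc m₀) (suc p))} fe) count-d)) (sym (+-identityʳ _))

    good⇒feasible : GoodCell s (ρ at_) (suc m₀) (suc p) → feasible ρ (suc m₀) (suc p) ≡ true
    good⇒feasible G = ≡ᵇ-true (trans count-W (trans (GoodInsertion.N3-additive cell-Insertion good) (trans (+-identityʳ _) (sym count-d))))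
      where
      open GoodCell G
      good : Good s p m₀ (ρ at_)
      good = record
        { no-left-below = λ q r q≤p → left⇒above q r (s≤s q≤p)
        ; right-above-increasing = right-above-increasing
        }

  private
    row : ℕ → ℕ → List (ℕ × ℕ)
    row l m = if feasible ρ m l then (m , l) ∷ [] else []

  ∈-cells⁻ : ∀ {m l} → (m , l) ∈ cells ρ → Rng s m × Rng (suc s) l × feasible ρ m l ≡ true
  ∈-cells⁻ c∈ with ∈-concatMap-elim (λ l → concatMap (row l) (reverse (range (length ρ)))) {range (suc (length ρ))} c∈
  ... | l , l∈ , c∈₁ with ∈-concatMap-elim (row l) {reverse (range (length ρ))} c∈₁
  ...   | m , m∈ , c∈₂ with ∈-if {b = feasible ρ m l} c∈₂
  ...     | fe , here refl = subst (λ z → Rng z m) len (∈-range⁻ (Anyₚ.reverse⁻ m∈))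
                           , subst (λ z → Rng (suc z) l) len (∈-range⁻ l∈) , fe

  ∈-cells : ∀ {m l} → Rng s m → Rng (suc s) l → feasible ρ m l ≡ true → (m , l) ∈ cells ρ
  ∈-cells {m} {l} rm rl fe = ∈-concatMap-intro (λ l → concatMap (row l) (reverse (range (length ρ))))
    (∈-range (subst (λ z → Rng (suc z) l) (sym len) rl))
    (∈-concatMap-intro (row l) (Anyₚ.reverse⁺ (∈-range (subst (λ z → Rng z m) (sym len) rm))) (∈-if-intro {b = feasible ρ m l} fe (here refl)))

  cells-sorted : AllPairs CellLt (cells ρ)
  cells-sorted = AllPairs-concatMap (λ l → concatMap (row l) R) (range (suc (length ρ))) (range-sorted (suc (length ρ)))
    (λ l _ → AllPairs-concatMap (row l) R R-sorted (λ m _ → single m l)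
      λ m m′ _ _ m>m′ a b a∈ b∈ → inj₂ (trans (proj₂ (in-row m l a∈)) (sym (proj₂ (in-row m′ l b∈)))
                                       , subst₂ _<_ (sym (proj₁ (in-row m′ l b∈))) (sym (proj₁ (in-row m l a∈))) m>m′))
    λ l l′ _ _ l<l′ a b a∈ b∈ → inj₁ (subst₂ _<_ (sym (in-col l a∈)) (sym (in-col l′ b∈)) l<l′)
    where
    R = reverse (range (length ρ))
    R-sorted : AllPairs _>_ R
    R-sorted = subst (AllPairs _>_) (sym (reverse-applyUpTo suc (length ρ)))
      (AllPairsₚ.applyDownFrom⁺₁ suc (length ρ) (λ j<i _ → s≤s j<i))
    in-row : ∀ m l {c} → c ∈ row l m → proj₁ c ≡ m × proj₂ c ≡ l
    in-row m l c∈ with ∈-if {b = feasible ρ m l} c∈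
    ... | _ , here refl = refl , refl
    in-col : ∀ l {c} → c ∈ concatMap (row l) R → proj₂ c ≡ l
    in-col l c∈ with ∈-concatMap-elim (row l) {R} c∈
    ... | m , _ , c∈′ = proj₂ (in-row m l c∈′)
    single : ∀ m l → AllPairs CellLt (row l m)
    single m l with feasible ρ m l
    ... | true  = [] ∷ []
    ... | false = []

  cells-good : Connected s (ρ at_) → ∀ {m l} → (m , l) ∈ cells ρ → GoodCell s (ρ at_) m l
  cells-good conn c∈ with ∈-cells⁻ c∈
  cells-good conn {suc m} {suc l} c∈ | rm , rl@(_ , s≤s l≤s) , fe =
    unobstructed⇒good s (ρ at_) (suc m) (suc l) pρ conn rm rl (feasible⇒unobstructed m l l≤s fe)

  good⇒∈-cells : ∀ {m l} → GoodCell s (ρ at_) m l → (m , l) ∈ cells ρ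
  good⇒∈-cells {m} {l} G with GoodCell.m-Rng G | GoodCell.l-Rng G
  good⇒∈-cells {suc m} {suc l} G | rm | rl@(_ , s≤s l≤s) = ∈-cells rm rl (good⇒feasible m l l≤s G)

-- Placement of the remaining entries

record InCell (s : ℕ) (u ρ κ : ℕ → ℕ) (q m l : ℕ) : Set where
  field
    left  : ∀ k → Rng s k → k < l → κ k < q
    right : ∀ k → Rng s k → l ≤ k → q < κ k
    below : ∀ k → Rng s k → ρ k < m → u (κ k) < u q
    above : ∀ k → Rng s k → m ≤ ρ k → u q < u (κ k)

inCell⇒¬Img : ∀ {s u ρ κ q m l} → InCell s u ρ κ q m l → ¬ Img s κ q
inCell⇒¬Img {l = l} C (k , r , refl) with k <? l
... | yes h = <-irrefl refl (InCell.left C k r h)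
... | no h  = <-irrefl refl (InCell.right C k r (≮⇒≥ h))

module _ {s : ℕ} {ρ : ℕ → ℕ} (pρ : IsPerm s ρ) {m l m′ l′ : ℕ} (G : GoodCell s ρ m l) (G′ : GoodCell s ρ m′ l′) where
  private
    module G = GoodCell G
    module G′ = GoodCell G′

  l<l′⇒l-Rng : l < l′ → Rng s l
  l<l′⇒l-Rng lt = proj₁ G.l-Rng , ≤-pred (≤-trans lt (proj₂ G′.l-Rng))

  -- Suppose l < l′ and m < m′, and let e be the position of m in ρ. Letters left of l′ are at least
  -- m′ > m, so e is at or after l′, whereas position l carries a value at least m′. Both are
  -- right-above the cell (m , l) and decrease, a contradiction.
  precedes : l < l′ ⊎ (l ≡ l′ × m′ < m) → m′ ≤ m × l ≤ l′
  precedes (inj₂ (l≡l′ , lt)) = <⇒≤ lt , ≤-reflexive l≡l′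
  precedes (inj₁ lt) = ≮⇒≥ m≮m′ , <⇒≤ lt
    where
    m≮m′ : ¬ (m < m′)
    m≮m′ m<m′ with perm-surjective s ρ pρ m G.m-Rng
    ... | e , re , ρe≡m = <-irrefl refl (<-trans m<m′ (≤-<-trans m′≤ρl (subst (ρ l <_) ρe≡m
            (G.right-above-increasing l e (l<l′⇒l-Rng lt) re ≤-refl (<-≤-trans lt l′≤e) (<⇒≤ (<-≤-trans m<m′ m′≤ρl)) (≤-reflexive (sym ρe≡m))))))
      where
      m′≤ρl : m′ ≤ ρ l
      m′≤ρl = G′.left⇒above l (l<l′⇒l-Rng lt) lt
      l′≤e : l′ ≤ e
      l′≤e = ≮⇒≥ λ h → <-irrefl refl (<-≤-trans m<m′ (subst (m′ ≤_) ρe≡m (G′.left⇒above e re h)))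

  -- An entry of an earlier cell is left of and above every entry of a later cell: otherwise the
  -- two entries would form an occurrence with a kernel entry separating the cells.
  ordered : ∀ {n u κ} → IsPerm n u → Kernel n s u ρ κ → l < l′ ⊎ (l ≡ l′ × m′ < m) →
            ∀ {q q′} → Rng n q → Rng n q′ → InCell s u ρ κ q m l → InCell s u ρ κ q′ m′ l′ → q < q′ × u q′ < u q
  ordered {n} {u} {κ} pu K lt {q} {q′} rq rq′ C C′ = position lt , value lt
    where
    open Kernel K
    module C = InCell C
    module C′ = InCell C′
    m′≤m = proj₁ (precedes lt)

    -- The kernel entry of value m′ is the lowest one above the later cell and is still below the
    -- earlier one.
    separator : m′ < m → ∃ λ e → Rng s e × ρ e ≡ m′ × u q′ < u (κ e) × u (κ e) < u q
    separator m′<m with perm-surjective s ρ pρ m′ G′.m-Rng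
    ... | e , re , refl = e , re , refl , C′.above e re ≤-refl , C.below e re m′<m

    position : l < l′ ⊎ (l ≡ l′ × m′ < m) → q < q′
    position (inj₁ l<l′) = <-trans (C.right l (l<l′⇒l-Rng l<l′) ≤-refl) (C′.left l (l<l′⇒l-Rng l<l′) l<l′)
    position (inj₂ (refl , m′<m)) with separator m′<m
    ... | e , re , refl , a , b with <-cmp q q′
    ...   | tri< h _ _ = h
    ...   | tri≈ _ refl _ = ⊥-elim (<-asym a b)
    ...   | tri> _ _ h = ⊥-elim (inCell⇒¬Img C (proj₁ (proj₂ (closed q′ q (κ e) rq′ rq (κ-Rng e re)
              (h , C.right e re l≤e , a , b) (inj₂ (inj₂ (e , re , refl)))))))
      where
      l≤e : l ≤ e
      l≤e = ≮⇒≥ λ h → <-irrefl refl (<-≤-trans m′<m (G.left⇒above e re h))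

    value : l < l′ ⊎ (l ≡ l′ × m′ < m) → u q′ < u q
    value lt′ with m≤n⇒m<n∨m≡n m′≤m | lt′
    ... | inj₁ m′<m | _ = let (e , _ , _ , a , b) = separator m′<m in <-trans a b
    ... | inj₂ refl | inj₂ (_ , m<m) = ⊥-elim (<-irrefl refl m<m)
    ... | inj₂ refl | inj₁ l<l′ with <-cmp (u q′) (u q)
    ...   | tri< h _ _ = h
    ...   | tri≈ _ e _ = ⊥-elim (<⇒≢ (position lt) (proj₂ pu q q′ rq rq′ (sym e)))
    -- In equal rows the separating entry is the l-th kernel entry, which is right of the earlier
    -- cell, left of the later one and above both.
    ...   | tri> _ _ h = ⊥-elim (inCell⇒¬Img C (proj₁ (closed q (κ l) q′ rq (κ-Rng l rl) rq′
              (C.right l rl ≤-refl , C′.left l rl l<l′ , h , C′.above l rl (G′.left⇒above l rl l<l′)) (inj₂ (inj₁ (l , rl , refl))))))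
      where rl = l<l′⇒l-Rng l<l′

-- The invariant of insertion and removal: all entries outside the kernel lie in cells of the list
-- `cs`, which may be any final part of the chain.
record Filled (n s : ℕ) (u ρ κ : ℕ → ℕ) (cs : List (ℕ × ℕ)) : Set₁ where
  field
    isKernel : Kernel n s u ρ κ
    located : ∀ q → Rng n q → Img s κ q ⊎ (∃ λ m → ∃ λ l → (m , l) ∈ cs × InCell s u ρ κ q m l)

module _ {a i p v : ℕ} {W w π : ℕ → ℕ} (I : Insertion a i p v W w π) (G : Good a p v w)
         {s : ℕ} {ρ κ : ℕ → ℕ} (K : Kernel a s w ρ κ) where
  open Insertion I
  open GoodInsertion I G
  open Kernel K

  -- Without mixed occurrences an occurrence is either old or inside the block, so closedness is
  -- inherited. The hypothesis provides an old letter above the block, which keeps the maximum among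
  -- the old letters.
  kernel-ins : (∃ λ q → Rng a q × v < w q) → Kernel (a + i) s W ρ (e₁ p i ∘ κ)
  kernel-ins (q₀ , rq₀ , v<) = record
    { κ-0 = trans (cong (e₁ p i) κ-0) (e₁-≤ z≤n)
    ; κ-Rng = λ k r → e₁-Rng (κ-Rng k r)
    ; κ-mono = λ k k′ r r′ lt → e₁-mono p i (κ-mono k k′ r r′ lt)
    ; pattern-κ = λ k k′ r r′ lt → w<w (κ k) (κ k′) (κ-Rng k r) (κ-Rng k′ r′) (pattern-κ k k′ r r′ lt)
    ; closed = closed′
    ; top = top′
    ; connected = connected
    }
    where
    down : ∀ {q} → Img s (e₁ p i ∘ κ) (e₁ p i q) → Img s κ q
    down (k , r , e) = k , r , e₁-injective p i e
    up : ∀ {q} → Img s κ q → Img s (e₁ p i ∘ κ) (e₁ p i q)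
    up (k , r , e) = k , r , cong (e₁ p i) e
    none : ∀ {x} → Rng i x → ¬ Img s (e₁ p i ∘ κ) (e₂ p x)
    none rx (k , r , e) = e₁≢e₂ rx e
    closed′ : Closed (a + i) W (Img s (e₁ p i ∘ κ))
    closed′ x y z rx ry rz o h with cover p i a p≤a x rx | cover p i a p≤a y ry | cover p i a p≤a z rz
    ... | old x rx | old y ry | old z rz =
            let (f , g , k) = closed x y z rx ry rz (Occ-w⁻ x y z rx ry rz o) (map₃ down down down h) in up f , up g , up k
    ... | old x rx | _        | new z rz = ⊥-elim (no-w-π x _ z rx rz o)
    ... | old x rx | new y ry | old z rz = ⊥-elim (no-wπ- x y z rx ry rz o)
    ... | new x rx | old y ry | old z rz = ⊥-elim (no-πw- x y z rx ry rz o)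
    ... | new x rx | old y ry | new z rz = ⊥-elim (no-πwπ x y z rx ry rz o)
    ... | new x rx | new y ry | old z rz = ⊥-elim (no-ππw x y z rx ry rz o)
    ... | new x rx | new y ry | new z rz = ⊥-elim (case h of λ where
            (inj₁ g)        → none rx g
            (inj₂ (inj₁ g)) → none ry g
            (inj₂ (inj₂ g)) → none rz g)
    top′ : ∃ λ k → Rng s k × Top (a + i) W (e₁ p i (κ k))
    top′ with top
    ... | k , r , t = k , r , t′
      where
      t′ : Top (a + i) W (e₁ p i (κ k))
      t′ y ry lt with cover p i a p≤a y ry
      ... | old q rq = t q rq (w<w⁻ (κ k) q (κ-Rng k r) rq lt)
      ... | new x rx = <-irrefl refl (<-≤-trans v< (≤-trans (≮⇒≥ (t q₀ rq₀)) (w<π⁻ (κ k) x (κ-Rng k r) rx lt)))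

zero-or-Rng : ∀ {s} j → j ≤ s → j ≡ 0 ⊎ Rng s j
zero-or-Rng zero    _  = inj₁ refl
zero-or-Rng (suc j) le = inj₂ (s≤s z≤n , le)

-- The block of a cell (m , l) goes directly after the kernel entry l − 1 and directly below the
-- kernel entry of value m; the entries of the later cells are to the right of and below it.
module Slot {a s : ℕ} {w ρ κ : ℕ → ℕ} {cs : List (ℕ × ℕ)} (pw : IsPerm a w) (pρ : IsPerm s ρ)
  (Fi : Filled a s w ρ κ cs) {m l₀ : ℕ} (G : GoodCell s ρ m (suc l₀))
  (after : ∀ m′ l′ → (m′ , l′) ∈ cs → GoodCell s ρ m′ l′ × (suc l₀ < l′ ⊎ (suc l₀ ≡ l′ × m′ < m)))
  (h : ℕ) (rh : Rng s h) (ρh≡m : ρ h ≡ m) where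

  open Filled Fi
  open Kernel isKernel
  private
    module G = GoodCell G

  p v : ℕ
  p = κ l₀
  v = w (κ h) ∸ 1

  suc-v : suc v ≡ w (κ h)
  suc-v = m+[n∸m]≡n (proj₁ (proj₁ pw (κ h) (κ-Rng h rh)))

  v<a : v < a
  v<a = subst (_≤ a) (sym suc-v) (proj₂ (proj₁ pw (κ h) (κ-Rng h rh)))

  private
    l₀-cases : l₀ ≡ 0 ⊎ Rng s l₀
    l₀-cases = zero-or-Rng l₀ (≤-pred (proj₂ G.l-Rng))

  p≤a : p ≤ a
  p≤a with l₀-cases
  ... | inj₁ refl = subst (_≤ a) (sym κ-0) z≤n
  ... | inj₂ r    = proj₂ (κ-Rng l₀ r)

  κ≤p : ∀ k → Rng s k → k ≤ l₀ → κ k ≤ p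
  κ≤p k r le with m≤n⇒m<n∨m≡n le
  ... | inj₂ refl = ≤-refl
  ... | inj₁ lt   = <⇒≤ (κ-mono k l₀ r (≤-trans (s≤s z≤n) lt , ≤-pred (proj₂ G.l-Rng)) lt)

  p<κ : ∀ k → Rng s k → l₀ < k → p < κ k
  p<κ k r lt with l₀-cases
  ... | inj₁ refl = subst (_< κ k) (sym κ-0) (proj₁ (κ-Rng k r))
  ... | inj₂ r₀   = κ-mono l₀ k r₀ r lt

  κ-low : ∀ k → Rng s k → ρ k < m → w (κ k) ≤ v
  κ-low k r lt = ≤-pred (subst (w (κ k) <_) (sym suc-v) (pattern-κ k h r rh (subst (ρ k <_) (sym ρh≡m) lt)))

  κ-high : ∀ k → Rng s k → m ≤ ρ k → v < w (κ k)
  κ-high k r le with m≤n⇒m<n∨m≡n le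
  ... | inj₁ lt = ≤-trans (≤-reflexive suc-v) (<⇒≤ (pattern-κ h k rh r (subst (_< ρ k) (sym ρh≡m) lt)))
  ... | inj₂ e  = ≤-reflexive (trans suc-v (cong (λ z → w (κ z)) (proj₂ pρ h k rh r (trans ρh≡m e))))

  cell-right : ∀ q m′ l′ → Rng a q → (m′ , l′) ∈ cs → InCell s w ρ κ q m′ l′ → p < q
  cell-right q m′ l′ rq c∈ C with l₀-cases
  ... | inj₁ refl = subst (_< q) (sym κ-0) (proj₁ rq)
  ... | inj₂ r    = InCell.left C l₀ r (proj₂ (precedes pρ G (proj₁ (after m′ l′ c∈)) (proj₂ (after m′ l′ c∈))))

  cell-low : ∀ q m′ l′ → (m′ , l′) ∈ cs → InCell s w ρ κ q m′ l′ → w q ≤ v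
  cell-low q m′ l′ c∈ C = ≤-pred (subst (w q <_) (sym suc-v) (InCell.above C h rh
    (subst (m′ ≤_) (sym ρh≡m) (proj₁ (precedes pρ G (proj₁ (after m′ l′ c∈)) (proj₂ (after m′ l′ c∈)))))))

  -- Entries of later cells are right of the block and below it, so they are neither left-below nor
  -- right-above it. Only kernel letters remain, and for them the conditions are those of the good
  -- cell.
  good : Good a p v w
  good = record { no-left-below = nlb ; right-above-increasing = rai }
    where
    nlb : ∀ q → Rng a q → q ≤ p → v < w q
    nlb q rq q≤p with located q rq
    ... | inj₁ (k , r , refl) = κ-high k r (G.left⇒above k r (s≤s (≮⇒≥ λ lt → <-irrefl refl (<-≤-trans (p<κ k r lt) q≤p))))
    ... | inj₂ (m′ , l′ , c∈ , C) = ⊥-elim (<-irrefl refl (<-≤-trans (cell-right q m′ l′ rq c∈ C) q≤p))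
    rai : ∀ q q′ → Rng a q → Rng a q′ → p < q → q < q′ → v < w q → v < w q′ → w q < w q′
    rai q q′ rq rq′ p<q q<q′ v<q v<q′ with located q rq | located q′ rq′
    ... | inj₂ (m′ , l′ , c∈ , C) | _ = ⊥-elim (<-irrefl refl (<-≤-trans v<q (cell-low q m′ l′ c∈ C)))
    ... | inj₁ _ | inj₂ (m′ , l′ , c∈ , C) = ⊥-elim (<-irrefl refl (<-≤-trans v<q′ (cell-low q′ m′ l′ c∈ C)))
    ... | inj₁ (k , r , refl) | inj₁ (k′ , r′ , refl) = pattern-κ k k′ r r′
            (G.right-above-increasing k k′ r r′ (≰⇒> λ le → <-irrefl refl (<-≤-trans p<q (κ≤p k r le)))
              (κ-reflect k k′ r r′ q<q′) (hi k r v<q) (hi k′ r′ v<q′))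
      where
      hi : ∀ k → Rng s k → v < w (κ k) → m ≤ ρ k
      hi k r lt = ≮⇒≥ λ lt′ → <-irrefl refl (<-≤-trans lt (κ-low k r lt′))

  module _ {i : ℕ} {W π : ℕ → ℕ} (I : Insertion a i p v W w π) where
    open Insertion I hiding (p≤a)

    block-inCell : ∀ x → Rng i x → InCell s W ρ (e₁ p i ∘ κ) (e₂ p x) m (suc l₀)
    block-inCell x rx = record
      { left = λ k r lt → e₁<e₂ (κ≤p k r (≤-pred lt)) rx
      ; right = λ k r le → e₂<e₁ (p<κ k r le) rx
      ; below = λ k r lt → w<π (κ k) x (κ-Rng k r) rx (κ-low k r lt)
      ; above = λ k r le → π<w (κ k) x (κ-Rng k r) rx (κ-high k r le)
      }

    inCell-ins : ∀ {q m′ l′} → Rng a q → InCell s w ρ κ q m′ l′ → InCell s W ρ (e₁ p i ∘ κ) (e₁ p i q) m′ l′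
    inCell-ins rq C = record
      { left = λ k r lt → e₁-mono p i (InCell.left C k r lt)
      ; right = λ k r le → e₁-mono p i (InCell.right C k r le)
      ; below = λ k r lt → w<w _ _ (κ-Rng k r) rq (InCell.below C k r lt)
      ; above = λ k r le → w<w _ _ rq (κ-Rng k r) (InCell.above C k r le)
      }

    filled : Filled (a + i) s W ρ (e₁ p i ∘ κ) ((m , suc l₀) ∷ cs)
    filled = record
      { isKernel = kernel-ins I good isKernel (κ h , κ-Rng h rh , ≤-reflexive suc-v)
      ; located = loc
      }
      where
      loc : ∀ q → Rng (a + i) q → Img s (e₁ p i ∘ κ) q ⊎ _
      loc y ry with cover p i a p≤a y ry
      ... | new x rx = inj₂ (m , suc l₀ , here refl , block-inCell x rx)
      ... | old q rq with located q rq
      ...   | inj₁ (k , r , e) = inj₁ (k , r , cong (e₁ p i) e)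
      ...   | inj₂ (m′ , l′ , c∈ , C) = inj₂ (m′ , l′ , there c∈ , inCell-ins rq C)

    -- On kernel letters `discordant` is the test by which `lcell` counts.
    discordant-κ : ∀ k → Rng s k → discordant (κ k) ≡ b2n (((m ≤ᵇ ρ k) ∧ (k <ᵇ suc l₀)) ∨ ((ρ k <ᵇ m) ∧ (suc l₀ ≤ᵇ k)))
    discordant-κ k r with k ≤? l₀ | ρ k <? m
    ... | yes g | yes h rewrite ≤ᵇ-true (κ≤p k r g) | <ᵇ-false (κ-low k r h) | <ᵇ-false (κ≤p k r g)
                              | ≤ᵇ-false h | <ᵇ-true h | <ᵇ-false g = refl
    ... | yes g | no h  rewrite ≤ᵇ-true (κ≤p k r g) | <ᵇ-true (κ-high k r (≮⇒≥ h)) | <ᵇ-false (κ≤p k r g)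
                              | ≤ᵇ-true (≮⇒≥ h) | <ᵇ-false (≮⇒≥ h) | <ᵇ-true (s≤s g) = refl
    ... | no g  | yes h rewrite ≤ᵇ-false (p<κ k r (≰⇒> g)) | <ᵇ-true (p<κ k r (≰⇒> g)) | ≤ᵇ-true (κ-low k r h)
                              | ≤ᵇ-false h | <ᵇ-true h | <ᵇ-true (≰⇒> g) = refl
    ... | no g  | no h  rewrite ≤ᵇ-false (p<κ k r (≰⇒> g)) | <ᵇ-true (p<κ k r (≰⇒> g)) | ≤ᵇ-false (κ-high k r (≮⇒≥ h))
                              | ≤ᵇ-true (≮⇒≥ h) | <ᵇ-false (≮⇒≥ h) | <ᵇ-false (≰⇒> g) = refl

    -- Such an entry belongs to a later cell and is therefore below-right of the block; this
    -- produces the products of block sizes in the inversion number.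
    discordant-cell : ∀ q → Rng a q → ¬ Img s κ q → discordant q ≡ 1
    discordant-cell q rq ¬im with located q rq
    ... | inj₁ im = ⊥-elim (¬im im)
    ... | inj₂ (m′ , l′ , c∈ , C) rewrite ≤ᵇ-false (cell-right q m′ l′ rq c∈ C) | <ᵇ-true (cell-right q m′ l′ rq c∈ C)
                                        | ≤ᵇ-true (cell-low q m′ l′ c∈ C) = refl

-- Searching positions and initial segments

locate : ℕ → (ℕ → ℕ) → ℕ → ℕ
locate zero    ρ m = 0
locate (suc s) ρ m = if ρ (suc s) ≡ᵇ m then suc s else locate s ρ m

locate-spec : ∀ s ρ m → (∃ λ k → Rng s k × ρ k ≡ m) → Rng s (locate s ρ m) × ρ (locate s ρ m) ≡ m
locate-spec zero    ρ m (k , (a , b) , _) = ⊥-elim (<-irrefl refl (≤-trans a b))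
locate-spec (suc s) ρ m (k , (a , b) , e) with ρ (suc s) ≡ᵇ m in eq
... | true  = last , ≡ᵇ-true⁻ {ρ (suc s)} eq
... | false with m≤n⇒m<n∨m≡n b
...   | inj₁ (s≤s k≤s) = let (r , e′) = locate-spec s ρ m (k , (a , k≤s) , e) in weaken r , e′
...   | inj₂ refl      = case trans (sym eq) (≡ᵇ-true {ρ (suc s)} e) of λ ()

-- A decidable property that is inherited downwards holds exactly on an initial segment. It delimits
-- the block of a cell and finds the row and the column of an entry.
interval : ∀ d p (P : ℕ → Set) → (∀ x → p < x → x ≤ p + d → P x ⊎ ¬ P x) →
           (∀ x y → p < x → x < y → y ≤ p + d → P y → P x) →
           ∃ λ i → i ≤ d × (∀ x → p < x → x ≤ p + i → P x) × (∀ x → p + i < x → x ≤ p + d → ¬ P x)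
interval zero p P dec down = 0 , z≤n , (λ x a b → ⊥-elim (<-irrefl refl (<-≤-trans a (subst (x ≤_) (+-identityʳ p) b))))
                                     , (λ x a b → ⊥-elim (<-irrefl refl (<-≤-trans a b)))
interval (suc d) p P dec down with dec (suc p) ≤-refl (subst (suc p ≤_) (sym (+-suc p d)) (s≤s (m≤m+n p d)))
... | inj₂ ¬P = 0 , z≤n , (λ x a b → ⊥-elim (<-irrefl refl (<-≤-trans a (subst (x ≤_) (+-identityʳ p) b)))) , none
  where
  none : ∀ x → p + 0 < x → x ≤ p + suc d → ¬ P x
  none x a b Px with m≤n⇒m<n∨m≡n (subst (_< x) (+-identityʳ p) a)
  ... | inj₁ lt = ¬P (down (suc p) x ≤-refl lt b Px)
  ... | inj₂ e  = ¬P (subst P (sym e) Px)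
... | inj₁ P1 with interval d (suc p) P (λ x a b → dec x (<-trans (n<1+n p) a) (subst (x ≤_) (sym (+-suc p d)) b))
                     (λ x y a b c → down x y (<-trans (n<1+n p) a) b (subst (y ≤_) (sym (+-suc p d)) c))
...   | i , i≤d , yes′ , no′ = suc i , s≤s i≤d , all , λ x a b → no′ x (subst (_< x) (+-suc p i) a) (subst (x ≤_) (+-suc p d) b)
  where
  all : ∀ x → p < x → x ≤ p + suc i → P x
  all x a b with m≤n⇒m<n∨m≡n a
  ... | inj₁ lt = yes′ x lt (subst (x ≤_) (+-suc p i) b)
  ... | inj₂ e  = subst P e P1

decImg : ∀ s κ q → Img s κ q ⊎ ¬ Img s κ q
decImg zero    κ q = inj₂ λ { (k , (a , b) , _) → <-irrefl refl (≤-trans a b) }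
decImg (suc s) κ q with κ (suc s) ≟ q | decImg s κ q
... | yes e | _                    = inj₁ (suc s , last , e)
... | no _  | inj₁ (k , r , e)     = inj₁ (k , weaken r , e)
... | no h  | inj₂ g               = inj₂ λ { (k , (a , b) , e) → case m≤n⇒m<n∨m≡n b of λ where
        (inj₁ (s≤s k≤s)) → g (k , (a , k≤s) , e)
        (inj₂ refl)      → h e }

-- Blocks are inserted from the last cell to the first; the second component tracks the positions
-- of the letters of ρ.
combine : Word → List (ℕ × ℕ) → List Word → Word × (ℕ → ℕ)
combine ρ []             πs       = ρ , id
combine ρ (c ∷ cs)       []       = ρ , id
combine ρ ((m , l) ∷ cs) (π ∷ πs) = ins w p v π , e₁ p (length π) ∘ κ
  where
  w = proj₁ (combine ρ cs πs)
  κ = proj₂ (combine ρ cs πs)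
  p = κ (l ∸ 1)
  v = (w at κ (locate (length ρ) (ρ at_) m)) ∸ 1

sizeWith : ℕ → List Word → ℕ
sizeWith s []       = s
sizeWith s (π ∷ πs) = sizeWith s πs + length π

sizeWith-total : ∀ s πs → sizeWith s πs ≡ s + total length πs
sizeWith-total s []       = sym (+-identityʳ s)
sizeWith-total s (π ∷ πs) = trans (cong (_+ length π) (sizeWith-total s πs))
  (trans (+-assoc s _ _) (cong (s +_) (+-comm _ (length π))))

-- A block is inverted with the kernel entries counted by lcell and with all entries of later cells.
crossings : Word → List (ℕ × ℕ) → List Word → ℕ
crossings ρ (c ∷ cs) (π ∷ πs) = length π * (lcell ρ c + total length πs) + crossings ρ cs πs
crossings ρ _        _        = 0

Blocks : List Word → Set
Blocks = All (λ π → π ∈ Sym (length π))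

un : ℕ → ℕ → ℕ → ℕ
un p i x = if x ≤ᵇ p then x else x ∸ i

un-e₁ : ∀ p i y → un p i (e₁ p i y) ≡ y
un-e₁ p i y with y ≤? p
... | yes h rewrite e₁-≤ {p} {i} h | ≤ᵇ-true h = refl
... | no h rewrite e₁-> {p} {i} (≰⇒> h) | ≤ᵇ-false {i + y} {p} (<-≤-trans (≰⇒> h) (m≤n+m y i)) | m+n∸m≡n i y = refl

un-≤ : ∀ p i x → x ≤ p → un p i x ≡ x
un-≤ p i x h rewrite ≤ᵇ-true h = refl

inCell-cong : ∀ {s u ρ κ κ′ q m l} → (∀ k → Rng s k → κ k ≡ κ′ k) → InCell s u ρ κ q m l → InCell s u ρ κ′ q m l
inCell-cong {u = u} {q = q} e C = record
  { left = λ k r h → subst (_< q) (e k r) (left k r h)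
  ; right = λ k r h → subst (q <_) (e k r) (right k r h)
  ; below = λ k r h → subst (λ z → u z < u q) (e k r) (below k r h)
  ; above = λ k r h → subst (λ z → u q < u z) (e k r) (above k r h)
  }
  where open InCell C

-- Both old words and both blocks read their comparisons off the same W; the thresholds v and v′ are
-- not compared.
insertion-unique : ∀ {a i p v v′ W w w′ π π′} → Insertion a i p v W w π → Insertion a i p v′ W w′ π′ → Pat a w w′ × Pat i π π′
insertion-unique I I′ =
    (λ q q′ r r′ lt → Insertion.w<w⁻ I′ q q′ r r′ (Insertion.w<w I q q′ r r′ lt))
  , (λ q q′ r r′ lt → Insertion.π<π⁻ I′ q q′ r r′ (Insertion.π<π I q q′ r r′ lt))

-- Assembling and decomposing a permutation cell by cell

record Chain (s : ℕ) (ρ : ℕ → ℕ) (cs : List (ℕ × ℕ)) : Set where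
  field
    sorted : AllPairs CellLt cs
    allGood : ∀ m l → (m , l) ∈ cs → GoodCell s ρ m l

module Assembly (s : ℕ) (ρ : Word) (ρ∈ : ρ ∈ Sym s) (1≤s : 1 ≤ s) (conn : Connected s (ρ at_)) where

  private
    len : length ρ ≡ s
    len = proj₁ (∈-Sym⁻ s ρ ρ∈)
    pρ : IsPerm s (ρ at_)
    pρ = proj₂ (∈-Sym⁻ s ρ ρ∈)

  CH : List (ℕ × ℕ) → Set
  CH = Chain s (ρ at_)

  chain-tail : ∀ {c cs} → CH (c ∷ cs) → CH cs
  chain-tail ch with Chain.sorted ch
  ... | _ ∷ so = record { sorted = so ; allGood = λ m l c∈ → Chain.allGood ch m l (there c∈) }

  chain-after : ∀ {m l cs} → CH ((m , l) ∷ cs) → ∀ m′ l′ → (m′ , l′) ∈ cs → GoodCell s (ρ at_) m′ l′ × CellLt (m , l) (m′ , l′)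
  chain-after ch m′ l′ c∈ with Chain.sorted ch
  ... | lt ∷ _ = Chain.allGood ch m′ l′ (there c∈) , All.lookup lt c∈

  chain-head : ∀ {m l cs} → CH ((m , l) ∷ cs) → GoodCell s (ρ at_) m l
  chain-head ch = Chain.allGood ch _ _ (here refl)

  cells-chain : CH (cells ρ)
  cells-chain = record { sorted = cells-sorted s ρ ρ∈ ; allGood = λ m l c∈ → cells-good s ρ ρ∈ conn c∈ }

  identity-kernel : Kernel s s (ρ at_) (ρ at_) id
  identity-kernel = record
    { κ-0 = refl
    ; κ-Rng = λ k r → r
    ; κ-mono = λ k k′ r r′ lt → lt
    ; pattern-κ = λ q q′ r r′ lt → lt
    ; closed = λ i j k ri rj rk _ _ → (i , ri , refl) , (j , rj , refl) , (k , rk , refl)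
    ; top = let (k , r , e) = perm-surjective s (ρ at_) pρ s (1≤s , ≤-refl) in k , r , value-top s (ρ at_) pρ k e
    ; connected = conn
    }

  h : ℕ → ℕ
  h m = locate (length ρ) (ρ at_) m

  h-spec : ∀ m → Rng s m → Rng s (h m) × ρ at h m ≡ m
  h-spec m r = subst (λ z → Rng z (h m)) len (proj₁ spec) , proj₂ spec
    where
    spec = locate-spec (length ρ) (ρ at_) m (subst (λ z → ∃ λ k → Rng z k × ρ at k ≡ m) (sym len) (perm-surjective s (ρ at_) pρ m r))

  record Assembled (cs : List (ℕ × ℕ)) (πs : List Word) : Set₁ where
    private
      w = proj₁ (combine ρ cs πs)
      κ = proj₂ (combine ρ cs πs)
      a = sizeWith s πs
    field
      inSym : w ∈ Sym a
      isFilled : Filled a s (w at_) (ρ at_) κ cs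
      -- Applied to `discordant`, which is 1 off the kernel, this gives the `lcell` of the next cell
      -- plus the number of entries already placed.
      count : ∀ g → (∀ q → Rng a q → ¬ Img s κ q → g q ≡ 1) → sumR a g ≡ sumR s (g ∘ κ) + total length πs
      occurrences : N3 a (w at_) ≡ N3 s (ρ at_) + total n132 πs
      inversions : N2 a (w at_) ≡ N2 s (ρ at_) + total inv πs + crossings ρ cs πs

  module Step {m l₀ : ℕ} {cs : List (ℕ × ℕ)} (ch : CH ((m , suc l₀) ∷ cs)) {πs : List Word} (A : Assembled cs πs)
              (π : Word) (π∈ : π ∈ Sym (length π)) where
    private
      w = proj₁ (combine ρ cs πs)
      κ = proj₂ (combine ρ cs πs)
      a = sizeWith s πs
      i = length π
    open Assembled A
    private
      pw = proj₂ (∈-Sym⁻ a w inSym)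
      rm = GoodCell.m-Rng (chain-head ch)

    module S = Slot pw pρ isFilled (chain-head ch) (chain-after ch) (h m) (proj₁ (h-spec m rm)) (proj₂ (h-spec m rm))

    I : Insertion a i S.p S.v (ins w S.p S.v π at_) (w at_) (π at_)
    I = ins-Insertion a i S.p S.v w π inSym π∈ S.p≤a

    step : Assembled ((m , suc l₀) ∷ cs) (π ∷ πs)
    step = record
      { inSym = ins-Sym a i S.p S.v w π inSym π∈ S.p≤a (<⇒≤ S.v<a)
      ; isFilled = S.filled I
      ; count = count′
      ; occurrences = trans (GoodInsertion.N3-additive I S.good) (trans (cong₂ _+_ occurrences (sym (n132-N3 π)))
          (trans (+-assoc (N3 s (ρ at_)) _ _) (cong (N3 s (ρ at_) +_) (+-comm _ (n132 π)))))
      ; inversions = inversions′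
      }
      where
      count′ : ∀ g → (∀ q → Rng (a + i) q → ¬ Img s (e₁ S.p i ∘ κ) q → g q ≡ 1) →
               sumR (a + i) g ≡ sumR s (g ∘ e₁ S.p i ∘ κ) + (length π + total length πs)
      count′ g hyp = begin
        sumR (a + i) g ≡⟨ splitSum S.p i a S.p≤a g ⟩
        sumR a (g ∘ e₁ S.p i) + sumR i (g ∘ e₂ S.p)
          ≡⟨ cong₂ _+_ (count (g ∘ e₁ S.p i) λ q r ¬im → hyp (e₁ S.p i q) (e₁-Rng r) λ { (k , rk , e) → ¬im (k , rk , e₁-injective S.p i e) })
                       (trans (sumR-cong i λ x r → hyp (e₂ S.p x) (e₂-Rng S.p≤a r) λ { (k , rk , e) → e₁≢e₂ r e })
                         (trans (sumR-const i 1) (*-identityʳ i))) ⟩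
        sumR s (g ∘ e₁ S.p i ∘ κ) + total length πs + i ≡⟨ +-assoc (sumR s (g ∘ e₁ S.p i ∘ κ)) _ i ⟩
        sumR s (g ∘ e₁ S.p i ∘ κ) + (total length πs + i) ≡⟨ cong (sumR s (g ∘ e₁ S.p i ∘ κ) +_) (+-comm _ i) ⟩
        sumR s (g ∘ e₁ S.p i ∘ κ) + (length π + total length πs) ∎
        where open ≡-Reasoning
      D : sumR a (Insertion.discordant I) ≡ lcell ρ (m , suc l₀) + total length πs
      D = trans (count (Insertion.discordant I) (S.discordant-cell I)) (cong (_+ total length πs)
        (trans (sumR-cong s (S.discordant-κ I)) (trans (cong (λ z → sumR z g) (sym len)) (sym (countᵇ-range _ (length ρ))))))
        where
        g : ℕ → ℕ
        g k = b2n (((m ≤ᵇ (ρ at k)) ∧ (k <ᵇ suc l₀)) ∨ (((ρ at k) <ᵇ m) ∧ (suc l₀ ≤ᵇ k)))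
      inversions′ : N2 (a + i) (ins w S.p S.v π at_) ≡
        N2 s (ρ at_) + (inv π + total inv πs) + (i * (lcell ρ (m , suc l₀) + total length πs) + crossings ρ cs πs)
      inversions′ = begin
        N2 (a + i) (ins w S.p S.v π at_) ≡⟨ Insertion.N2-split I ⟩
        (N2 a (w at_) + N2 i (π at_)) + i * sumR a (Insertion.discordant I)
          ≡⟨ cong₂ (λ y z → y + i * z) (cong₂ _+_ inversions (sym (inv-N2 π))) D ⟩
        ((R + τ + E) + inv π) + B ≡⟨ shuffle R τ E (inv π) B ⟩
        R + (inv π + τ) + (B + E) ∎
        where
        open ≡-Reasoning
        R = N2 s (ρ at_)
        τ = total inv πs
        E = crossings ρ cs πs
        B = i * (lcell ρ (m , suc l₀) + total length πs)
        shuffle : ∀ r t e x b → ((r + t + e) + x) + b ≡ r + (x + t) + (b + e)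
        shuffle r t e x b = begin
          ((r + t + e) + x) + b ≡⟨ cong (_+ b) (+-assoc (r + t) e x) ⟩
          (r + t + (e + x)) + b ≡⟨ cong (λ z → r + t + z + b) (+-comm e x) ⟩
          (r + t + (x + e)) + b ≡⟨ +-assoc (r + t) (x + e) b ⟩
          r + t + ((x + e) + b) ≡⟨ cong (r + t +_) (trans (+-assoc x e b) (cong (x +_) (+-comm e b))) ⟩
          r + t + (x + (b + e)) ≡⟨ sym (+-assoc (r + t) x (b + e)) ⟩
          r + t + x + (b + e)   ≡⟨ cong (_+ (b + e)) (trans (+-assoc r t x) (cong (r +_) (+-comm t x))) ⟩
          r + (x + t) + (b + e) ∎

  assembled : ∀ cs πs → CH cs → length πs ≡ length cs → Blocks πs → Assembled cs πs
  assembled [] [] ch _ _ = record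
    { inSym = ρ∈
    ; isFilled = record { isKernel = identity-kernel ; located = λ q r → inj₁ (q , r , refl) }
    ; count = λ g _ → sym (+-identityʳ _)
    ; occurrences = sym (+-identityʳ _)
    ; inversions = sym (trans (+-identityʳ _) (+-identityʳ _))
    }
  assembled ((m , zero) ∷ cs) (π ∷ πs) ch _ _ = case proj₁ (GoodCell.l-Rng (chain-head ch)) of λ ()
  assembled ((m , suc l₀) ∷ cs) (π ∷ πs) ch e (π∈ ∷ bs) =
    Step.step ch (assembled cs πs (chain-tail ch) (suc-injective e) bs) π π∈

  -- Only the new entries lie in the first cell: kernel entries lie in none, and an old entry that
  -- were also in a later cell would precede itself by `ordered`. Hence word and kernel positions
  -- determine the length of the block.
  block-bound : ∀ {m l₀ cs πs} (ch : CH ((m , suc l₀) ∷ cs)) (A : Assembled cs πs) π (π∈ : π ∈ Sym (length π)) →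
    let κ′ = proj₂ (combine ρ ((m , suc l₀) ∷ cs) (π ∷ πs))
        u  = proj₁ (combine ρ ((m , suc l₀) ∷ cs) (π ∷ πs)) in
    ∀ q → Rng (sizeWith s πs + length π) q → InCell s (u at_) (ρ at_) κ′ q m (suc l₀) → q ≤ proj₂ (combine ρ cs πs) l₀ + length π
  block-bound {m} {l₀} {cs} {πs} ch A π π∈ y ry C with cover S.p (length π) (sizeWith s πs) S.p≤a y ry
    where open Step ch A π π∈
  ... | new x rx = +-monoʳ-≤ _ (proj₂ rx)
  ... | old q rq with Filled.located (Assembled.isFilled A) q rq
  ...   | inj₁ (k , r , e) = ⊥-elim (inCell⇒¬Img C (k , r , cong (e₁ _ _) e))
  ...   | inj₂ (m′ , l′ , c∈ , C′) = ⊥-elim (<-irrefl refl (proj₁ (ordered pρ (chain-head ch) (proj₁ (chain-after ch m′ l′ c∈))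
            (proj₂ (∈-Sym⁻ _ _ (Assembled.inSym step))) (Filled.isKernel (Assembled.isFilled step)) (proj₂ (chain-after ch m′ l′ c∈))
            ry ry C (S.inCell-ins I rq C′))))
    where open Step ch A π π∈

  combine-injective : ∀ cs πs πs′ → CH cs → length πs ≡ length cs → length πs′ ≡ length cs → Blocks πs → Blocks πs′ →
    proj₁ (combine ρ cs πs) ≡ proj₁ (combine ρ cs πs′) →
    (∀ k → k ≤ s → proj₂ (combine ρ cs πs) k ≡ proj₂ (combine ρ cs πs′) k) → πs ≡ πs′
  combine-injective [] [] [] _ _ _ _ _ _ _ = refl
  combine-injective ((m , zero) ∷ cs) (π ∷ πs) (π′ ∷ πs′) ch _ _ _ _ _ _ = case proj₁ (GoodCell.l-Rng (chain-head ch)) of λ ()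
  combine-injective ((m , suc l₀) ∷ cs) (π ∷ πs) (π′ ∷ πs′) ch e e′ (π∈ ∷ bs) (π′∈ ∷ bs′) eqw eqκ =
    cong₂ _∷_ π≡π′ (combine-injective cs πs πs′ (chain-tail ch) (suc-injective e) (suc-injective e′) bs bs′ w≡w′ κ≡κ′)
    where
    A = assembled cs πs (chain-tail ch) (suc-injective e) bs
    A′ = assembled cs πs′ (chain-tail ch) (suc-injective e′) bs′
    module St = Step ch A π π∈
    module St′ = Step ch A′ π′ π′∈
    a = sizeWith s πs
    a′ = sizeWith s πs′
    i = length π
    i′ = length π′
    w = proj₁ (combine ρ cs πs)
    w′ = proj₁ (combine ρ cs πs′)
    κ = proj₂ (combine ρ cs πs)
    κ′ = proj₂ (combine ρ cs πs′)
    -- The position p is fixed by its own shift `e₁`, so it is the value at `l₀` of the kernel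
    -- positions of the whole word.
    p≡p′ : St.S.p ≡ St′.S.p
    p≡p′ = trans (sym (e₁-≤ ≤-refl)) (trans (eqκ l₀ (≤-pred (proj₂ (GoodCell.l-Rng (chain-head ch))))) (e₁-≤ ≤-refl))
    n≡n′ : a + i ≡ a′ + i′
    n≡n′ = trans (sym (length-ins w _ _ π ⟨trans⟩ cong (_+ i) (proj₁ (∈-Sym⁻ a w (Assembled.inSym A)))))
             (trans (cong length eqw) (length-ins w′ _ _ π′ ⟨trans⟩ cong (_+ i′) (proj₁ (∈-Sym⁻ a′ w′ (Assembled.inSym A′)))))
      where
      infixl 4 _⟨trans⟩_
      _⟨trans⟩_ : ∀ {x y z : ℕ} → x ≡ y → y ≡ z → x ≡ z
      _⟨trans⟩_ = trans
    -- The last entry of the second block lies in the first cell of the common word, so the bound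
    -- for the first block applies to it.
    i′≤i : i′ ≤ i
    i′≤i with zero-or-Rng i′ (≤-refl {i′})
    ... | inj₁ z = subst (_≤ i) (sym z) z≤n
    ... | inj₂ r = +-cancelˡ-≤ St.S.p i′ i (block-bound ch A π π∈ (St.S.p + i′)
            (subst₂ (λ x y → Rng x (y + i′)) (sym n≡n′) (sym p≡p′) (e₂-Rng {St′.S.p} St′.S.p≤a r))
            (inCell-cong (λ k rk → sym (eqκ k (proj₂ rk))) (subst₂ (λ y z → InCell s (z at_) (ρ at_) (e₁ St′.S.p i′ ∘ κ′) (y + i′) m (suc l₀)) (sym p≡p′) (sym eqw) (St′.S.block-inCell St′.I i′ r))))
    i≤i′ : i ≤ i′
    i≤i′ with zero-or-Rng i (≤-refl {i})
    ... | inj₁ z = subst (_≤ i′) (sym z) z≤n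
    ... | inj₂ r = +-cancelˡ-≤ St′.S.p i i′ (block-bound ch A′ π′ π′∈ (St′.S.p + i)
            (subst₂ (λ x y → Rng x (y + i)) n≡n′ p≡p′ (e₂-Rng {St.S.p} St.S.p≤a r))
            (inCell-cong (λ k rk → eqκ k (proj₂ rk)) (subst₂ (λ y z → InCell s (z at_) (ρ at_) (e₁ St.S.p i ∘ κ) (y + i) m (suc l₀)) p≡p′ eqw (St.S.block-inCell St.I i r))))
    i≡i′ : i ≡ i′
    i≡i′ = ≤-antisym i≤i′ i′≤i
    a≡a′ : a ≡ a′
    a≡a′ = +-cancelʳ-≡ i a a′ (trans n≡n′ (cong (a′ +_) (sym i≡i′)))
    I″ : Insertion a i St.S.p St′.S.v (ins w St.S.p St.S.v π at_) (w′ at_) (π′ at_)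
    I″ = subst (λ z → Insertion z i St.S.p St′.S.v (ins w St.S.p St.S.v π at_) (w′ at_) (π′ at_)) (sym a≡a′)
           (subst₂ (λ y z → Insertion a′ y z St′.S.v (ins w St.S.p St.S.v π at_) (w′ at_) (π′ at_)) (sym i≡i′) (sym p≡p′)
             (subst (λ z → Insertion a′ i′ St′.S.p St′.S.v (z at_) (w′ at_) (π′ at_)) (sym eqw) St′.I))
    w≡w′ : w ≡ w′
    w≡w′ = Sym-ext a w w′ (Assembled.inSym A) (subst (λ z → w′ ∈ Sym z) (sym a≡a′) (Assembled.inSym A′)) (proj₁ (insertion-unique St.I I″))
    π≡π′ : π ≡ π′
    π≡π′ = Sym-ext i π π′ π∈ (subst (λ z → π′ ∈ Sym z) (sym i≡i′) π′∈) (proj₂ (insertion-unique St.I I″))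
    κ≡κ′ : ∀ k → k ≤ s → κ k ≡ κ′ k
    κ≡κ′ k r = e₁-injective St.S.p i (trans (eqκ k r) (cong₂ (λ y z → e₁ y z (κ′ k)) (sym p≡p′) (sym i≡i′)))

  -- The inverse of one insertion: the entries of the first cell occupy the gap after `κ l₀` and are
  -- cut out. Both parts are standardised, as only their patterns matter for putting them together
  -- again.
  module Peel {m l₀ : ℕ} {cs : List (ℕ × ℕ)} (ch : CH ((m , suc l₀) ∷ cs)) (a i : ℕ) (u : Word) (κ : ℕ → ℕ)
    (u∈ : u ∈ Sym (a + i)) (Fi : Filled (a + i) s (u at_) (ρ at_) κ ((m , suc l₀) ∷ cs)) (p≤a : κ l₀ ≤ a)
    (inside : ∀ x → Rng i x → InCell s (u at_) (ρ at_) κ (e₂ (κ l₀) x) m (suc l₀))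
    (outside : ∀ y → Rng a y → ¬ InCell s (u at_) (ρ at_) κ (e₁ (κ l₀) i y) m (suc l₀)) where

    open Filled Fi
    open Kernel isKernel
    private
      pu : IsPerm (a + i) (u at_)
      pu = proj₂ (∈-Sym⁻ (a + i) u u∈)

    p : ℕ
    p = κ l₀

    w π : Word
    w = std a (λ q → u at e₁ p i q)
    π = std i (λ x → u at e₂ p x)

    κ′ : ℕ → ℕ
    κ′ k = un p i (κ k)

    private
      w-inj : Injective-on a (λ q → u at e₁ p i q)
      w-inj q q′ r r′ e = e₁-injective p i (proj₂ pu _ _ (e₁-Rng r) (e₁-Rng r′) e)
      π-inj : Injective-on i (λ x → u at e₂ p x)
      π-inj x x′ r r′ e = +-cancelˡ-≡ p x x′ (proj₂ pu _ _ (e₂-Rng p≤a r) (e₂-Rng p≤a r′) e)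

    w∈ : w ∈ Sym a
    w∈ = std-Sym a _ w-inj
    π∈ : π ∈ Sym i
    π∈ = std-Sym i _ π-inj

    private
      u<w : Pat a (λ q → u at e₁ p i q) (w at_)
      u<w = std-Pat a _
      w<u : Pat a (w at_) (λ q → u at e₁ p i q)
      w<u = Pat-reflect a _ _ w-inj u<w
      u<π : Pat i (λ x → u at e₂ p x) (π at_)
      u<π = std-Pat i _

      preimage : ∀ k → Rng s k → ∃ λ y → Rng a y × e₁ p i y ≡ κ k
      preimage k r = go (κ k) refl (cover p i a p≤a (κ k) (κ-Rng k r))
        where
        go : ∀ x → κ k ≡ x → Cover p i a x → ∃ λ y → Rng a y × e₁ p i y ≡ κ k
        go _ e (old y ry) = y , ry , sym e
        go _ e (new x rx) = ⊥-elim (inCell⇒¬Img (inside x rx) (k , r , e))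

      κ′-spec : ∀ k → Rng s k → Rng a (κ′ k) × e₁ p i (κ′ k) ≡ κ k
      κ′-spec k r with preimage k r
      ... | y , ry , e = subst (Rng a) (sym κ′≡y) ry , trans (cong (e₁ p i) κ′≡y) e
        where
        κ′≡y : κ′ k ≡ y
        κ′≡y = trans (cong (un p i) (sym e)) (un-e₁ p i y)

    e₁-κ′ : ∀ k → k ≤ s → e₁ p i (κ′ k) ≡ κ k
    e₁-κ′ k le with zero-or-Rng k le
    ... | inj₂ r    = proj₂ (κ′-spec k r)
    ... | inj₁ refl = trans (cong (e₁ p i) (trans (cong (un p i) κ-0) (un-≤ p i 0 z≤n))) (trans (e₁-≤ z≤n) (sym κ-0))

    κ′-l₀ : κ′ l₀ ≡ p
    κ′-l₀ = un-≤ p i p ≤-refl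

    private
      u-κ : ∀ k → Rng s k → u at e₁ p i (κ′ k) ≡ u at κ k
      u-κ k r = cong (u at_) (proj₂ (κ′-spec k r))

      img↓ : ∀ {q} → Img s κ (e₁ p i q) → Img s κ′ q
      img↓ {q} (k , r , e) = k , r , trans (cong (un p i) e) (un-e₁ p i q)

      img↑ : ∀ {q} → Img s κ′ q → Img s κ (e₁ p i q)
      img↑ (k , r , e) = k , r , trans (sym (proj₂ (κ′-spec k r))) (cong (e₁ p i) e)

    kernel′ : Kernel a s (w at_) (ρ at_) κ′
    kernel′ = record
      { κ-0 = trans (cong (un p i) κ-0) (un-≤ p i 0 z≤n)
      ; κ-Rng = λ k r → proj₁ (κ′-spec k r)
      ; κ-mono = λ k k′ r r′ lt → e₁-reflect p i (subst₂ _<_ (sym (proj₂ (κ′-spec k r))) (sym (proj₂ (κ′-spec k′ r′))) (κ-mono k k′ r r′ lt))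
      ; pattern-κ = λ k k′ r r′ lt → u<w (κ′ k) (κ′ k′) (proj₁ (κ′-spec k r)) (proj₁ (κ′-spec k′ r′))
          (subst₂ _<_ (sym (u-κ k r)) (sym (u-κ k′ r′)) (pattern-κ k k′ r r′ lt))
      ; closed = λ x y z rx ry rz (b , c , d , f) im →
          let (g , g′ , g″) = closed (e₁ p i x) (e₁ p i y) (e₁ p i z) (e₁-Rng rx) (e₁-Rng ry) (e₁-Rng rz)
                (e₁-mono p i b , e₁-mono p i c , w<u x z rx rz d , w<u z y rz ry f) (map₃ img↑ img↑ img↑ im)
          in img↓ g , img↓ g′ , img↓ g″
      ; top = let (k , r , t) = top in k , r , λ q rq lt →
          t (e₁ p i q) (e₁-Rng rq) (subst (_< u at e₁ p i q) (u-κ k r) (w<u (κ′ k) q (proj₁ (κ′-spec k r)) rq lt))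
      ; connected = connected
      }

    located′ : ∀ y → Rng a y → Img s κ′ y ⊎ (∃ λ m′ → ∃ λ l′ → (m′ , l′) ∈ cs × InCell s (w at_) (ρ at_) κ′ y m′ l′)
    located′ y ry with located (e₁ p i y) (e₁-Rng ry)
    ... | inj₁ im = inj₁ (img↓ im)
    ... | inj₂ (_ , _ , here refl , C) = ⊥-elim (outside y ry C)
    ... | inj₂ (m′ , l′ , there c∈ , C) = inj₂ (m′ , l′ , c∈ , record
            { left = λ k r lt → e₁-reflect p i (subst (_< e₁ p i y) (sym (proj₂ (κ′-spec k r))) (InCell.left C k r lt))
            ; right = λ k r le → e₁-reflect p i (subst (e₁ p i y <_) (sym (proj₂ (κ′-spec k r))) (InCell.right C k r le))
            ; below = λ k r lt → u<w (κ′ k) y (proj₁ (κ′-spec k r)) ry (subst (_< u at e₁ p i y) (sym (u-κ k r)) (InCell.below C k r lt))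
            ; above = λ k r le → u<w y (κ′ k) ry (proj₁ (κ′-spec k r)) (subst (u at e₁ p i y <_) (sym (u-κ k r)) (InCell.above C k r le))
            })

    filled′ : Filled a s (w at_) (ρ at_) κ′ cs
    filled′ = record { isKernel = kernel′ ; located = located′ }

    private
      rm = GoodCell.m-Rng (chain-head ch)
      module S = Slot (proj₂ (∈-Sym⁻ a w w∈)) pρ filled′ (chain-head ch) (chain-after ch) (h m) (proj₁ (h-spec m rm)) (proj₂ (h-spec m rm))

    v : ℕ
    v = (w at κ′ (h m)) ∸ 1

    private
      I : Insertion a i p v (ins w p v π at_) (w at_) (π at_)
      I = ins-Insertion a i p v w π w∈ π∈ p≤a

      -- The threshold v is read off a kernel letter, but it separates all old letters correctly.
      -- Those of later cells are below it anyway; a kernel letter smaller than a block entry has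
      -- value less than m in ρ.
      low : ∀ q x → Rng a q → Rng i x → u at e₁ p i q < u at e₂ p x → w at q ≤ v
      low q x rq rx lt with located′ q rq
      ... | inj₂ (m′ , l′ , c∈ , C) = S.cell-low q m′ l′ c∈ C
      ... | inj₁ (k , r , refl) = S.κ-low k r (≰⇒> λ le →
              <-asym (InCell.above (inside x rx) k r le) (subst (_< u at e₂ p x) (u-κ k r) lt))

      high-kernel : ∀ q x → Rng i x → Img s κ′ q → u at e₂ p x < u at e₁ p i q → v < w at q
      high-kernel q x rx (k , r , refl) lt = S.κ-high k r (≮⇒≥ λ h →
        <-asym (InCell.below (inside x rx) k r h) (subst (u at e₂ p x <_) (u-κ k r) lt))

      high : ∀ q x → Rng a q → Rng i x → u at e₂ p x < u at e₁ p i q → v < w at q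
      high q x rq rx lt with located (e₁ p i q) (e₁-Rng rq)
      ... | inj₁ im = high-kernel q x rx (img↓ im) lt
      ... | inj₂ (_ , _ , here refl , C) = ⊥-elim (outside q rq C)
      ... | inj₂ (m″ , l″ , there c∈ , C) = ⊥-elim (<-asym lt (proj₂ (ordered pρ (chain-head ch) (proj₁ (chain-after ch m″ l″ c∈))
              pu isKernel (proj₂ (chain-after ch m″ l″ c∈)) (e₂-Rng p≤a rx) (e₁-Rng rq) (inside x rx) C)))

    reassemble : u ≡ ins w p v π
    reassemble = Sym-ext (a + i) u (ins w p v π) u∈ (ins-Sym a i p v w π w∈ π∈ p≤a (<⇒≤ S.v<a)) pat
      where
      pat : Pat (a + i) (u at_) (ins w p v π at_)
      pat y y′ ry ry′ lt with cover p i a p≤a y ry | cover p i a p≤a y′ ry′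
      ... | old q rq | old q′ rq′ = Insertion.w<w I q q′ rq rq′ (u<w q q′ rq rq′ lt)
      ... | old q rq | new x rx   = Insertion.w<π I q x rq rx (low q x rq rx lt)
      ... | new x rx | old q rq   = Insertion.π<w I q x rq rx (high q x rq rx lt)
      ... | new x rx | new x′ rx′ = Insertion.π<π I x x′ rx rx′ (u<π x x′ rx rx′ lt)

  -- An increasing surjection of this kind has no room to move. If κ k < k, induction makes κ k a
  -- fixed point and contradicts injectivity; if κ k > k, the preimage of k is smaller than k and is
  -- fixed by induction.
  κ-surjective⇒id : ∀ {n u κ} → Kernel n s u (ρ at_) κ → (∀ q → Rng n q → Img s κ q) → ∀ k → Rng s k → κ k ≡ k
  κ-surjective⇒id {n} {u} {κ} K onto k r = go k k r ≤-refl
    where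
    open Kernel K
    go : ∀ b k → Rng s k → k ≤ b → κ k ≡ k
    go zero    k r k≤b = ⊥-elim (<-irrefl refl (≤-trans (proj₁ r) k≤b))
    go (suc b) k r k≤b with <-cmp (κ k) k
    ... | tri≈ _ e _ = e
    ... | tri< lt _ _ = ⊥-elim (<-irrefl (κ-injective (κ k) k r′ r (go b (κ k) r′ (≤-pred (≤-trans lt k≤b)))) lt)
      where
      r′ : Rng s (κ k)
      r′ = proj₁ (κ-Rng k r) , <⇒≤ (<-≤-trans lt (proj₂ r))
    ... | tri> _ _ gt with onto k (proj₁ r , <⇒≤ (<-≤-trans gt (proj₂ (κ-Rng k r))))
    ...   | k′ , r′ , e = ⊥-elim (<-irrefl (trans (sym (go b k′ r′ (≤-pred (≤-trans k′<k k≤b)))) e) k′<k)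
      where
      k′<k : k′ < k
      k′<k = κ-reflect k′ k r′ r (subst (_< κ k) (sym e) gt)

  record Decomposition (n : ℕ) (u : Word) (κ : ℕ → ℕ) (cs : List (ℕ × ℕ)) : Set where
    constructor decomposition
    field
      blocks : List Word
      arity : length blocks ≡ length cs
      perms : Blocks blocks
      sizes : sizeWith s blocks ≡ n
      word-eq : proj₁ (combine ρ cs blocks) ≡ u
      κ-eq : ∀ k → k ≤ s → proj₂ (combine ρ cs blocks) k ≡ κ k

  decompose : ∀ cs → CH cs → ∀ n u κ → u ∈ Sym n → Filled n s (u at_) (ρ at_) κ cs → Decomposition n u κ cs
  decompose [] ch n u κ u∈ Fi = decomposition [] refl [] s≡n ρ≡u id≡κ
    where
    open Filled Fi
    open Kernel isKernel
    onto : ∀ q → Rng n q → Img s κ q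
    onto q r with located q r
    ... | inj₁ im = im
    ... | inj₂ (_ , _ , () , _)
    κ≡id = κ-surjective⇒id isKernel onto
    id≡κ : ∀ k → k ≤ s → k ≡ κ k
    id≡κ k le with zero-or-Rng k le
    ... | inj₁ refl = sym κ-0
    ... | inj₂ r    = sym (κ≡id k r)
    s≤n : s ≤ n
    s≤n = subst (_≤ n) (κ≡id s (1≤s , ≤-refl)) (proj₂ (κ-Rng s (1≤s , ≤-refl)))
    s≡n : s ≡ n
    s≡n with onto n (≤-trans 1≤s s≤n , ≤-refl)
    ... | k , r , e = ≤-antisym s≤n (subst (_≤ s) (trans (sym (κ≡id k r)) e) (proj₂ r))
    ρ≡u : ρ ≡ u
    ρ≡u = Sym-ext s ρ u ρ∈ (subst (λ z → u ∈ Sym z) (sym s≡n) u∈)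
      λ q q′ r r′ lt → subst₂ (λ x y → u at x < u at y) (κ≡id q r) (κ≡id q′ r′) (pattern-κ q q′ r r′ lt)
  decompose ((m , zero) ∷ cs) ch n u κ u∈ Fi = case proj₁ (GoodCell.l-Rng (chain-head ch)) of λ ()
  decompose ((m , suc l₀) ∷ cs) ch n u κ u∈ Fi = result
    where
    module F = Filled Fi
    module K = Kernel F.isKernel
    p = κ l₀
    l₀≤s : l₀ ≤ s
    l₀≤s = ≤-pred (proj₂ (GoodCell.l-Rng (chain-head ch)))
    p≤n : p ≤ n
    p≤n with zero-or-Rng l₀ l₀≤s
    ... | inj₁ refl = subst (_≤ n) (sym K.κ-0) z≤n
    ... | inj₂ r    = proj₂ (K.κ-Rng l₀ r)
    d = n ∸ p
    p+d : p + d ≡ n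
    p+d = m+[n∸m]≡n p≤n
    P : ℕ → Set
    P q = InCell s (u at_) (ρ at_) κ q m (suc l₀)
    P⇒p< : ∀ q → Rng n q → P q → p < q
    P⇒p< q r C with zero-or-Rng l₀ l₀≤s
    ... | inj₁ refl = subst (_< q) (sym K.κ-0) (proj₁ r)
    ... | inj₂ r₀   = InCell.left C l₀ r₀ ≤-refl
    pu = proj₂ (∈-Sym⁻ n u u∈)
    before : ∀ q q′ → Rng n q → Rng n q′ → P q → ∀ m′ l′ → (m′ , l′) ∈ cs → InCell s (u at_) (ρ at_) κ q′ m′ l′ → q < q′
    before q q′ r r′ C m′ l′ c∈ C′ = proj₁ (ordered pρ (chain-head ch) (proj₁ (chain-after ch m′ l′ c∈)) pu F.isKernel
      (proj₂ (chain-after ch m′ l′ c∈)) r r′ C C′)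
    mkR : ∀ x → p < x → x ≤ p + d → Rng n x
    mkR x lt le = ≤-trans (s≤s z≤n) lt , subst (x ≤_) p+d le
    dec : ∀ x → p < x → x ≤ p + d → P x ⊎ ¬ P x
    dec x lt le with F.located x (mkR x lt le)
    ... | inj₁ im = inj₂ λ C → inCell⇒¬Img C im
    ... | inj₂ (_ , _ , here refl , C) = inj₁ C
    ... | inj₂ (m′ , l′ , there c∈ , C) = inj₂ λ C′ → <-irrefl refl (before x x (mkR x lt le) (mkR x lt le) C′ m′ l′ c∈ C)
    -- An entry x between the kernel position p and an entry y of the first cell stays in that cell:
    -- an entry of a later cell would come after y, and a kernel entry is either at most p or right
    -- of the cell.
    down : ∀ x y → p < x → x < y → y ≤ p + d → P y → P x
    down x y lt x<y le C with F.located x (mkR x lt (<⇒≤ (<-≤-trans x<y le)))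
    ... | inj₂ (_ , _ , here refl , C′) = C′
    ... | inj₂ (m′ , l′ , there c∈ , C′) = ⊥-elim (<-asym x<y (before y x (mkR y (<-trans lt x<y) le)
            (mkR x lt (<⇒≤ (<-≤-trans x<y le))) C m′ l′ c∈ C′))
    ... | inj₁ (k , r , refl) with k ≤? l₀
    ...   | no h  = ⊥-elim (<-asym x<y (InCell.right C k r (≰⇒> h)))
    ...   | yes h with m≤n⇒m<n∨m≡n h
    ...     | inj₂ refl = ⊥-elim (<-irrefl refl lt)
    ...     | inj₁ k<l₀ = ⊥-elim (<-asym lt (K.κ-mono k l₀ r (≤-trans (s≤s z≤n) k<l₀ , l₀≤s) k<l₀))
    block = interval d p P dec down
    i = proj₁ block
    i≤d : i ≤ d
    i≤d = proj₁ (proj₂ block)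
    -- Equals n - i, written so that p ≤ a is immediate.
    a = p + (d ∸ i)
    a+i : a + i ≡ n
    a+i = trans (+-assoc p (d ∸ i) i) (trans (cong (p +_) (m∸n+n≡m i≤d)) p+d)
    p≤a : p ≤ a
    p≤a = m≤m+n p (d ∸ i)
    inside : ∀ x → Rng i x → P (e₂ p x)
    inside x (l , r) = proj₁ (proj₂ (proj₂ block)) (p + x) (m<m+n p l) (+-monoʳ-≤ p r)
    outside : ∀ y → Rng a y → ¬ P (e₁ p i y)
    outside y r C = let r′ = subst (λ z → Rng z (e₁ p i y)) a+i (e₁-Rng r)
                        p<y = P⇒p< (e₁ p i y) r′ C
                    in proj₂ (proj₂ (proj₂ block)) (e₁ p i y) (p+i< p<y) (subst (e₁ p i y ≤_) (sym p+d) (proj₂ r′)) C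
      where
      p+i< : p < e₁ p i y → p + i < e₁ p i y
      p+i< lt with y ≤? p
      ... | yes g = ⊥-elim (<-irrefl refl (<-≤-trans lt (subst (_≤ p) (sym (e₁-≤ g)) g)))
      ... | no g  = subst₂ _<_ (+-comm i p) (sym (e₁-> (≰⇒> g))) (+-monoʳ-< i (≰⇒> g))
    module Q = Peel ch a i u κ (subst (λ z → u ∈ Sym z) (sym a+i) u∈) (subst (λ z → Filled z s (u at_) (ρ at_) κ _) (sym a+i) Fi) p≤a inside outside
    rec : Decomposition a Q.w Q.κ′ cs
    rec = decompose cs (chain-tail ch) a Q.w Q.κ′ Q.w∈ Q.filled′
    module R = Decomposition rec
    lenπ : length Q.π ≡ i
    lenπ = proj₁ (∈-Sym⁻ i Q.π Q.π∈)
    κl₀ : proj₂ (combine ρ cs R.blocks) l₀ ≡ p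
    κl₀ = trans (R.κ-eq l₀ l₀≤s) Q.κ′-l₀
    h≤s = proj₂ (proj₁ (h-spec m (GoodCell.m-Rng (chain-head ch))))
    result : Decomposition n u κ ((m , suc l₀) ∷ cs)
    result = decomposition (Q.π ∷ R.blocks) (cong suc R.arity) (subst (λ z → Q.π ∈ Sym z) (sym lenπ) Q.π∈ ∷ R.perms)
      (trans (cong₂ _+_ R.sizes lenπ) a+i)
      (trans (trans (cong₂ (λ x y → ins (proj₁ (combine ρ cs R.blocks)) x ((proj₁ (combine ρ cs R.blocks) at y) ∸ 1) Q.π) κl₀ (R.κ-eq (h m) h≤s))
                    (cong (λ z → ins z p ((z at Q.κ′ (h m)) ∸ 1) Q.π) R.word-eq))
             (sym Q.reassemble))
      (λ k le → trans (cong₂ (λ x y → e₁ x y (proj₂ (combine ρ cs R.blocks) k)) κl₀ lenπ)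
                 (trans (cong (e₁ p i) (R.κ-eq k le)) (Q.e₁-κ′ k le)))

  -- An entry outside the kernel determines a row and a column by comparison with the kernel. Their
  -- cell is feasible because any obstruction would join the entry to the kernel.
  fill-cells : ∀ n u κ → u ∈ Sym n → Kernel n s (u at_) (ρ at_) κ → Filled n s (u at_) (ρ at_) κ (cells ρ)
  fill-cells n u κ u∈ K = record { isKernel = K ; located = located }
    where
    open Kernel K
    pu = proj₂ (∈-Sym⁻ n u u∈)
    module _ (q : ℕ) (rq : Rng n q) (¬im : ¬ Img s κ q) where
      dec< : ∀ x y → x < y ⊎ ¬ (x < y)
      dec< x y with x <? y
      ... | yes g = inj₁ g
      ... | no g  = inj₂ g
      -- The kernel entries left of q form an initial segment of positions, and those below q an
      -- initial segment of values; their lengths are l - 1 and m - 1.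
      hor = interval s 0 (λ x → κ x < q) (λ x _ _ → dec< (κ x) q)
        (λ x y lt x<y le g → <-trans (κ-mono x y (lt , <⇒≤ (<-≤-trans x<y le)) (≤-trans lt (<⇒≤ x<y) , le) x<y) g)
      ver = interval s 0 (λ x → u at κ (h x) < u at q) (λ x _ _ → dec< (u at κ (h x)) (u at q))
        (λ x y lt x<y le g →
          let (rx , ex) = h-spec x (lt , <⇒≤ (<-≤-trans x<y le))
              (ry , ey) = h-spec y (≤-trans lt (<⇒≤ x<y) , le)
          in <-trans (pattern-κ (h x) (h y) rx ry (subst₂ _<_ (sym ex) (sym ey) x<y)) g)
      l₀ = proj₁ hor
      m₀ = proj₁ ver
      h-ρ : ∀ k → Rng s k → h (ρ at k) ≡ k
      h-ρ k r = let (r′ , e) = h-spec (ρ at k) (proj₁ pρ k r) in proj₂ pρ _ k r′ r e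
      C : InCell s (u at_) (ρ at_) κ q (suc m₀) (suc l₀)
      C = record
        { left = λ k r lt → proj₁ (proj₂ (proj₂ hor)) k (proj₁ r) (≤-pred lt)
        ; right = λ k r le → ≤∧≢⇒< (≮⇒≥ (proj₂ (proj₂ (proj₂ hor)) k le (proj₂ r))) λ e → ¬im (k , r , sym e)
        ; below = λ k r lt → subst (λ z → u at κ z < u at q) (h-ρ k r)
            (proj₁ (proj₂ (proj₂ ver)) (ρ at k) (proj₁ (proj₁ pρ k r)) (≤-pred lt))
        ; above = λ k r le → ≤∧≢⇒< (≮⇒≥ (subst (λ z → ¬ (u at κ z < u at q)) (h-ρ k r)
            (proj₂ (proj₂ (proj₂ ver)) (ρ at k) le (proj₂ (proj₁ pρ k r))))) λ e → ¬im (k , r , sym (proj₂ pu q (κ k) rq (κ-Rng k r) e))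
        }
      module C = InCell C
      -- The kernel contains the maximum, so not all of its letters are below q.
      m₀<s : m₀ < s
      m₀<s with top
      ... | k , r , t = ≰⇒> λ s≤m₀ → t q rq (C.below k r (s≤s (≤-trans (proj₂ (proj₁ pρ k r)) s≤m₀)))
      U : Unobstructed s (ρ at_) (suc m₀) (suc l₀)
      U = record
        { not-last = λ x y rx ry x<y y<l lo hi → ¬im (proj₂ (proj₂ (closed (κ x) (κ y) q (κ-Rng x rx) (κ-Rng y ry) rq
            (κ-mono x y rx ry x<y , C.left y ry y<l , C.below x rx lo , C.above y ry hi) (inj₁ (x , rx , refl)))))
        ; not-middle = λ x y rx ry x<l l≤y lt hi → ¬im (proj₁ (proj₂ (closed (κ x) q (κ y) (κ-Rng x rx) rq (κ-Rng y ry)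
            (C.left x rx x<l , C.right y ry l≤y , pattern-κ x y rx ry lt , C.below y ry hi) (inj₁ (x , rx , refl)))))
        ; not-first = λ x y rx ry l≤x x<y lo lt → ¬im (proj₁ (closed q (κ x) (κ y) rq (κ-Rng x rx) (κ-Rng y ry)
            (C.right x rx l≤x , κ-mono x y rx ry x<y , C.above y ry lo , pattern-κ y x ry rx lt) (inj₂ (inj₁ (x , rx , refl)))))
        }
      cell∈ : (suc m₀ , suc l₀) ∈ cells ρ
      cell∈ = good⇒∈-cells s ρ ρ∈ (unobstructed⇒good s (ρ at_) (suc m₀) (suc l₀) pρ conn (s≤s z≤n , m₀<s) (s≤s z≤n , s≤s (proj₁ (proj₂ hor))) U)
    located : ∀ q → Rng n q → Img s κ q ⊎ (∃ λ m → ∃ λ l → (m , l) ∈ cells ρ × InCell s (u at_) (ρ at_) κ q m l)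
    located q r with decImg s κ q
    ... | inj₁ im = inj₁ im
    ... | inj₂ ¬im = inj₂ (_ , _ , cell∈ q r ¬im , C q r ¬im)

-- Growing a set from the maximum, each new occurrence contributes at most two letters.
module SizeBound (s : ℕ) (ρ : ℕ → ℕ) (pρ : IsPerm s ρ) (conn : Connected s ρ) where

  private
    card : (ℕ → Bool) → ℕ
    card B = sumR s λ q → b2n (B q)

    all₃ : (ℕ → Bool) → ℕ → ℕ → ℕ → Bool
    all₃ B i j k = B i ∧ B j ∧ B k

    some₃ : (ℕ → Bool) → ℕ → ℕ → ℕ → Bool
    some₃ B i j k = B i ∨ B j ∨ B k

    insideᵇ crossᵇ : (ℕ → Bool) → ℕ → ℕ → ℕ → Bool
    insideᵇ B i j k = occᵇ ρ i j k ∧ all₃ B i j k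
    crossᵇ B i j k = occᵇ ρ i j k ∧ some₃ B i j k ∧ not (all₃ B i j k)

    inside cross : (ℕ → Bool) → ℕ
    inside B = sumR s λ i → sumR s λ j → sumR s λ k → b2n (insideᵇ B i j k)
    cross B = sumR s λ i → sumR s λ j → sumR s λ k → b2n (crossᵇ B i j k)

    inside≤N3 : ∀ B → inside B ≤ N3 s ρ
    inside≤N3 B = sumR-mono s λ i _ → sumR-mono s λ j _ → sumR-mono s λ k _ →
      b2n-mono {insideᵇ B i j k} λ t → proj₁ (∧-true {occᵇ ρ i j k} t)

    card≤s : ∀ B → card B ≤ s
    card≤s B = ≤-trans (sumR-mono s {h = λ _ → 1} (λ q _ → b2n≤1 (B q))) (≤-reflexive (trans (sumR-const s 1) (*-identityʳ s)))

    all₃-intro : ∀ B i j k → B i ≡ true → B j ≡ true → B k ≡ true → all₃ B i j k ≡ true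
    all₃-intro B i j k a b c = ∧-intro a (∧-intro b c)

    all₃-elim : ∀ B i j k → all₃ B i j k ≡ true → B i ≡ true × B j ≡ true × B k ≡ true
    all₃-elim B i j k t = let (a , t′) = ∧-true {B i} t ; (b , c) = ∧-true {B j} t′ in a , b , c

    some₃-intro : ∀ B i j k → B i ≡ true ⊎ B j ≡ true ⊎ B k ≡ true → some₃ B i j k ≡ true
    some₃-intro B i j k (inj₁ h)        = ∨-introˡ h
    some₃-intro B i j k (inj₂ (inj₁ h)) = ∨-introʳ {B i} (∨-introˡ h)
    some₃-intro B i j k (inj₂ (inj₂ h)) = ∨-introʳ {B i} (∨-introʳ {B j} h)

    not-true : ∀ {b} → not b ≡ true → b ≡ false
    not-true {false} _ = refl

    b2n≢0 : ∀ {b} → ¬ (b2n b ≡ 0) → b ≡ true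
    b2n≢0 {true}  _ = refl
    b2n≢0 {false} h = ⊥-elim (h refl)

    crossing : ∀ B → ¬ (cross B ≡ 0) → ∃ λ i → ∃ λ j → ∃ λ k → Rng s i × Rng s j × Rng s k × crossᵇ B i j k ≡ true
    crossing B ne =
      let (i , ri , ne₁) = sumR-witness s ne
          (j , rj , ne₂) = sumR-witness s ne₁
          (k , rk , ne₃) = sumR-witness s ne₂
      in i , j , k , ri , rj , rk , b2n≢0 ne₃

    cross≡0⇒closed : ∀ B → cross B ≡ 0 → Closed s ρ (λ q → B q ≡ true)
    cross≡0⇒closed B e i j k ri rj rk o h with all₃ B i j k in eq
    ... | true  = all₃-elim B i j k eq
    ... | false = case trans (sym (cong b2n c)) (sumR-0⁻ s (sumR-0⁻ s (sumR-0⁻ s e i ri) j rj) k rk) of λ ()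
      where
      c : crossᵇ B i j k ≡ true
      c = ∧-intro (Occ⇒occᵇ ρ i j k o) (∧-intro (some₃-intro B i j k h) (cong not eq))

    extend : (ℕ → Bool) → ℕ → ℕ → ℕ → Bool
    extend B y z q = B q ∨ (q ≡ᵇ y) ∨ (q ≡ᵇ z)

    extend-⊇ : ∀ B y z q → B q ≡ true → extend B y z q ≡ true
    extend-⊇ B y z q = ∨-introˡ

    extend-y : ∀ B y z → extend B y z y ≡ true
    extend-y B y z = ∨-introʳ {B y} (∨-introˡ (≡ᵇ-true {y} refl))

    extend-z : ∀ B y z → extend B y z z ≡ true
    extend-z B y z = ∨-introʳ {B z} (∨-introʳ {z ≡ᵇ y} (≡ᵇ-true {z} refl))

    card-extend : ∀ B y z → card (extend B y z) ≤ card B + 2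
    card-extend B y z = begin
      card (extend B y z) ≤⟨ sumR-mono s (λ q _ → bound (B q) (q ≡ᵇ y) (q ≡ᵇ z)) ⟩
      sumR s (λ q → b2n (B q) + (b2n (q ≡ᵇ y) + b2n (q ≡ᵇ z))) ≡⟨ sumR-+ s _ _ ⟩
      card B + sumR s (λ q → b2n (q ≡ᵇ y) + b2n (q ≡ᵇ z)) ≡⟨ cong (card B +_) (sumR-+ s _ _) ⟩
      card B + (sumR s (λ q → b2n (q ≡ᵇ y)) + sumR s (λ q → b2n (q ≡ᵇ z)))
        ≤⟨ +-monoʳ-≤ (card B) (+-mono-≤ (sum-eq≤1 s id y (λ _ _ _ _ e → e)) (sum-eq≤1 s id z (λ _ _ _ _ e → e))) ⟩
      card B + 2 ∎
      where
      open ≤-Reasoning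
      bound : ∀ a b c → b2n (a ∨ b ∨ c) ≤ b2n a + (b2n b + b2n c)
      bound true  b     c     = s≤s z≤n
      bound false true  c     = s≤s z≤n
      bound false false true  = ≤-refl
      bound false false false = z≤n

    crossing-pair : ∀ B i j k → crossᵇ B i j k ≡ true → ∃ λ y → ∃ λ z →
      all₃ (extend B y z) i j k ≡ true
    crossing-pair B i j k c with ∨-true {B i} (proj₁ (∧-true {some₃ B i j k} (proj₂ (∧-true {occᵇ ρ i j k} c))))
    ... | inj₁ h = j , k , all₃-intro (extend B j k) i j k (extend-⊇ B j k i h) (extend-y B j k) (extend-z B j k)
    ... | inj₂ t with ∨-true {B j} t
    ...   | inj₁ h = i , k , all₃-intro (extend B i k) i j k (extend-y B i k) (extend-⊇ B i k j h) (extend-z B i k)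
    ...   | inj₂ h = i , j , all₃-intro (extend B i j) i j k (extend-y B i j) (extend-z B i j) (extend-⊇ B i j k h)

    module Crossing (B B′ : ℕ → Bool) (sub : ∀ q → B q ≡ true → B′ q ≡ true) {i j k : ℕ} (ri : Rng s i) (rj : Rng s j) (rk : Rng s k)
                    (c : crossᵇ B i j k ≡ true) (full : all₃ B′ i j k ≡ true) where
      o : occᵇ ρ i j k ≡ true
      o = proj₁ (∧-true {occᵇ ρ i j k} c)
      not-full : all₃ B i j k ≡ false
      not-full = not-true (proj₂ (∧-true {some₃ B i j k} (proj₂ (∧-true {occᵇ ρ i j k} c))))

      all₃-mono : ∀ x y z → all₃ B x y z ≡ true → all₃ B′ x y z ≡ true
      all₃-mono x y z t = let (a , b , d) = all₃-elim B x y z t in all₃-intro B′ x y z (sub x a) (sub y b) (sub z d)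

      insideᵇ-mono : ∀ x y z → b2n (insideᵇ B x y z) ≤ b2n (insideᵇ B′ x y z)
      insideᵇ-mono x y z = b2n-mono {insideᵇ B x y z} λ t →
        let (a , b) = ∧-true {occᵇ ρ x y z} t in ∧-intro a (all₃-mono x y z b)

      inside-< : inside B < inside B′
      inside-< = sumR-mono-< s (λ x _ → sumR-mono s λ y _ → sumR-mono s λ z _ → insideᵇ-mono x y z) i ri
        (sumR-mono-< s (λ y _ → sumR-mono s λ z _ → insideᵇ-mono i y z) j rj
          (sumR-mono-< s (λ z _ → insideᵇ-mono i j z) k rk
            (subst₂ _<_ (cong b2n (sym (trans (cong (occᵇ ρ i j k ∧_) not-full) (∧-false (occᵇ ρ i j k)))))
                        (cong b2n (sym (∧-intro o full))) (s≤s z≤n))))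
        where
        ∧-false : ∀ b → (b ∧ false) ≡ false
        ∧-false true  = refl
        ∧-false false = refl

      gained : ∃ λ x → Rng s x × B x ≡ false × B′ x ≡ true
      gained with all₃-elim B′ i j k full | B i in ei | B j in ej | B k in ek
      ... | a , _ , _ | false | _     | _     = i , ri , ei , a
      ... | _ , a , _ | true  | false | _     = j , rj , ej , a
      ... | _ , _ , a | true  | true  | false = k , rk , ek , a
      ... | _         | true  | true  | true  = case trans (sym (all₃-intro B i j k ei ej ek)) not-full of λ ()

      card-< : card B < card B′
      card-< = let (x , rx , e , e′) = gained in
        sumR-mono-< s (λ q _ → b2n-mono (sub q)) x rx (subst₂ _<_ (cong b2n (sym e)) (cong b2n (sym e′)) (s≤s z≤n))

    -- While some occurrence crosses B, adding its missing letters costs at most two letters and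
    -- gains at least one inner occurrence, so card B - 2 · inside B does not increase. When none
    -- crosses, B is closed and by connectedness is everything. The inequality avoids subtraction; d
    -- bounds the number of letters still missing.
    grow : ∀ d B → s ≤ d + card B → (∀ q → Rng s q → Top s ρ q → B q ≡ true) → s + 2 * inside B ≤ card B + 2 * N3 s ρ
    grow d B le tp with cross B ≟ 0
    ... | yes e = +-mono-≤ (≤-reflexive (sym full)) (*-monoʳ-≤ 2 (inside≤N3 B))
      where
      full : card B ≡ s
      full = trans (sumR-cong s λ q r → cong b2n (conn (λ q → B q ≡ true) (cross≡0⇒closed B e) tp q r))
        (trans (sumR-const s 1) (*-identityʳ s))
    ... | no ne with crossing B ne
    ...   | i , j , k , ri , rj , rk , c with crossing-pair B i j k c
    ...     | y , z , full with d
    ...       | zero  = ⊥-elim (<-irrefl refl (<-≤-trans C.card-< (≤-trans (card≤s (extend B y z)) le)))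
      where module C = Crossing B (extend B y z) (extend-⊇ B y z) ri rj rk c full
    ...       | suc d′ = +-cancelʳ-≤ 2 _ _ (begin
        s + 2 * inside B + 2                ≡⟨ +-assoc s _ 2 ⟩
        s + (2 * inside B + 2)              ≡⟨ cong (s +_) (trans (+-comm _ 2) (sym (*-suc 2 (inside B)))) ⟩
        s + 2 * suc (inside B)              ≤⟨ +-monoʳ-≤ s (*-monoʳ-≤ 2 C.inside-<) ⟩
        s + 2 * inside (extend B y z)       ≤⟨ grow d′ (extend B y z) le′ (λ q r t → extend-⊇ B y z q (tp q r t)) ⟩
        card (extend B y z) + 2 * N3 s ρ    ≤⟨ +-monoˡ-≤ (2 * N3 s ρ) (card-extend B y z) ⟩
        card B + 2 + 2 * N3 s ρ             ≡⟨ trans (+-assoc (card B) 2 _) (trans (cong (card B +_) (+-comm 2 _)) (sym (+-assoc (card B) _ 2))) ⟩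
        card B + 2 * N3 s ρ + 2             ∎)
      where
      open ≤-Reasoning
      module C = Crossing B (extend B y z) (extend-⊇ B y z) ri rj rk c full
      le′ : s ≤ d′ + card (extend B y z)
      le′ = ≤-trans le (≤-trans (≤-reflexive (sym (+-suc d′ (card B)))) (+-monoʳ-≤ d′ C.card-<))

  size-bound : s ≤ 2 * N3 s ρ + 1
  size-bound = begin
    s                     ≤⟨ m≤m+n s (2 * inside B) ⟩
    s + 2 * inside B      ≤⟨ grow s B (m≤m+n s _) (λ q r t → ≡ᵇ-true {ρ q} (top-value s ρ pρ q r t)) ⟩
    card B + 2 * N3 s ρ   ≤⟨ +-monoˡ-≤ _ (sum-eq≤1 s ρ s (proj₂ pρ)) ⟩
    1 + 2 * N3 s ρ        ≡⟨ +-comm 1 _ ⟩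
    2 * N3 s ρ + 1        ∎
    where
    open ≤-Reasoning
    B : ℕ → Bool
    B q = ρ q ≡ᵇ s

-- Kernel permutations

eqListℕ-true : ∀ xs ys → eqListℕ xs ys ≡ true → xs ≡ ys
eqListℕ-true []       []       _ = refl
eqListℕ-true (x ∷ xs) (y ∷ ys) e = let (a , b) = ∧-true {x ≡ᵇ y} e in cong₂ _∷_ (≡ᵇ-true⁻ {x} a) (eqListℕ-true xs ys b)

eqListℕ-refl : ∀ xs → eqListℕ xs xs ≡ true
eqListℕ-refl []       = refl
eqListℕ-refl (x ∷ xs) = ∧-intro (≡ᵇ-true {x} refl) (eqListℕ-refl xs)

anyᵇ-true : {A : Set} (p : A → Bool) {xs : List A} {x : A} → x ∈ xs → p x ≡ true → anyᵇ p xs ≡ true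
anyᵇ-true p (here refl) e = ∨-introˡ e
anyᵇ-true p {y ∷ ys} (there x∈) e = ∨-introʳ {p y} (anyᵇ-true p x∈ e)

anyᵇ-true⁻ : {A : Set} (p : A → Bool) (xs : List A) → anyᵇ p xs ≡ true → ∃ λ x → x ∈ xs × p x ≡ true
anyᵇ-true⁻ p (x ∷ xs) e with ∨-true {p x} e
... | inj₁ h = x , here refl , h
... | inj₂ h = let (y , y∈ , t) = anyᵇ-true⁻ p xs h in y , there y∈ , t

-- The intrinsic description of kernel permutations: by `inK⇒KernelPerm` and `KernelPerm⇒inK` it
-- agrees with being the shape of a permutation of any given sufficient size.
record KernelPerm (s : ℕ) (ρ : Word) : Set₁ where
  field
    inSym : ρ ∈ Sym s
    nonempty : 1 ≤ s
    connected : Connected s (ρ at_)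

kernelShape-KernelPerm : ∀ n π → π ∈ Sym n → 1 ≤ n → KernelPerm (length (kernelList π)) (kernelShape π)
kernelShape-KernelPerm n π π∈ 1≤n = record
  { inSym = kernelShape-Sym n π π∈ 1≤n
  ; nonempty = let (k , r , _) = Kernel.top (kernel n π π∈ 1≤n) in ≤-trans (proj₁ r) (proj₂ r)
  ; connected = Kernel.connected (kernel n π π∈ 1≤n)
  }

abstract
  inK⇒KernelPerm : ∀ t s ρ → 1 ≤ t → ρ ∈ Sym s → inK t ρ ≡ true → KernelPerm s ρ
  inK⇒KernelPerm t s ρ 1≤t ρ∈ e =
    let (π , π∈ , t′) = anyᵇ-true⁻ (λ π → eqListℕ (kernelShape π) ρ) (Sym t) e
        eq = eqListℕ-true (kernelShape π) ρ t′
        len = trans (sym (proj₁ (∈-Sym⁻ _ _ (kernelShape-Sym t π π∈ 1≤t)))) (trans (cong length eq) (proj₁ (∈-Sym⁻ s ρ ρ∈)))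
    in subst₂ KernelPerm len eq (kernelShape-KernelPerm t π π∈ 1≤t)

  -- padding with small letters at the end creates no occurrence
  KernelPerm⇒inK : ∀ t s ρ → s ≤ t → KernelPerm s ρ → inK t ρ ≡ true
  KernelPerm⇒inK t s ρ s≤t KP = anyᵇ-true (λ π → eqListℕ (kernelShape π) ρ) π∈
    (trans (cong (λ z → eqListℕ z ρ) shape) (eqListℕ-refl ρ))
    where
    open KernelPerm KP
    module A = Assembly s ρ inSym nonempty connected
    i : ℕ
    i = t ∸ s
    pad : Word
    pad = tab i id
    pad∈ : pad ∈ Sym i
    pad∈ = ∈-Sym i pad (length-tab i id) ((λ q r → subst (Rng i) (sym (at-tab i id q r)) r)
      , λ q q′ r r′ e → trans (sym (at-tab i id q r)) (trans e (at-tab i id q′ r′)))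
    pρ : IsPerm s (ρ at_)
    pρ = proj₂ (∈-Sym⁻ s ρ inSym)
    I : Insertion s i s 0 (ins ρ s 0 pad at_) (ρ at_) (pad at_)
    I = ins-Insertion s i s 0 ρ pad inSym pad∈ ≤-refl
    G : Good s s 0 (ρ at_)
    G = record { no-left-below = λ q r _ → proj₁ (proj₁ pρ q r)
               ; right-above-increasing = λ q q′ r r′ lt → ⊥-elim (<-irrefl refl (<-≤-trans lt (proj₂ r))) }
    s+i : s + i ≡ t
    s+i = m+[n∸m]≡n s≤t
    π∈ : ins ρ s 0 pad ∈ Sym t
    π∈ = subst (λ z → ins ρ s 0 pad ∈ Sym z) s+i (ins-Sym s i s 0 ρ pad inSym pad∈ ≤-refl z≤n)
    shape : kernelShape (ins ρ s 0 pad) ≡ ρ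
    shape = kernelShape-unique t (ins ρ s 0 pad) π∈ (≤-trans nonempty s≤t) inSym
      (subst (λ z → Kernel z s (ins ρ s 0 pad at_) (ρ at_) (e₁ s i ∘ id)) s+i
        (kernel-ins I G A.identity-kernel (1 , (≤-refl , nonempty) , proj₁ (proj₁ pρ 1 (≤-refl , nonempty)))))

  ∈-K⁻ : ∀ t ρ → 1 ≤ t → ρ ∈ K t → KernelPerm (length ρ) ρ
  ∈-K⁻ t ρ 1≤t ρ∈ =
    let (s , s∈ , ρ∈′) = ∈-concatMap-elim (λ s → filterᵇ (inK t) (Sym s)) {range t} ρ∈
        (ρ∈″ , e) = ∈-filterᵇ⁻ (inK t) {Sym s} ρ∈′
    in subst (λ z → KernelPerm z ρ) (sym (proj₁ (∈-Sym⁻ s ρ ρ∈″))) (inK⇒KernelPerm t s ρ 1≤t ρ∈″ e)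

  -- The origin of the index 2r + 1: a connected shape with at most r occurrences has at most that
  -- many letters, and padding brings it to exactly that size.
  ∈-K : ∀ r s ρ → KernelPerm s ρ → n132 ρ ≤ r → ρ ∈ K (2 * r + 1)
  ∈-K r s ρ KP le = ∈-concatMap-intro (λ s → filterᵇ (inK (2 * r + 1)) (Sym s)) (∈-range (nonempty , s≤))
    (∈-filterᵇ (inK (2 * r + 1)) inSym (KernelPerm⇒inK (2 * r + 1) s ρ s≤ KP))
    where
    open KernelPerm KP
    s≤ : s ≤ 2 * r + 1
    s≤ = ≤-trans (SizeBound.size-bound s (ρ at_) (proj₂ (∈-Sym⁻ s ρ inSym)) connected)
      (+-monoˡ-≤ 1 (*-monoʳ-≤ 2 (subst (_≤ r) (trans (n132-N3 ρ) (cong (λ z → N3 z (ρ at_)) (proj₁ (∈-Sym⁻ s ρ inSym)))) le)))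

  K-unique : ∀ t → AllPairs _≢_ (K t)
  K-unique t = concatMap-unique (λ s → filterᵇ (inK t) (Sym s)) (range t) length (range-unique t)
    (λ s _ → filterᵇ-AllPairs (inK t) (Sym-unique s))
    λ s ρ ρ∈ → proj₁ (∈-Sym⁻ s ρ (proj₁ (∈-filterᵇ⁻ (inK t) {Sym s} ρ∈)))

-- Sums of rationals over lists

guard : Bool → ℚ → ℚ
guard b x = if b then x else 0ℚ

+ℚ-interchange : ∀ a b c d → (a +ℚ b) +ℚ (c +ℚ d) ≡ (a +ℚ c) +ℚ (b +ℚ d)
+ℚ-interchange = CommutativeSemigroup.interchange (CommutativeMonoid.commutativeSemigroup ℚₚ.+-0-commutativeMonoid)

abstract
  ∑ : {A : Set} → List A → (A → ℚ) → ℚ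
  ∑ xs g = sumℚ (map g xs)

  ∑-sumℚ : {A : Set} (xs : List A) (g : A → ℚ) → ∑ xs g ≡ sumℚ (map g xs)
  ∑-sumℚ xs g = refl

  ∑-[] : {A : Set} (g : A → ℚ) → ∑ [] g ≡ 0ℚ
  ∑-[] g = refl

  ∑-∷ : {A : Set} (x : A) (xs : List A) (g : A → ℚ) → ∑ (x ∷ xs) g ≡ g x +ℚ ∑ xs g
  ∑-∷ x xs g = refl

∑-[x] : {A : Set} (x : A) (g : A → ℚ) → ∑ (x ∷ []) g ≡ g x
∑-[x] x g = trans (∑-∷ x [] g) (trans (cong (g x +ℚ_) (∑-[] g)) (ℚₚ.+-identityʳ (g x)))

module _ {A : Set} where

  abstract
    ∑-cong : (xs : List A) {g h : A → ℚ} → (∀ x → x ∈ xs → g x ≡ h x) → ∑ xs g ≡ ∑ xs h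
    ∑-cong []       e = refl
    ∑-cong (x ∷ xs) e = cong₂ _+ℚ_ (e x (here refl)) (∑-cong xs λ y y∈ → e y (there y∈))

    ∑-0 : (xs : List A) {g : A → ℚ} → (∀ x → x ∈ xs → g x ≡ 0ℚ) → ∑ xs g ≡ 0ℚ
    ∑-0 []       e = refl
    ∑-0 (x ∷ xs) e = trans (cong₂ _+ℚ_ (e x (here refl)) (∑-0 xs λ y y∈ → e y (there y∈))) (ℚₚ.+-identityˡ 0ℚ)

    ∑-++ : (xs ys : List A) (g : A → ℚ) → ∑ (xs ++ ys) g ≡ ∑ xs g +ℚ ∑ ys g
    ∑-++ []       ys g = sym (ℚₚ.+-identityˡ _)
    ∑-++ (x ∷ xs) ys g = trans (cong (g x +ℚ_) (∑-++ xs ys g)) (sym (ℚₚ.+-assoc (g x) _ _))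

    ∑-+ : (xs : List A) (g h : A → ℚ) → ∑ xs (λ x → g x +ℚ h x) ≡ ∑ xs g +ℚ ∑ xs h
    ∑-+ []       g h = sym (ℚₚ.+-identityˡ 0ℚ)
    ∑-+ (x ∷ xs) g h = trans (cong ((g x +ℚ h x) +ℚ_) (∑-+ xs g h)) (+ℚ-interchange (g x) (h x) _ _)

    ∑-*ˡ : (c : ℚ) (xs : List A) (g : A → ℚ) → c *ℚ ∑ xs g ≡ ∑ xs (λ x → c *ℚ g x)
    ∑-*ˡ c []       g = ℚₚ.*-zeroʳ c
    ∑-*ˡ c (x ∷ xs) g = trans (ℚₚ.*-distribˡ-+ c (g x) _) (cong (c *ℚ g x +ℚ_) (∑-*ˡ c xs g))

    ∑-*ʳ : (c : ℚ) (xs : List A) (g : A → ℚ) → ∑ xs g *ℚ c ≡ ∑ xs (λ x → g x *ℚ c)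
    ∑-*ʳ c xs g = trans (ℚₚ.*-comm _ c) (trans (∑-*ˡ c xs g) (∑-cong xs λ x _ → ℚₚ.*-comm c (g x)))

    ∑-filterᵇ : (p : A → Bool) (xs : List A) (g : A → ℚ) → ∑ (filterᵇ p xs) g ≡ ∑ xs (λ x → guard (p x) (g x))
    ∑-filterᵇ p []       g = refl
    ∑-filterᵇ p (x ∷ xs) g with p x
    ... | true  = cong (g x +ℚ_) (∑-filterᵇ p xs g)
    ... | false = trans (∑-filterᵇ p xs g) (sym (ℚₚ.+-identityˡ _))

    ∑-single : (xs : List A) (g : A → ℚ) (x : A) → AllPairs _≢_ xs → x ∈ xs → (∀ y → y ≢ x → g y ≡ 0ℚ) → ∑ xs g ≡ g x
    ∑-single (y ∷ ys) g x (u ∷ us) (here refl) z =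
      trans (cong (g x +ℚ_) (∑-0 ys λ w w∈ → z w λ e → All.lookup u w∈ (sym e))) (ℚₚ.+-identityʳ (g x))
    ∑-single (y ∷ ys) g x (u ∷ us) (there x∈) z =
      trans (cong₂ _+ℚ_ (z y (All.lookup u x∈)) (∑-single ys g x us x∈ z)) (ℚₚ.+-identityˡ (g x))

    ∑-↭ : {xs ys : List A} (g : A → ℚ) → xs ↭ ys → ∑ xs g ≡ ∑ ys g
    ∑-↭ g Perm.refl                 = refl
    ∑-↭ g (Perm.prep x p)           = cong (g x +ℚ_) (∑-↭ g p)
    ∑-↭ {x ∷ y ∷ xs} g (Perm.swap _ _ p) = trans (cong (λ z → g x +ℚ (g y +ℚ z)) (∑-↭ g p))
      (trans (sym (ℚₚ.+-assoc (g x) (g y) _)) (trans (cong (_+ℚ _) (ℚₚ.+-comm (g x) (g y))) (ℚₚ.+-assoc (g y) (g x) _)))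
    ∑-↭ g (Perm.trans p q)          = trans (∑-↭ g p) (∑-↭ g q)

module _ {A B : Set} where

  abstract
    ∑-map : (k : A → B) (xs : List A) (g : B → ℚ) → ∑ (map k xs) g ≡ ∑ xs (λ x → g (k x))
    ∑-map k xs g = cong sumℚ (sym (map-∘ xs))

    ∑-concatMap : (F : A → List B) (xs : List A) (g : B → ℚ) → ∑ (concatMap F xs) g ≡ ∑ xs (λ x → ∑ (F x) g)
    ∑-concatMap F []       g = refl
    ∑-concatMap F (x ∷ xs) g = trans (∑-++ (F x) (concatMap F xs) g) (cong (∑ (F x) g +ℚ_) (∑-concatMap F xs g))

    ∑-swap : (xs : List A) (ys : List B) (g : A → B → ℚ) → ∑ xs (λ x → ∑ ys (g x)) ≡ ∑ ys (λ y → ∑ xs (λ x → g x y))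
    ∑-swap []       ys g = sym (∑-0 ys λ _ _ → refl)
    ∑-swap (x ∷ xs) ys g = trans (cong (∑ ys (g x) +ℚ_) (∑-swap xs ys g)) (sym (∑-+ ys (g x) _))

    ∑-*-∑ : (xs : List A) (ys : List B) (g : A → ℚ) (h : B → ℚ) → ∑ xs g *ℚ ∑ ys h ≡ ∑ xs (λ x → ∑ ys (λ y → g x *ℚ h y))
    ∑-*-∑ xs ys g h = trans (∑-*ʳ (∑ ys h) xs g) (∑-cong xs λ x _ → ∑-*ˡ (g x) ys h)

guard-∑ : {A : Set} (b : Bool) (xs : List A) (g : A → ℚ) → guard b (∑ xs g) ≡ ∑ xs (λ x → guard b (g x))
guard-∑ true  xs g = refl
guard-∑ false xs g = sym (∑-0 xs λ _ _ → refl)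

guard-*ˡ : ∀ b c x → c *ℚ guard b x ≡ guard b (c *ℚ x)
guard-*ˡ true  c x = refl
guard-*ˡ false c x = ℚₚ.*-zeroʳ c

guard-*ʳ : ∀ b c x → guard b x *ℚ c ≡ guard b (x *ℚ c)
guard-*ʳ true  c x = refl
guard-*ʳ false c x = ℚₚ.*-zeroˡ c

guard-∧ : ∀ a b x → guard a (guard b x) ≡ guard (a ∧ b) x
guard-∧ true  b x = refl
guard-∧ false b x = refl

upTo-unique : ∀ n → AllPairs _≢_ (upTo n)
upTo-unique n = AllPairsₚ.applyUpTo⁺₁ id n (λ i<j _ → <⇒≢ i<j)

∑-delta : ∀ c R (g : ℕ → ℚ) → ∑ (upTo (suc R)) (λ r → guard (c ≡ᵇ r) (g r)) ≡ guard (c ≤ᵇ R) (g c)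
∑-delta c R g with c ≤? R
... | yes h rewrite ≤ᵇ-true h = trans (∑-single (upTo (suc R)) (λ r → guard (c ≡ᵇ r) (g r)) c (upTo-unique (suc R)) (∈-upTo⁺ (s≤s h))
        λ y y≢c → cong (λ b → guard b (g y)) (≢true λ e → y≢c (sym (≡ᵇ-true⁻ {c} e)))) (cong (λ b → guard b (g c)) (≡ᵇ-true {c} refl))
... | no h rewrite ≤ᵇ-false (≰⇒> h) = ∑-0 (upTo (suc R)) λ y y∈ →
        cong (λ b → guard b (g y)) (≢true λ e → h (subst (_≤ R) (sym (≡ᵇ-true⁻ {c} e)) (≤-pred (∈-upTo⁻ y∈))))

-- Summing over the number r of occurrences assigned to the first block leaves only r = c, and then
-- the rest must account for T = R - c.
∑-convolution : ∀ c T R x y → ∑ (upTo (suc R)) (λ r → guard (c ≡ᵇ r) x *ℚ guard (T ≡ᵇ R ∸ r) y) ≡ guard (c + T ≡ᵇ R) (x *ℚ y)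
∑-convolution c T R x y = begin
  ∑ (upTo (suc R)) (λ r → guard (c ≡ᵇ r) x *ℚ guard (T ≡ᵇ R ∸ r) y)
    ≡⟨ ∑-cong (upTo (suc R)) (λ r _ → trans (guard-*ʳ (c ≡ᵇ r) _ x) (cong (guard (c ≡ᵇ r)) (guard-*ˡ (T ≡ᵇ R ∸ r) x y))) ⟩
  ∑ (upTo (suc R)) (λ r → guard (c ≡ᵇ r) (guard (T ≡ᵇ R ∸ r) (x *ℚ y))) ≡⟨ ∑-delta c R _ ⟩
  guard (c ≤ᵇ R) (guard (T ≡ᵇ R ∸ c) (x *ℚ y)) ≡⟨ guard-∧ (c ≤ᵇ R) _ _ ⟩
  guard ((c ≤ᵇ R) ∧ (T ≡ᵇ R ∸ c)) (x *ℚ y) ≡⟨ cong (λ b → guard b (x *ℚ y)) same ⟩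
  guard (c + T ≡ᵇ R) (x *ℚ y) ∎
  where
  open ≡-Reasoning
  same : ((c ≤ᵇ R) ∧ (T ≡ᵇ R ∸ c)) ≡ (c + T ≡ᵇ R)
  same = bool-ext
    (λ e → let (a , b) = ∧-true {c ≤ᵇ R} e in ≡ᵇ-true (trans (cong (c +_) (≡ᵇ-true⁻ {T} b)) (m+[n∸m]≡n (≤ᵇ-true⁻ {c} a))))
    (λ e → let e′ = ≡ᵇ-true⁻ {c + T} e in ∧-intro (≤ᵇ-true (subst (c ≤_) e′ (m≤m+n c T)))
             (≡ᵇ-true (trans (sym (m+n∸m≡n c T)) (cong (_∸ c) e′))))

∑-vectors : ∀ k (g : List Bool → ℚ) → ∑ (vectors (suc k)) g ≡ ∑ (true ∷ false ∷ []) (λ b → ∑ (vectors k) (λ v → g (b ∷ v)))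
∑-vectors k g = trans (∑-++ (map (true ∷_) (vectors k)) _ g)
  (trans (cong₂ _+ℚ_ (∑-map (true ∷_) (vectors k) g) (trans (∑-map (false ∷_) (vectors k) g) (sym (∑-[x] false _))))
    (sym (∑-∷ true (false ∷ []) _)))

sgnℚ-odd : ∀ n → sgnℚ n ≡ (if odd n then -ℚ 1ℚ else 1ℚ)
sgnℚ-odd zero          = refl
sgnℚ-odd (suc zero)    = refl
sgnℚ-odd (suc (suc n)) = sgnℚ-odd n

-- Fillings and the expansion of the cell factors

-- Follows the recursion of `compositions`, so that products of series can be expanded factor by
-- factor.
fillings : ℕ → ℕ → List (List Word)
fillings zero    zero    = [] ∷ []
fillings zero    (suc N) = []
fillings (suc k) N       =
  concatMap (λ i → concatMap (λ π → map (π ∷_) (fillings k (N ∸ i))) (Sym i)) (upTo (suc N))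

∈-fillings⁻ : ∀ k N πs → πs ∈ fillings k N → length πs ≡ k × Blocks πs × total length πs ≡ N
∈-fillings⁻ zero zero πs (here refl) = refl , [] , refl
∈-fillings⁻ (suc k) N πs πs∈
  with ∈-concatMap-elim (λ i → concatMap (λ π → map (π ∷_) (fillings k (N ∸ i))) (Sym i)) {upTo (suc N)} πs∈
... | i , i∈ , πs∈₁ with ∈-concatMap-elim (λ π → map (π ∷_) (fillings k (N ∸ i))) {Sym i} πs∈₁
...   | π , π∈ , πs∈₂ with ∈-map⁻ (π ∷_) πs∈₂
...     | πs′ , πs′∈ , refl with ∈-fillings⁻ k (N ∸ i) πs′ πs′∈
...       | l , b , t = cong suc l , subst (λ z → π ∈ Sym z) (sym len) π∈ ∷ b
                      , trans (cong₂ _+_ len t) (m+[n∸m]≡n (≤-pred (∈-upTo⁻ i∈)))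
  where
  len : length π ≡ i
  len = proj₁ (∈-Sym⁻ i π π∈)

∈-fillings : ∀ k N πs → length πs ≡ k → Blocks πs → total length πs ≡ N → πs ∈ fillings k N
∈-fillings zero    .0 []       refl b refl = here refl
∈-fillings (suc k) N (π ∷ πs) l (π∈ ∷ b) t =
  ∈-concatMap-intro (λ i → concatMap (λ π → map (π ∷_) (fillings k (N ∸ i))) (Sym i))
    (∈-upTo⁺ (s≤s (subst (length π ≤_) t (m≤m+n (length π) _))))
    (∈-concatMap-intro (λ π′ → map (π′ ∷_) (fillings k (N ∸ length π))) π∈
      (∈-map⁺ (π ∷_) (∈-fillings k (N ∸ length π) πs (suc-injective l) b
        (trans (sym (m+n∸m≡n (length π) _)) (cong (_∸ length π) t)))))

fillings-unique : ∀ k N → AllPairs _≢_ (fillings k N)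
fillings-unique zero    zero    = [] ∷ []
fillings-unique zero    (suc N) = []
fillings-unique (suc k) N       = concatMap-unique G (upTo (suc N)) (λ πs → length (head₀ πs)) (upTo-unique (suc N))
  (λ i _ → concatMap-unique (H i) (Sym i) head₀ (Sym-unique i)
    (λ π _ → map-unique (π ∷_) (λ { refl → refl }) (fillings-unique k (N ∸ i)))
    (λ π πs πs∈ → case ∈-map⁻ (π ∷_) πs∈ of λ { (_ , _ , refl) → refl }))
  (λ i πs πs∈ → length-head i πs πs∈)
  where
  head₀ : List Word → Word
  head₀ []      = []
  head₀ (π ∷ _) = π
  H : ℕ → Word → List (List Word)
  H i π = map (π ∷_) (fillings k (N ∸ i))
  G : ℕ → List (List Word)
  G i = concatMap (H i) (Sym i)
  length-head : ∀ i πs → πs ∈ G i → length (head₀ πs) ≡ i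
  length-head i πs πs∈ with ∈-concatMap-elim (H i) {Sym i} πs∈
  ... | π , π∈ , πs∈₁ with ∈-map⁻ (π ∷_) πs∈₁
  ...   | _ , _ , refl = proj₁ (∈-Sym⁻ i π π∈)

signs : List Word → ℚ
signs []       = 1ℚ
signs (π ∷ πs) = signℚ π *ℚ signs πs

parities : List Word → List Bool
parities = map (λ π → odd (length π))

∑-compositions : ∀ k R (g : List ℕ → ℚ) →
  ∑ (compositions (suc k) R) g ≡ ∑ (upTo (suc R)) (λ r → ∑ (compositions k (R ∸ r)) (λ rs → g (r ∷ rs)))
∑-compositions k R g = trans (∑-concatMap (λ r → map (r ∷_) (compositions k (R ∸ r))) (upTo (suc R)) g)
  (∑-cong (upTo (suc R)) λ r _ → ∑-map (r ∷_) (compositions k (R ∸ r)) g)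

∑-fillings : ∀ k N (g : List Word → ℚ) →
  ∑ (fillings (suc k) N) g ≡ ∑ (upTo (suc N)) (λ i → ∑ (Sym i) (λ π → ∑ (fillings k (N ∸ i)) (λ πs → g (π ∷ πs))))
∑-fillings k N g = trans (∑-concatMap (λ i → concatMap (λ π → map (π ∷_) (fillings k (N ∸ i))) (Sym i)) (upTo (suc N)) g)
  (∑-cong (upTo (suc N)) λ i _ → trans (∑-concatMap (λ π → map (π ∷_) (fillings k (N ∸ i))) (Sym i) g)
    (∑-cong (Sym i) λ π _ → ∑-map (π ∷_) (fillings k (N ∸ i)) g))

⊗-∑ : ∀ F G n → (F ⊗ G) n ≡ ∑ (upTo (suc n)) (λ i → F i *ℚ G (n ∸ i))
⊗-∑ F G n = trans (cong sumℚ (sym (map-applyUpTo id (λ i → F i *ℚ G (n ∸ i)) (suc n)))) (sym (∑-sumℚ (upTo (suc n)) _))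

-- ½ (M_r(x) + (−1)^b M_r(−x)) keeps the coefficients of parity b.
halfFactor : ℕ → Bool → Series
halfFactor r b n = ½ *ℚ (M r n +ℚ sgnℚ (b2n b) *ℚ (sgnℚ n *ℚ M r n))

-- The factor with b different from the parity of i vanishes, and the other one is the full
-- coefficient; so the sum over b evaluates y at that parity.
∑-halfFactor : ∀ r i (y : Bool → ℚ) → ∑ (true ∷ false ∷ []) (λ b → halfFactor r b i *ℚ y b) ≡ M r i *ℚ y (odd i)
∑-halfFactor r i y rewrite ∑-∷ true (false ∷ []) (λ b → halfFactor r b i *ℚ y b) | ∑-∷ false [] (λ b → halfFactor r b i *ℚ y b)
                         | ∑-[] (λ b → halfFactor r b i *ℚ y b) | sgnℚ-odd i with odd i
... | true  = odd-case (M r i) (y true) (y false)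
  where
  open ℚ-Solver
  odd-case : ∀ c s t → (½ *ℚ (c +ℚ (-ℚ 1ℚ) *ℚ ((-ℚ 1ℚ) *ℚ c))) *ℚ s +ℚ ((½ *ℚ (c +ℚ 1ℚ *ℚ ((-ℚ 1ℚ) *ℚ c))) *ℚ t +ℚ 0ℚ) ≡ c *ℚ s
  odd-case = solve 3 (λ c s t → (con ½ :* (c :+ con (-ℚ 1ℚ) :* (con (-ℚ 1ℚ) :* c))) :* s :+ ((con ½ :* (c :+ con 1ℚ :* (con (-ℚ 1ℚ) :* c))) :* t :+ con 0ℚ) := c :* s) refl
... | false = even-case (M r i) (y true) (y false)
  where
  open ℚ-Solver
  even-case : ∀ c s t → (½ *ℚ (c +ℚ (-ℚ 1ℚ) *ℚ (1ℚ *ℚ c))) *ℚ s +ℚ ((½ *ℚ (c +ℚ 1ℚ *ℚ (1ℚ *ℚ c))) *ℚ t +ℚ 0ℚ) ≡ c *ℚ t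
  even-case = solve 3 (λ c s t → (con ½ :* (c :+ con (-ℚ 1ℚ) :* (con 1ℚ :* c))) :* s :+ ((con ½ :* (c :+ con 1ℚ :* (con 1ℚ :* c))) :* t :+ con 0ℚ) := c :* t) refl

M-∑ : ∀ r n → M r n ≡ ∑ (Sym n) (λ π → guard (n132 π ≡ᵇ r) (signℚ π))
M-∑ r n = trans (sym (∑-sumℚ (filterᵇ (λ π → n132 π ≡ᵇ r) (Sym n)) signℚ)) (∑-filterᵇ (λ π → n132 π ≡ᵇ r) (Sym n) signℚ)

module _ where
  open ℚ-Solver

  redistribute : ∀ u c w x y → ((u *ℚ c) *ℚ w) *ℚ (x *ℚ y) ≡ (u *ℚ x) *ℚ ((c *ℚ w) *ℚ y)
  redistribute = solve 5 (λ u c w x y → ((u :* c) :* w) :* (x :* y) := (u :* x) :* ((c :* w) :* y)) refl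

-- The function h is arbitrary, since the induction replaces it by its restriction to vectors with a
-- fixed first entry. Each cell factor absorbs one factor ½ of `halfPow`, and in the result v is
-- forced to be the vector of block parities.
expansion : ∀ k R N (h : List Bool → ℚ) →
  ∑ (compositions k R) (λ rs → ∑ (vectors k) (λ v → (halfPow k *ℚ h v) *ℚ prodTerm rs v N))
  ≡ ∑ (fillings k N) (λ πs → guard (total n132 πs ≡ᵇ R) (h (parities πs) *ℚ signs πs))
expansion zero zero N h = trans (∑-[x] [] _) (trans (∑-[x] [] _) (go N))
  where
  go : ∀ N → (1ℚ *ℚ h []) *ℚ oneS N ≡ ∑ (fillings zero N) (λ πs → guard (total n132 πs ≡ᵇ 0) (h (parities πs) *ℚ signs πs))
  go zero    = trans (cong (_*ℚ 1ℚ) (ℚₚ.*-identityˡ (h []))) (sym (∑-[x] [] _))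
  go (suc N) = trans (ℚₚ.*-zeroʳ (1ℚ *ℚ h [])) (sym (∑-[] _))
expansion zero (suc R) zero h = trans (∑-[] _) (sym (∑-[x] [] _))
expansion zero (suc R) (suc N) h = trans (∑-[] _) (sym (∑-[] _))
expansion (suc k) R N h = begin
  ∑ (compositions (suc k) R) (λ rs → ∑ (vectors (suc k)) (λ v → (halfPow (suc k) *ℚ h v) *ℚ prodTerm rs v N))
    ≡⟨ ∑-compositions k R _ ⟩
  ∑ UR (λ r → ∑ (compositions k (R ∸ r)) (λ rs → ∑ (vectors (suc k)) (λ v → (halfPow (suc k) *ℚ h v) *ℚ prodTerm (r ∷ rs) v N)))
    ≡⟨ ∑-cong UR (λ r _ → per-r r) ⟩
  ∑ UR (λ r → ∑ UN (λ i → M r i *ℚ E r i (odd i)))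
    ≡⟨ ∑-swap UR UN _ ⟩
  ∑ UN (λ i → ∑ UR (λ r → M r i *ℚ E r i (odd i)))
    ≡⟨ ∑-cong UN (λ i _ → per-i i) ⟩
  ∑ UN (λ i → ∑ (Sym i) (λ π → ∑ (fillings k (N ∸ i)) (λ πs → goal (π ∷ πs))))
    ≡⟨ sym (∑-fillings k N goal) ⟩
  ∑ (fillings (suc k) N) goal ∎
  where
  open ≡-Reasoning
  UR = upTo (suc R)
  UN = upTo (suc N)
  BB = true ∷ false ∷ []
  goal : List Word → ℚ
  goal πs = guard (total n132 πs ≡ᵇ R) (h (parities πs) *ℚ signs πs)
  term : ℕ → Bool → List ℕ → List Bool → ℚ
  term i b rs v = (halfPow k *ℚ h (b ∷ v)) *ℚ prodTerm rs v (N ∸ i)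
  E : ℕ → ℕ → Bool → ℚ
  E r i b = ∑ (fillings k (N ∸ i)) (λ πs → guard (total n132 πs ≡ᵇ R ∸ r) (h (b ∷ parities πs) *ℚ signs πs))

  per-term : ∀ r rs b v → (halfPow (suc k) *ℚ h (b ∷ v)) *ℚ prodTerm (r ∷ rs) (b ∷ v) N ≡ ∑ UN (λ i → halfFactor r b i *ℚ term i b rs v)
  per-term r rs b v = trans (cong (λ z → (halfPow (suc k) *ℚ h (b ∷ v)) *ℚ z)
      (⊗-∑ (M r ⊕ (sgnℚ (b2n b) ⊛ negX (M r))) (prodTerm rs v) N))
    (trans (∑-*ˡ (halfPow (suc k) *ℚ h (b ∷ v)) UN (λ i → factor i *ℚ prodTerm rs v (N ∸ i)))
      (∑-cong UN λ i _ → redistribute ½ (halfPow k) (h (b ∷ v)) (factor i) (prodTerm rs v (N ∸ i))))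
    where
    factor : ℕ → ℚ
    factor i = M r i +ℚ sgnℚ (b2n b) *ℚ (sgnℚ i *ℚ M r i)

  per-r : ∀ r → ∑ (compositions k (R ∸ r)) (λ rs → ∑ (vectors (suc k)) (λ v → (halfPow (suc k) *ℚ h v) *ℚ prodTerm (r ∷ rs) v N))
              ≡ ∑ UN (λ i → M r i *ℚ E r i (odd i))
  per-r r = begin
    ∑ C (λ rs → ∑ (vectors (suc k)) (λ v → (halfPow (suc k) *ℚ h v) *ℚ prodTerm (r ∷ rs) v N))
      ≡⟨ ∑-cong C (λ rs _ → trans (∑-vectors k _) (∑-cong BB λ b _ → ∑-cong (vectors k) λ v _ → per-term r rs b v)) ⟩
    ∑ C (λ rs → ∑ BB (λ b → ∑ (vectors k) (λ v → ∑ UN (λ i → halfFactor r b i *ℚ term i b rs v))))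
      ≡⟨ ∑-cong C (λ rs _ → trans (∑-cong BB λ b _ → ∑-swap (vectors k) UN _) (∑-swap BB UN _)) ⟩
    ∑ C (λ rs → ∑ UN (λ i → ∑ BB (λ b → ∑ (vectors k) (λ v → halfFactor r b i *ℚ term i b rs v))))
      ≡⟨ trans (∑-swap C UN _) (∑-cong UN λ i _ → ∑-swap C BB _) ⟩
    ∑ UN (λ i → ∑ BB (λ b → ∑ C (λ rs → ∑ (vectors k) (λ v → halfFactor r b i *ℚ term i b rs v))))
      ≡⟨ ∑-cong UN (λ i _ → ∑-cong BB λ b _ → trans (∑-cong C λ rs _ → sym (∑-*ˡ (halfFactor r b i) (vectors k) _)) (sym (∑-*ˡ (halfFactor r b i) C _))) ⟩
    ∑ UN (λ i → ∑ BB (λ b → halfFactor r b i *ℚ ∑ C (λ rs → ∑ (vectors k) (λ v → term i b rs v))))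
      ≡⟨ ∑-cong UN (λ i _ → ∑-cong BB λ b _ → cong (halfFactor r b i *ℚ_) (expansion k (R ∸ r) (N ∸ i) (λ v → h (b ∷ v)))) ⟩
    ∑ UN (λ i → ∑ BB (λ b → halfFactor r b i *ℚ E r i b))
      ≡⟨ ∑-cong UN (λ i _ → ∑-halfFactor r i (E r i)) ⟩
    ∑ UN (λ i → M r i *ℚ E r i (odd i)) ∎
    where
    C = compositions k (R ∸ r)

  per-i : ∀ i → ∑ UR (λ r → M r i *ℚ E r i (odd i)) ≡ ∑ (Sym i) (λ π → ∑ (fillings k (N ∸ i)) (λ πs → goal (π ∷ πs)))
  per-i i = begin
    ∑ UR (λ r → M r i *ℚ E r i (odd i))
      ≡⟨ ∑-cong UR (λ r _ → trans (cong (_*ℚ E r i (odd i)) (M-∑ r i)) (∑-*-∑ (Sym i) Fi _ _)) ⟩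
    ∑ UR (λ r → ∑ (Sym i) (λ π → ∑ Fi (λ πs → guard (n132 π ≡ᵇ r) (signℚ π) *ℚ guard (total n132 πs ≡ᵇ R ∸ r) (Z πs))))
      ≡⟨ trans (∑-swap UR (Sym i) _) (∑-cong (Sym i) λ π _ → ∑-swap UR Fi _) ⟩
    ∑ (Sym i) (λ π → ∑ Fi (λ πs → ∑ UR (λ r → guard (n132 π ≡ᵇ r) (signℚ π) *ℚ guard (total n132 πs ≡ᵇ R ∸ r) (Z πs))))
      ≡⟨ ∑-cong (Sym i) (λ π π∈ → ∑-cong Fi λ πs _ → trans (∑-convolution (n132 π) (total n132 πs) R (signℚ π) (Z πs))
           (cong (guard (n132 π + total n132 πs ≡ᵇ R)) (reorder π πs π∈))) ⟩
    ∑ (Sym i) (λ π → ∑ Fi (λ πs → goal (π ∷ πs))) ∎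
    where
    Fi = fillings k (N ∸ i)
    Z : List Word → ℚ
    Z πs = h (odd i ∷ parities πs) *ℚ signs πs
    reorder : ∀ π πs → π ∈ Sym i → signℚ π *ℚ Z πs ≡ h (odd (length π) ∷ parities πs) *ℚ (signℚ π *ℚ signs πs)
    reorder π πs π∈ =
      trans (sym (ℚₚ.*-assoc (signℚ π) H (signs πs))) (trans (cong (_*ℚ signs πs) (ℚₚ.*-comm (signℚ π) H))
        (trans (ℚₚ.*-assoc H (signℚ π) (signs πs))
          (cong (λ z → h (odd z ∷ parities πs) *ℚ (signℚ π *ℚ signs πs)) (sym (proj₁ (∈-Sym⁻ i π π∈))))))
      where
      H = h (odd i ∷ parities πs)

-- Signs and parities

sgnℚ-suc : ∀ n → sgnℚ (suc n) ≡ (-ℚ 1ℚ) *ℚ sgnℚ n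
sgnℚ-suc zero          = refl
sgnℚ-suc (suc zero)    = refl
sgnℚ-suc (suc (suc n)) = sgnℚ-suc n

sgnℚ-+ : ∀ m n → sgnℚ (m + n) ≡ sgnℚ m *ℚ sgnℚ n
sgnℚ-+ zero    n = sym (ℚₚ.*-identityˡ (sgnℚ n))
sgnℚ-+ (suc m) n = trans (sgnℚ-suc (m + n)) (trans (cong ((-ℚ 1ℚ) *ℚ_) (sgnℚ-+ m n))
  (trans (sym (ℚₚ.*-assoc (-ℚ 1ℚ) (sgnℚ m) (sgnℚ n))) (cong (_*ℚ sgnℚ n) (sym (sgnℚ-suc m)))))

odd-suc : ∀ n → odd (suc n) ≡ not (odd n)
odd-suc zero          = refl
odd-suc (suc zero)    = refl
odd-suc (suc (suc n)) = odd-suc n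

infix 4 _≈₂_
_≈₂_ : ℕ → ℕ → Set
m ≈₂ n = odd m ≡ odd n

≈₂-+ʳ : ∀ k {m n} → m ≈₂ n → k + m ≈₂ k + n
≈₂-+ʳ zero    e = e
≈₂-+ʳ (suc k) {m} {n} e = trans (odd-suc (k + m)) (trans (cong not (≈₂-+ʳ k e)) (sym (odd-suc (k + n))))

≈₂-+ : ∀ {m m′ n n′} → m ≈₂ m′ → n ≈₂ n′ → m + n ≈₂ m′ + n′
≈₂-+ {m} {m′} {n} {n′} e e′ = trans (≈₂-+ʳ m e′)
  (trans (cong odd (+-comm m n′)) (trans (≈₂-+ʳ n′ e) (cong odd (+-comm n′ m′))))

≈₂-*ʳ : ∀ k {m n} → m ≈₂ n → k * m ≈₂ k * n
≈₂-*ʳ zero    e = refl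
≈₂-*ʳ (suc k) {m} {n} e = ≈₂-+ {m} {n} {k * m} {k * n} e (≈₂-*ʳ k e)

≈₂-* : ∀ {m m′ n n′} → m ≈₂ m′ → n ≈₂ n′ → m * n ≈₂ m′ * n′
≈₂-* {m} {m′} {n} {n′} e e′ = trans (≈₂-*ʳ m e′)
  (trans (cong odd (*-comm m n′)) (trans (≈₂-*ʳ n′ e) (cong odd (*-comm n′ m′))))

sgnℚ-≈₂ : ∀ m n → m ≈₂ n → sgnℚ m ≡ sgnℚ n
sgnℚ-≈₂ m n e = trans (sgnℚ-odd m) (trans (cong (λ b → if b then -ℚ 1ℚ else 1ℚ) e) (sym (sgnℚ-odd n)))

b2n-odd : ∀ n → b2n (odd n) ≈₂ n
b2n-odd n with odd n
... | true  = refl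
... | false = refl

ones-parities : ∀ πs → ones (parities πs) ≈₂ total length πs
ones-parities []       = refl
ones-parities (π ∷ πs) = trans (cong odd (ones-∷ (odd (length π)) (parities πs)))
  (≈₂-+ {b2n (odd (length π))} {length π} (b2n-odd (length π)) (ones-parities πs))
  where
  ones-∷ : ∀ b vs → ones (b ∷ vs) ≡ b2n b + ones vs
  ones-∷ true  vs = refl
  ones-∷ false vs = refl

cellSum : Word → List (ℕ × ℕ) → List Bool → ℕ
cellSum ρ cs v = foldr _+_ 0 (zipWith (λ c b → lcell ρ c * b2n b) cs v)

-- Each block size is congruent to its entry of v modulo 2, so the products of sizes become the
-- products of entries of v and the terms with `lcell` become those of the exponent in `zρ`.
exponent-parity : ∀ ρ cs πs → length πs ≡ length cs →
                  pairSum (parities πs) + cellSum ρ cs (parities πs) ≈₂ crossings ρ cs πs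
exponent-parity ρ []       []       _ = refl
exponent-parity ρ (c ∷ cs) (π ∷ πs) e = trans (cong odd (regroup (b2n b) o P (lcell ρ c) Z))
  (≈₂-+ {b2n b * (lcell ρ c + o)} {length π * (lcell ρ c + total length πs)}
    (≈₂-* {b2n b} {length π} (b2n-odd (length π)) (≈₂-+ʳ (lcell ρ c) (ones-parities πs)))
    (exponent-parity ρ cs πs (suc-injective e)))
  where
  b = odd (length π)
  o = ones (parities πs)
  P = pairSum (parities πs)
  Z = cellSum ρ cs (parities πs)
  open ℕ-Solver
  regroup : ∀ b o P l Z → (b * o + P) + (l * b + Z) ≡ b * (l + o) + (P + Z)
  regroup = solve 5 (λ b o P l Z → (b :* o :+ P) :+ (l :* b :+ Z) := b :* (l :+ o) :+ (P :+ Z)) refl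

sgnℚ-total-inv : ∀ πs → sgnℚ (total inv πs) ≡ signs πs
sgnℚ-total-inv []       = refl
sgnℚ-total-inv (π ∷ πs) = trans (sgnℚ-+ (inv π) (total inv πs)) (cong (signℚ π *ℚ_) (sgnℚ-total-inv πs))

eqᵇ : Bool → Bool → Bool
eqᵇ true  b = b
eqᵇ false b = not b

eqᵇ-true : ∀ {b c} → b ≡ c → eqᵇ b c ≡ true
eqᵇ-true {true}  refl = refl
eqᵇ-true {false} refl = refl

eqᵇ-true⁻ : ∀ {b c} → eqᵇ b c ≡ true → b ≡ c
eqᵇ-true⁻ {true}          e = sym e
eqᵇ-true⁻ {false} {false} e = refl

filterᵇ-dichotomy : {A : Set} (p : A → Bool) {xs : List A} {x : A} → x ∈ xs → x ∈ filterᵇ p xs ⊎ p x ≡ false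
filterᵇ-dichotomy p {xs} {x} x∈ with p x in eq
... | true  = inj₁ (∈-filterᵇ p x∈ eq)
... | false = inj₂ refl

-- The equality test of X is local to its definition, so X is only accessible through membership.
∈-X⁻ : ∀ ρ a v → v ∈ X ρ a → odd (ones v + size ρ) ≡ odd a
∈-X⁻ ρ a v v∈ with proj₂ (∈-filterᵇ⁻ _ {vectors (f ρ)} v∈)
... | e with odd (ones v + size ρ) | odd a | e
...   | true  | true  | _ = refl
...   | false | false | _ = refl

∈-X : ∀ ρ a v → v ∈ vectors (f ρ) → odd (ones v + size ρ) ≡ odd a → v ∈ X ρ a
∈-X ρ a v v∈ eq with filterᵇ-dichotomy _ {vectors (f ρ)} v∈
... | inj₁ h = h
... | inj₂ e with odd (ones v + size ρ) | odd a | eq | e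
...   | true  | .true  | refl | ()
...   | false | .false | refl | ()

-- Exchanges a predicate p that cannot be named for one that can, by comparing the members of the
-- filtered list.
∑-filterᵇ-∈ : {A : Set} (p q : A → Bool) (xs : List A) (g : A → ℚ) →
  (∀ x → x ∈ filterᵇ p xs → q x ≡ true) → (∀ x → x ∈ xs → q x ≡ true → x ∈ filterᵇ p xs) →
  ∑ (filterᵇ p xs) g ≡ ∑ xs (λ x → guard (q x) (g x))
∑-filterᵇ-∈ p q xs g to from = trans (∑-filterᵇ p xs g) (∑-cong xs λ x x∈ → cong (λ b → guard b (g x))
  (bool-ext (λ e → to x (∈-filterᵇ p x∈ e)) (λ e → proj₂ (∈-filterᵇ⁻ p {xs} (from x x∈ e)))))

∑-X : ∀ ρ a (g : List Bool → ℚ) → ∑ (X ρ a) g ≡ ∑ (vectors (f ρ)) (λ v → guard (eqᵇ (odd (ones v + size ρ)) (odd a)) (g v))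
∑-X ρ a g = ∑-filterᵇ-∈ _ (λ v → eqᵇ (odd (ones v + size ρ)) (odd a)) (vectors (f ρ)) g
  (λ v v∈ → eqᵇ-true (∈-X⁻ ρ a v v∈)) (λ v v∈ e → ∈-X ρ a v v∈ (eqᵇ-true⁻ e))

-- Permutations as fillings of the feasible cells of their kernel shapes

Φ : Word × List Word → Word
Φ (ρ , πs) = proj₁ (combine ρ (cells ρ) πs)

module Fill (n : ℕ) (ρ : Word) (KP : KernelPerm (length ρ) ρ) (s≤n : length ρ ≤ n) where
  open KernelPerm KP
  module As = Assembly (length ρ) ρ inSym nonempty connected

  module _ (πs : List Word) (πs∈ : πs ∈ fillings (f ρ) (n ∸ length ρ)) where
    private
      arity : length πs ≡ length (cells ρ)
      arity = proj₁ (∈-fillings⁻ (f ρ) (n ∸ length ρ) πs πs∈)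
      A : As.Assembled (cells ρ) πs
      A = As.assembled (cells ρ) πs As.cells-chain arity (proj₁ (proj₂ (∈-fillings⁻ (f ρ) (n ∸ length ρ) πs πs∈)))
      total≡ : total length πs ≡ n ∸ length ρ
      total≡ = proj₂ (proj₂ (∈-fillings⁻ (f ρ) (n ∸ length ρ) πs πs∈))
      size≡n : sizeWith (length ρ) πs ≡ n
      size≡n = trans (sizeWith-total (length ρ) πs) (trans (cong (length ρ +_) total≡) (m+[n∸m]≡n s≤n))
      len : length (Φ (ρ , πs)) ≡ sizeWith (length ρ) πs
      len = proj₁ (∈-Sym⁻ _ _ (As.Assembled.inSym A))

    Φ-Sym : Φ (ρ , πs) ∈ Sym n
    Φ-Sym = subst (λ z → Φ (ρ , πs) ∈ Sym z) size≡n (As.Assembled.inSym A)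

    Φ-kernel : Kernel n (length ρ) (Φ (ρ , πs) at_) (ρ at_) (proj₂ (combine ρ (cells ρ) πs))
    Φ-kernel = subst (λ z → Kernel z (length ρ) (Φ (ρ , πs) at_) (ρ at_) (proj₂ (combine ρ (cells ρ) πs))) size≡n
      (Filled.isKernel (As.Assembled.isFilled A))

    Φ-n132 : n132 (Φ (ρ , πs)) ≡ n132 ρ + total n132 πs
    Φ-n132 = trans (n132-N3 (Φ (ρ , πs))) (trans (cong (λ z → N3 z (Φ (ρ , πs) at_)) len)
      (trans (As.Assembled.occurrences A) (cong (_+ total n132 πs) (sym (n132-N3 ρ)))))

    Φ-inv : inv (Φ (ρ , πs)) ≡ inv ρ + total inv πs + crossings ρ (cells ρ) πs
    Φ-inv = trans (inv-N2 (Φ (ρ , πs))) (trans (cong (λ z → N2 z (Φ (ρ , πs) at_)) len)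
      (trans (As.Assembled.inversions A) (cong (λ z → z + total inv πs + crossings ρ (cells ρ) πs) (sym (inv-N2 ρ)))))

    Φ-sign : zρ ρ (parities πs) *ℚ signs πs ≡ signℚ (Φ (ρ , πs))
    Φ-sign = begin
      (sgnℚ E *ℚ signℚ ρ) *ℚ signs πs
        ≡⟨ cong₂ (λ x y → (x *ℚ signℚ ρ) *ℚ y) (sgnℚ-≈₂ E C (exponent-parity ρ (cells ρ) πs arity)) (sym (sgnℚ-total-inv πs)) ⟩
      (sgnℚ C *ℚ signℚ ρ) *ℚ sgnℚ (total inv πs)
        ≡⟨ trans (ℚₚ.*-assoc (sgnℚ C) _ _) (ℚₚ.*-comm (sgnℚ C) _) ⟩
      (signℚ ρ *ℚ sgnℚ (total inv πs)) *ℚ sgnℚ C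
        ≡⟨ cong (_*ℚ sgnℚ C) (sym (sgnℚ-+ (inv ρ) (total inv πs))) ⟩
      sgnℚ (inv ρ + total inv πs) *ℚ sgnℚ C
        ≡⟨ sym (sgnℚ-+ (inv ρ + total inv πs) C) ⟩
      sgnℚ (inv ρ + total inv πs + C) ≡⟨ cong sgnℚ (sym Φ-inv) ⟩
      signℚ (Φ (ρ , πs)) ∎
      where
      open ≡-Reasoning
      E = pairSum (parities πs) + cellSum ρ (cells ρ) (parities πs)
      C = crossings ρ (cells ρ) πs

    Φ-parity : ones (parities πs) + size ρ ≈₂ n
    Φ-parity = trans (≈₂-+ {ones (parities πs)} {total length πs} {size ρ} {size ρ} (ones-parities πs) refl)
      (cong odd (trans (cong (_+ size ρ) total≡) (m∸n+n≡m s≤n)))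

module _ (n : ℕ) (1≤n : 1 ≤ n) where

  -- The word determines its kernel shape and its kernel positions by uniqueness of the kernel; with
  -- these fixed, the blocks are determined by `combine-injective`.
  Φ-injective : ∀ ρ ρ′ (KP : KernelPerm (length ρ) ρ) (KP′ : KernelPerm (length ρ′) ρ′) (s≤n : length ρ ≤ n) (s′≤n : length ρ′ ≤ n)
    πs πs′ → πs ∈ fillings (f ρ) (n ∸ length ρ) → πs′ ∈ fillings (f ρ′) (n ∸ length ρ′) →
    Φ (ρ , πs) ≡ Φ (ρ′ , πs′) → (ρ , πs) ≡ (ρ′ , πs′)
  Φ-injective ρ ρ′ KP KP′ s≤n s′≤n πs πs′ πs∈ πs′∈ eq = same-shape ρ≡ρ′
    where
    u = Φ (ρ , πs)
    module F = Fill n ρ KP s≤n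
    module F′ = Fill n ρ′ KP′ s′≤n
    u∈ = F.Φ-Sym πs πs∈
    K₁ = F.Φ-kernel πs πs∈
    K₂ : Kernel n (length ρ′) (u at_) (ρ′ at_) (proj₂ (combine ρ′ (cells ρ′) πs′))
    K₂ = subst (λ z → Kernel n (length ρ′) (z at_) (ρ′ at_) (proj₂ (combine ρ′ (cells ρ′) πs′))) (sym eq) (F′.Φ-kernel πs′ πs′∈)
    ρ≡ρ′ : ρ ≡ ρ′
    ρ≡ρ′ = trans (sym (kernelShape-unique n u u∈ 1≤n (KernelPerm.inSym KP) K₁)) (kernelShape-unique n u u∈ 1≤n (KernelPerm.inSym KP′) K₂)
    κ≡ : length ρ ≡ length ρ′ → ∀ k → k ≤ length ρ → proj₂ (combine ρ (cells ρ) πs) k ≡ proj₂ (combine ρ′ (cells ρ′) πs′) k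
    κ≡ l k le with zero-or-Rng k le
    ... | inj₁ refl = trans (Kernel.κ-0 K₁) (sym (Kernel.κ-0 K₂))
    ... | inj₂ r    = trans (sym (kernelList-at n u u∈ 1≤n (KernelPerm.inSym KP) K₁ k r))
                            (kernelList-at n u u∈ 1≤n (KernelPerm.inSym KP′) K₂ k (subst (λ z → Rng z k) l r))
    same-shape : ρ ≡ ρ′ → (ρ , πs) ≡ (ρ′ , πs′)
    same-shape refl = cong (ρ ,_) (F.As.combine-injective (cells ρ) πs πs′ F.As.cells-chain
      (proj₁ φ) (proj₁ φ′) (proj₁ (proj₂ φ)) (proj₁ (proj₂ φ′)) eq (κ≡ refl))
      where
      φ = ∈-fillings⁻ (f ρ) (n ∸ length ρ) πs πs∈
      φ′ = ∈-fillings⁻ (f ρ) (n ∸ length ρ) πs′ πs′∈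

  Φ-surjective : ∀ u → u ∈ Sym n → ∃ λ ρ → ∃ λ πs →
    KernelPerm (length ρ) ρ × length ρ ≤ n × πs ∈ fillings (f ρ) (n ∸ length ρ) × Φ (ρ , πs) ≡ u
  Φ-surjective u u∈ = ρ , D.blocks , subst (λ z → KernelPerm z ρ) (sym len) KP , subst (_≤ n) (sym len) s≤n
    , ∈-fillings (f ρ) (n ∸ length ρ) D.blocks D.arity D.perms total≡ , D.word-eq
    where
    ρ = kernelShape u
    s = length (kernelList u)
    KP : KernelPerm s ρ
    KP = kernelShape-KernelPerm n u u∈ 1≤n
    open KernelPerm KP
    len : length ρ ≡ s
    len = proj₁ (∈-Sym⁻ s ρ inSym)
    module As = Assembly s ρ inSym nonempty connected
    module D = As.Decomposition (As.decompose (cells ρ) As.cells-chain n u (kernelList u at_) u∈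
                 (As.fill-cells n u (kernelList u at_) u∈ (kernel n u u∈ 1≤n)))
    s+total : s + total length D.blocks ≡ n
    s+total = trans (sym (sizeWith-total s D.blocks)) D.sizes
    s≤n : s ≤ n
    s≤n = subst (s ≤_) s+total (m≤m+n s _)
    total≡ : total length D.blocks ≡ n ∸ length ρ
    total≡ = trans (sym (m+n∸m≡n s _)) (cong₂ _∸_ s+total (sym len))

  module _ (r : ℕ) where

    relevant : Word → Bool
    relevant ρ = (size ρ ≤ᵇ n) ∧ (capacity ρ ≤ᵇ r)

    blocksFor : Word → List (List Word)
    blocksFor ρ = filterᵇ (λ πs → total n132 πs ≡ᵇ r ∸ capacity ρ) (fillings (f ρ) (n ∸ size ρ))

    pairs : List (Word × List Word)
    pairs = concatMap (λ ρ → map (ρ ,_) (blocksFor ρ)) (filterᵇ relevant (K (2 * r + 1)))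

    record IsPair (ρ : Word) (πs : List Word) : Set₁ where
      field
        isKernelPerm : KernelPerm (length ρ) ρ
        size≤n : length ρ ≤ n
        capacity≤r : capacity ρ ≤ r
        isFilling : πs ∈ fillings (f ρ) (n ∸ length ρ)
        total-n132 : total n132 πs ≡ r ∸ capacity ρ

    private
      1≤t : 1 ≤ 2 * r + 1
      1≤t = m≤n+m 1 (2 * r)

    ∈-pairs⁻ : ∀ ρ πs → (ρ , πs) ∈ pairs → IsPair ρ πs
    ∈-pairs⁻ ρ πs p∈ with ∈-concatMap-elim (λ ρ → map (ρ ,_) (blocksFor ρ)) {filterᵇ relevant (K (2 * r + 1))} p∈
    ... | ρ , ρ∈ , p∈′ with ∈-map⁻ (ρ ,_) p∈′
    ...   | πs , πs∈ , refl = record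
      { isKernelPerm = ∈-K⁻ (2 * r + 1) ρ 1≤t (proj₁ fρ)
      ; size≤n = ≤ᵇ-true⁻ {size ρ} (proj₁ (∧-true {size ρ ≤ᵇ n} (proj₂ fρ)))
      ; capacity≤r = ≤ᵇ-true⁻ {capacity ρ} (proj₂ (∧-true {size ρ ≤ᵇ n} (proj₂ fρ)))
      ; isFilling = proj₁ fπ
      ; total-n132 = ≡ᵇ-true⁻ {total n132 πs} (proj₂ fπ)
      }
      where
      fρ = ∈-filterᵇ⁻ relevant {K (2 * r + 1)} ρ∈
      fπ = ∈-filterᵇ⁻ (λ πs → total n132 πs ≡ᵇ r ∸ capacity ρ) {fillings (f ρ) (n ∸ size ρ)} πs∈

    ∈-pairs : ∀ ρ πs → IsPair ρ πs → (ρ , πs) ∈ pairs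
    ∈-pairs ρ πs P = ∈-concatMap-intro (λ ρ → map (ρ ,_) (blocksFor ρ))
      (∈-filterᵇ relevant (∈-K r (length ρ) ρ isKernelPerm capacity≤r) (∧-intro (≤ᵇ-true size≤n) (≤ᵇ-true capacity≤r)))
      (∈-map⁺ (ρ ,_) (∈-filterᵇ (λ πs → total n132 πs ≡ᵇ r ∸ capacity ρ) isFilling (≡ᵇ-true total-n132)))
      where open IsPair P

    pairs-unique : AllPairs _≢_ pairs
    pairs-unique = concatMap-unique (λ ρ → map (ρ ,_) (blocksFor ρ)) (filterᵇ relevant (K (2 * r + 1))) proj₁
      (filterᵇ-AllPairs relevant (K-unique (2 * r + 1)))
      (λ ρ _ → map-unique (ρ ,_) (λ { refl → refl }) (filterᵇ-AllPairs _ (fillings-unique (f ρ) (n ∸ size ρ))))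
      (λ ρ p p∈ → case ∈-map⁻ (ρ ,_) p∈ of λ { (_ , _ , refl) → refl })

    map-unique-on : {A B : Set} (g : A → B) {xs : List A} → (∀ x y → x ∈ xs → y ∈ xs → g x ≡ g y → x ≡ y) →
                    AllPairs _≢_ xs → AllPairs _≢_ (map g xs)
    map-unique-on g inj []       = []
    map-unique-on g {x ∷ xs} inj (u ∷ us) =
      All.tabulate (λ y∈ e → let (z , z∈ , e′) = ∈-map⁻ g y∈ in
        All.lookup u z∈ (inj x z (here refl) (there z∈) (trans e e′)))
      ∷ map-unique-on g (λ y z y∈ z∈ → inj y z (there y∈) (there z∈)) us

    perms : List Word
    perms = filterᵇ (λ π → n132 π ≡ᵇ r) (Sym n)

    -- Both lists are free of repetitions and have the same members, so a signed sum over one is a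
    -- signed sum over the other.
    correspondence : map Φ pairs ↭ perms
    correspondence = ∼bag⇒↭ (unique∧set⇒bag
      (map-unique-on Φ (λ { (ρ , πs) (ρ′ , πs′) p∈ p∈′ e → inj (∈-pairs⁻ ρ πs p∈) (∈-pairs⁻ ρ′ πs′ p∈′) e }) pairs-unique)
      (filterᵇ-AllPairs _ (Sym-unique n)) (λ {u} → mk⇔ to from))
      where
      inj : ∀ {ρ ρ′ πs πs′} → IsPair ρ πs → IsPair ρ′ πs′ → Φ (ρ , πs) ≡ Φ (ρ′ , πs′) → (ρ , πs) ≡ (ρ′ , πs′)
      inj P P′ e = Φ-injective _ _ (isKernelPerm P) (isKernelPerm P′) (size≤n P) (size≤n P′) _ _ (isFilling P) (isFilling P′) e
        where open IsPair
      to : ∀ {u} → u ∈ map Φ pairs → u ∈ perms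
      to u∈ with ∈-map⁻ Φ u∈
      ... | (ρ , πs) , p∈ , refl = ∈-filterᵇ (λ π → n132 π ≡ᵇ r) (F.Φ-Sym πs isFilling)
              (≡ᵇ-true (trans (F.Φ-n132 πs isFilling) (trans (cong (n132 ρ +_) total-n132) (m+[n∸m]≡n capacity≤r))))
        where
        open IsPair (∈-pairs⁻ ρ πs p∈)
        module F = Fill n ρ isKernelPerm size≤n
      from : ∀ {u} → u ∈ perms → u ∈ map Φ pairs
      from {u} u∈ =
        let (u∈′ , e) = ∈-filterᵇ⁻ (λ π → n132 π ≡ᵇ r) {Sym n} u∈
            (ρ , πs , KP , s≤n , πs∈ , Φ≡u) = Φ-surjective u u∈′
            count = trans (sym (Fill.Φ-n132 n ρ KP s≤n πs πs∈)) (trans (cong n132 Φ≡u) (≡ᵇ-true⁻ {n132 u} e))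
        in subst (_∈ map Φ pairs) Φ≡u (∈-map⁺ Φ (∈-pairs ρ πs (record
             { isKernelPerm = KP ; size≤n = s≤n ; isFilling = πs∈
             ; capacity≤r = subst (n132 ρ ≤_) count (m≤m+n (n132 ρ) _)
             ; total-n132 = trans (sym (m+n∸m≡n (n132 ρ) _)) (cong (_∸ n132 ρ) count) })))

    ∑-pairs : ∑ pairs (λ p → signℚ (Φ p)) ≡ M r n
    ∑-pairs = trans (sym (∑-map Φ pairs signℚ)) (trans (∑-↭ signℚ correspondence) (∑-sumℚ perms signℚ))

-- Both sides as signed counts

∑-if : {A : Set} (b : Bool) (xs : List A) (g : A → ℚ) → ∑ (if b then xs else []) g ≡ guard b (∑ xs g)
∑-if true  xs g = refl
∑-if false xs g = ∑-[] g

inner : ℕ → ℕ → Word → Series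
inner a r ρ = sumS (concatMap (λ rs → map (λ v → (halfPow (f ρ) *ℚ zρ ρ v) ⊛ prodTerm rs v) (X ρ a)) (compsFor ρ r))

inner-∑ : ∀ a r ρ N → inner a r ρ N ≡ guard (capacity ρ ≤ᵇ r) (∑ (fillings (f ρ) N) (λ πs → guard (total n132 πs ≡ᵇ r ∸ capacity ρ)
  (guard (eqᵇ (odd (ones (parities πs) + size ρ)) (odd a)) (zρ ρ (parities πs)) *ℚ signs πs)))
inner-∑ a r ρ N = begin
  inner a r ρ N
    ≡⟨ sym (∑-sumℚ (concatMap (λ rs → map (summand rs) (X ρ a)) (compsFor ρ r)) (λ F → F N)) ⟩
  ∑ (concatMap (λ rs → map (summand rs) (X ρ a)) (compsFor ρ r)) (λ F → F N)
    ≡⟨ trans (∑-concatMap (λ rs → map (summand rs) (X ρ a)) (compsFor ρ r) (λ F → F N))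
             (∑-cong (compsFor ρ r) λ rs _ → ∑-map (summand rs) (X ρ a) (λ F → F N)) ⟩
  ∑ (compsFor ρ r) (λ rs → ∑ (X ρ a) (λ v → summand rs v N))
    ≡⟨ ∑-if (capacity ρ ≤ᵇ r) (compositions (f ρ) (r ∸ capacity ρ)) _ ⟩
  guard (capacity ρ ≤ᵇ r) (∑ C (λ rs → ∑ (X ρ a) (λ v → summand rs v N)))
    ≡⟨ cong (guard (capacity ρ ≤ᵇ r)) (∑-cong C λ rs _ → trans (∑-X ρ a (λ v → summand rs v N)) (∑-cong (vectors (f ρ)) λ v _ → push rs v)) ⟩
  guard (capacity ρ ≤ᵇ r) (∑ C (λ rs → ∑ (vectors (f ρ)) (λ v → (halfPow (f ρ) *ℚ h v) *ℚ prodTerm rs v N)))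
    ≡⟨ cong (guard (capacity ρ ≤ᵇ r)) (expansion (f ρ) (r ∸ capacity ρ) N h) ⟩
  guard (capacity ρ ≤ᵇ r) (∑ (fillings (f ρ) N) (λ πs → guard (total n132 πs ≡ᵇ r ∸ capacity ρ) (h (parities πs) *ℚ signs πs))) ∎
  where
  open ≡-Reasoning
  C = compositions (f ρ) (r ∸ capacity ρ)
  summand : List ℕ → List Bool → Series
  summand rs v = (halfPow (f ρ) *ℚ zρ ρ v) ⊛ prodTerm rs v
  ok : List Bool → Bool
  ok v = eqᵇ (odd (ones v + size ρ)) (odd a)
  h : List Bool → ℚ
  h v = guard (ok v) (zρ ρ v)
  push : ∀ rs v → guard (ok v) (summand rs v N) ≡ (halfPow (f ρ) *ℚ h v) *ℚ prodTerm rs v N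
  push rs v = sym (trans (cong (_*ℚ prodTerm rs v N) (guard-*ˡ (ok v) (halfPow (f ρ)) (zρ ρ v)))
    (guard-*ʳ (ok v) (prodTerm rs v N) (halfPow (f ρ) *ℚ zρ ρ v)))

RHS-∑ : ∀ a r n → RHS a r n ≡ ∑ (K (2 * r + 1)) (λ ρ → guard (size ρ ≤ᵇ n) (inner a r ρ (n ∸ size ρ)))
RHS-∑ a r n = trans (sym (∑-sumℚ (map G (K (2 * r + 1))) (λ F → F n))) (∑-map G (K (2 * r + 1)) (λ F → F n))
  where
  G : Word → Series
  G ρ = xpow (size ρ) (inner a r ρ)

guard-swap : ∀ b c x → guard b (guard c x) ≡ guard c (guard b x)
guard-swap true  c     x = refl
guard-swap false true  x = refl
guard-swap false false x = refl

guard-cong : ∀ b {x y} → (b ≡ true → x ≡ y) → guard b x ≡ guard b y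
guard-cong true  e = e refl
guard-cong false e = refl

-- The condition defining `X` says that the block sizes and the size of ρ add up to the parity of a.
-- As they add up to n, it is the same condition for all shapes and fillings and leaves the sum as
-- one guard.
RHS-M : ∀ a r n → 1 ≤ n → RHS a r n ≡ guard (eqᵇ (odd n) (odd a)) (M r n)
RHS-M a r n 1≤n = begin
  RHS a r n
    ≡⟨ RHS-∑ a r n ⟩
  ∑ (K t) (λ ρ → guard (size ρ ≤ᵇ n) (inner a r ρ (n ∸ size ρ)))
    ≡⟨ ∑-cong (K t) per-ρ ⟩
  ∑ (K t) (λ ρ → guard par (guard (relevant n 1≤n r ρ) (∑ (blocksFor n 1≤n r ρ) (λ πs → signℚ (Φ (ρ , πs))))))
    ≡⟨ sym (guard-∑ par (K t) _) ⟩
  guard par (∑ (K t) (λ ρ → guard (relevant n 1≤n r ρ) (∑ (blocksFor n 1≤n r ρ) (λ πs → signℚ (Φ (ρ , πs))))))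
    ≡⟨ cong (guard par) (trans (sym (∑-filterᵇ (relevant n 1≤n r) (K t) _)) (∑-cong (filterᵇ (relevant n 1≤n r) (K t)) λ ρ _ → sym (∑-map (ρ ,_) (blocksFor n 1≤n r ρ) (λ p → signℚ (Φ p))))) ⟩
  guard par (∑ (filterᵇ (relevant n 1≤n r) (K t)) (λ ρ → ∑ (map (ρ ,_) (blocksFor n 1≤n r ρ)) (λ p → signℚ (Φ p))))
    ≡⟨ cong (guard par) (trans (sym (∑-concatMap (λ ρ → map (ρ ,_) (blocksFor n 1≤n r ρ)) (filterᵇ (relevant n 1≤n r) (K t)) (λ p → signℚ (Φ p)))) (∑-pairs n 1≤n r)) ⟩
  guard par (M r n) ∎
  where
  open ≡-Reasoning
  t = 2 * r + 1
  par = eqᵇ (odd n) (odd a)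
  per-ρ : ∀ ρ → ρ ∈ K t → guard (size ρ ≤ᵇ n) (inner a r ρ (n ∸ size ρ))
        ≡ guard par (guard (relevant n 1≤n r ρ) (∑ (blocksFor n 1≤n r ρ) (λ πs → signℚ (Φ (ρ , πs)))))
  per-ρ ρ ρ∈ = begin
    guard (size ρ ≤ᵇ n) (inner a r ρ (n ∸ size ρ))
      ≡⟨ cong (guard (size ρ ≤ᵇ n)) (inner-∑ a r ρ (n ∸ size ρ)) ⟩
    guard (size ρ ≤ᵇ n) (guard (capacity ρ ≤ᵇ r) (∑ Fs (λ πs → guard (occ πs) (guard (eqᵇ (odd (ones (parities πs) + size ρ)) (odd a)) (zρ ρ (parities πs)) *ℚ signs πs))))
      ≡⟨ guard-cong (size ρ ≤ᵇ n) (λ le → cong (guard (capacity ρ ≤ᵇ r)) (∑-cong Fs (per-πs (≤ᵇ-true⁻ {size ρ} le)))) ⟩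
    guard (size ρ ≤ᵇ n) (guard (capacity ρ ≤ᵇ r) (∑ Fs (λ πs → guard par (guard (occ πs) (signℚ (Φ (ρ , πs)))))))
      ≡⟨ guard-∧ (size ρ ≤ᵇ n) (capacity ρ ≤ᵇ r) _ ⟩
    guard (relevant n 1≤n r ρ) (∑ Fs (λ πs → guard par (guard (occ πs) (signℚ (Φ (ρ , πs))))))
      ≡⟨ cong (guard (relevant n 1≤n r ρ)) (trans (sym (guard-∑ par Fs _)) (cong (guard par) (sym (∑-filterᵇ occ Fs _)))) ⟩
    guard (relevant n 1≤n r ρ) (guard par (∑ (blocksFor n 1≤n r ρ) (λ πs → signℚ (Φ (ρ , πs)))))
      ≡⟨ guard-swap (relevant n 1≤n r ρ) par _ ⟩
    guard par (guard (relevant n 1≤n r ρ) (∑ (blocksFor n 1≤n r ρ) (λ πs → signℚ (Φ (ρ , πs))))) ∎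
    where
    Fs = fillings (f ρ) (n ∸ size ρ)
    occ : List Word → Bool
    occ πs = total n132 πs ≡ᵇ r ∸ capacity ρ
    per-πs : size ρ ≤ n → ∀ πs → πs ∈ Fs → guard (occ πs) (guard (eqᵇ (odd (ones (parities πs) + size ρ)) (odd a)) (zρ ρ (parities πs)) *ℚ signs πs)
           ≡ guard par (guard (occ πs) (signℚ (Φ (ρ , πs))))
    per-πs s≤n πs πs∈ = trans (cong (guard (occ πs)) (trans (guard-*ʳ _ (signs πs) (zρ ρ (parities πs)))
        (cong₂ (λ b x → guard (eqᵇ b (odd a)) x) (F.Φ-parity πs πs∈) (F.Φ-sign πs πs∈))))
      (guard-swap (occ πs) par _)
      where
      module F = Fill n ρ (∈-K⁻ t ρ (m≤n+m 1 (2 * r)) ρ∈) s≤n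

-- Kernel shapes are nonempty, so each summand is divisible by x.
RHS-0 : ∀ a r → RHS a r 0 ≡ 0ℚ
RHS-0 a r = trans (RHS-∑ a r 0) (∑-0 (K (2 * r + 1)) λ ρ ρ∈ →
  cong (λ b → guard b (inner a r ρ (0 ∸ size ρ))) (≤ᵇ-false (KernelPerm.nonempty (∈-K⁻ (2 * r + 1) ρ (m≤n+m 1 (2 * r)) ρ∈))))

-- The empty permutation contributes 1 when r = 0. For a = 1 it cancels against its copy at -x, and
-- for a = 0 the delta removes it; larger even a would leave it uncancelled.
LHS-0 : ∀ a r → a ≤ 1 → LHS a r 0 ≡ 0ℚ
LHS-0 zero       zero    _ = refl
LHS-0 (suc zero) zero    _ = refl
LHS-0 zero       (suc r) _ = refl
LHS-0 (suc zero) (suc r) _ = refl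
LHS-0 (suc (suc a)) r (s≤s ())

LHS-M : ∀ a r n → LHS a r (suc n) ≡ guard (eqᵇ (odd (suc n)) (odd a)) (M r (suc n))
LHS-M a r n = trans (cong (λ d → ½ *ℚ (M r N +ℚ sgnℚ a *ℚ (sgnℚ N *ℚ M r N)) -ℚ d) (delta r a))
  (trans (cong₂ (λ x y → ½ *ℚ (M r N +ℚ x *ℚ (y *ℚ M r N)) -ℚ 0ℚ) (sgnℚ-odd a) (sgnℚ-odd N)) (go (odd a) (odd N) (M r N)))
  where
  N = suc n
  delta : ∀ r a → deltaS r a N ≡ 0ℚ
  delta zero    zero    = refl
  delta zero    (suc a) = refl
  delta (suc r) a       = refl
  sg : Bool → ℚ
  sg b = if b then -ℚ 1ℚ else 1ℚ
  open ℚ-Solver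
  go : ∀ b c x → ½ *ℚ (x +ℚ sg b *ℚ (sg c *ℚ x)) -ℚ 0ℚ ≡ guard (eqᵇ c b) x
  go true  true  = solve 1 (λ x → con ½ :* (x :+ con (-ℚ 1ℚ) :* (con (-ℚ 1ℚ) :* x)) :- con 0ℚ := x) refl
  go true  false = solve 1 (λ x → con ½ :* (x :+ con (-ℚ 1ℚ) :* (con 1ℚ :* x)) :- con 0ℚ := con 0ℚ) refl
  go false true  = solve 1 (λ x → con ½ :* (x :+ con 1ℚ :* (con (-ℚ 1ℚ) :* x)) :- con 0ℚ := con 0ℚ) refl
  go false false = solve 1 (λ x → con ½ :* (x :+ con 1ℚ :* (con 1ℚ :* x)) :- con 0ℚ := x) refl

theorem8 : (a r : ℕ) → a ≤ 1 → (n : ℕ) → LHS a r n ≡ RHS a r n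
theorem8 a r a≤1 zero    = trans (LHS-0 a r a≤1) (sym (RHS-0 a r))
theorem8 a r a≤1 (suc n) = trans (LHS-M a r n) (sym (RHS-M a r (suc n) (s≤s z≤n)))
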